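{- Let $N \cong \mathbb{Z}^2$ be a lattice of rank $2$, let $\Delta \subseteq N_{\mathbb{R}}$ be an LDP polygon, and let $\sigma \in \Sigma_\Delta[2]$ be a $2$-dimensional cone of the spanning fan $\Sigma_\Delta$ of $\Delta$. Then $$12\sum_{n\in \nabla_\sigma^{\circ} \cap N}(\kappa(n)+1)^2 = v\left(\nabla_\sigma \setminus \mathrm{sail}_\sigma \right)+ \sum_{i=1}^{k_\sigma-1} v\bigl(\mathrm{conv}(m_\sigma, m_{\sigma,i}, m_{\sigma,i+1})\bigr),$$ where $\kappa = \kappa_\Delta|_{\sigma}$ is the linear function given as the restriction to $\sigma$ of the piecewise linear function $\kappa_\Delta \colon N_{\mathbb{R}} \to \mathbb{R}$, $x \mapsto -\min\{\lambda \in \mathbb{R}_{\geq 0} \mid x \in \lambda\Delta\}$.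
   Context: Let $N$ be a free abelian group of rank $2$, $M = \mathrm{Hom}(N,\mathbb{Z})$, $N_{\mathbb{R}} = N\otimes_{\mathbb{Z}}\mathbb{R}$, $M_{\mathbb{R}} = M\otimes_{\mathbb{Z}}\mathbb{R}$, with natural pairing $\langle\cdot,\cdot\rangle \colon M_{\mathbb{R}}\times N_{\mathbb{R}}\to\mathbb{R}$. An LDP polygon is a $2$-dimensional convex polygon $\Delta \subseteq N_{\mathbb{R}}$ whose vertices are primitive lattice points of $N$ and which contains the origin in its interior. Its spanning fan $\Sigma_\Delta$ consists of the cones $\mathbb{R}_{\ge 0}\theta$ over the (proper) faces $\theta$ of $\Delta$; $\Sigma_\Delta[2]$ is the set of its $2$-dimensional cones, i.e. the cones over the edges of $\Delta$. For a $2$-dimensional cone $\sigma \in \Sigma_\Delta[2]$ with primitive ray generators $u_1,u_2 \in N$ (which are the endpoints of the corresponding edge of $\Delta$): - $\nabla_\sigma = \mathrm{conv}(0,u_1,u_2)$, and $\nabla_\sigma^\circ$ is its (relative) interior. The function $\kappa$ is linear on $\sigma$ with $\kappa(u_1)=\kappa(u_2)=-1$. - $\mathrm{sail}_\sigma = \nabla_\sigma \setminus \mathrm{conv}\bigl((\nabla_\sigma\cap N)\setminus\{0\}\bigr)$, so that $\nabla_\sigma\setminus \mathrm{sail}_\sigma = \mathrm{conv}\bigl((\nabla_\sigma\cap N)\setminus\{0\}\bigr)$. Its closure is denoted $\overline{\mathrm{sail}}_\sigma$. - The nonzero lattice points of $\overline{\mathrm{sail}}_\sigma$ (all of which lie on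 its boundary), ordered consecutively from $u_2$ to $u_1$, are denoted $p_0=u_2,p_1,\dots,p_{k_\sigma}=u_1$. The rays through them subdivide $\sigma$ into $k_\sigma$ unimodular cones $\sigma_i=\mathrm{cone}(p_{i-1},p_i)$, $i=1,\dots,k_\sigma$ (unimodular means that the primitive generators form a $\mathbb{Z}$-basis of $N$). - $m_\sigma\in M_{\mathbb{R}}$ is the unique vector with $\langle m_\sigma,u_1\rangle=\langle m_\sigma,u_2\rangle=-1$, and for $i=1,\dots,k_\sigma$, $m_{\sigma,i}\in M$ is the unique vector with $\langle m_{\sigma,i},p_{i-1}\rangle=\langle m_{\sigma,i},p_i\rangle=-1$. The normalized volume $v(P)$ is $2$ times the area of $P$, where area in $N_{\mathbb{R}}$ (resp. $M_{\mathbb{R}}$) is normalized so that a fundamental parallelogram of $N$ (resp. $M$) has area $1$; it is $0$ if $P$ is degenerate (of dimension less than $2$). An empty sum is $0$. -}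

module Defs where

open import Data.Fin.Base as Fin using (Fin; fromℕ)
open import Data.Integer.Base as ℤ using (ℤ; 0ℤ)
open import Data.Integer.Coprimality using (Coprime)
open import Data.List.Base using (List; []; _∷_; map; foldr; filter; deduplicate; cartesianProduct)
open import Data.List.Membership.Propositional using (_∈_)
open import Data.List.Relation.Unary.All using (All; all?)
open import Data.List.Relation.Unary.Unique.Propositional using (Unique)
open import Data.Nat.Base using (ℕ; suc)
open import Data.Product.Base using (_×_; _,_; proj₁; proj₂; ∃-syntax)
open import Data.Product.Properties using (≡-dec)
open import Data.Rational.Base using (ℚ; 0ℚ; 1ℚ; _+_; _*_; _-_; -_; _/_; _≤_; _<_; ∣_∣)
open import Data.Rational.Properties as ℚ using (_≤?_)
open import Function.Bundles using (_⇔_)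
open import Level using (0ℓ)
open import Relation.Binary.Definitions using (DecidableEquality)
open import Relation.Binary.PropositionalEquality.Core using (_≡_; _≢_)
open import Relation.Nullary using (¬_)
open import Relation.Nullary.Decidable using (Dec; _×-dec_; _→-dec_; ¬?)
open import Relation.Unary using (Pred)

-- Coordinates are taken in a ℤ-basis of N and in the dual basis of M, so both
-- lattices are ℤ² and the pairing is the dot product.  All points that occur
-- are rational, and the real planes N_ℝ, M_ℝ are represented by their rational
-- points ℚ².

ℤ² ℚ² : Set
ℤ² = ℤ × ℤ
ℚ² = ℚ × ℚ

0ℤ² : ℤ²
0ℤ² = 0ℤ , 0ℤ

0ℚ² : ℚ²
0ℚ² = 0ℚ , 0ℚ

ι : ℤ² → ℚ²
ι (a , b) = a / 1 , b / 1

infixl 6 _⊕_ _⊖_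
infixr 7 _•_

_⊕_ _⊖_ : ℚ² → ℚ² → ℚ²
(a , b) ⊕ (c , d) = a + c , b + d
(a , b) ⊖ (c , d) = a - c , b - d

_•_ : ℚ → ℚ² → ℚ²
r • (a , b) = r * a , r * b

⟨_,_⟩ : ℚ² → ℚ² → ℚ
⟨ (a , b) , (c , d) ⟩ = a * c + b * d

det : ℚ² → ℚ² → ℚ
det (a , b) (c , d) = a * d - b * c

detℤ : ℤ² → ℤ² → ℤ
detℤ (a , b) (c , d) = a ℤ.* d ℤ.- b ℤ.* c

sumℚ : List ℚ → ℚ
sumℚ = foldr _+_ 0ℚ

sumℚ² : List ℚ² → ℚ²
sumℚ² = foldr _⊕_ 0ℚ²

-- Finite sets are presented by duplicate-free enumerations.
Enumerates : {A : Set} → List A → Pred A 0ℓ → Set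
Enumerates L P = Unique L × (∀ a → a ∈ L ⇔ P a)

Region : Set₁
Region = Pred ℚ² 0ℓ

-- The list holds the weights and points of a convex combination.
Conv : Region → Region
Conv P x =
  ∃[ ws ] All (λ (w , y) → 0ℚ ≤ w × P y) ws
        × sumℚ (map proj₁ ws) ≡ 1ℚ
        × sumℚ² (map (λ (w , y) → w • y) ws) ≡ x

conv : List ℚ² → Region
conv L = Conv (_∈ L)

-- y is within ε of x in the maximum norm.
Near : ℚ → ℚ² → ℚ² → Set
Near ε (a , b) (c , d) = ∣ c - a ∣ < ε × ∣ d - b ∣ < ε

Interior : Region → Region
Interior P x = ∃[ ε ] 0ℚ < ε × (∀ y → Near ε x y → P y)

Closure : Region → Region
Closure P x = ∀ ε → 0ℚ < ε → ∃[ y ] Near ε x y × P y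

-- F is the face of P on which some linear function attains its maximum over P.
IsFace : Region → Region → Set
IsFace F P =
  ∃[ m ] ∃[ c ] (∀ x → P x → ⟨ m , x ⟩ ≤ c)
              × (∀ x → F x ⇔ (P x × ⟨ m , x ⟩ ≡ c))

Primitive : ℤ² → Set
Primitive (a , b) = Coprime a b

record LDPPolygon : Set where
  field
    vertices : List ℤ²

  Δ : Region
  Δ = conv (map ι vertices)

  field
    vertices-are-vertices : All (λ v → IsFace (conv (ι v ∷ [])) Δ) vertices
    vertices-primitive    : All Primitive vertices
    origin-interior       : Interior Δ 0ℚ²

-- κ_Δ(x) = - min { λ ≥ 0 ∣ x ∈ λΔ }, with r for λ.
IsKappa : LDPPolygon → (ℚ² → ℚ) → Set
IsKappa P κ = ∀ x → x ∈[ - κ x ]Δ × (∀ r → x ∈[ r ]Δ → - κ x ≤ r)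
  where
  open LDPPolygon P
  _∈[_]Δ : ℚ² → ℚ → Set
  x ∈[ r ]Δ = 0ℚ ≤ r × ∃[ y ] Δ y × r • y ≡ x

-- A 2-dimensional cone of the spanning fan, given by the edge it lies over.
record Cone₂ (P : LDPPolygon) : Set where
  open LDPPolygon P
  field
    u₁ u₂        : ℤ²
    u₁≢u₂        : u₁ ≢ u₂
    u₁-primitive : Primitive u₁
    u₂-primitive : Primitive u₂
    edge         : IsFace (conv (ι u₁ ∷ ι u₂ ∷ [])) Δ

  ∇ : Region
  ∇ = conv (0ℚ² ∷ ι u₁ ∷ ι u₂ ∷ [])

  -- ∇ is 2-dimensional, since 0 is interior to Δ; its relative interior is
  -- therefore its interior.
  ∇° : Region
  ∇° = Interior ∇

  NonzeroLatticePoint : Pred ℤ² 0ℓ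
  NonzeroLatticePoint n = ∇ (ι n) × n ≢ 0ℤ²

  Sail : Region
  Sail x = ∇ x × ¬ Conv (λ y → ∃[ n ] NonzeroLatticePoint n × ι n ≡ y) x

  SailPoint : Pred ℤ² 0ℓ
  SailPoint n = Closure Sail (ι n) × n ≢ 0ℤ²

-- The sail points p₀ = u₂, …, p_k = u₁ where k = suc r; here k ≥ 1 because
-- u₁ ≢ u₂.  Consecutive order is the angular order from u₂ to u₁: p j lies
-- strictly on the u₁-side of p i whenever i < j.  The factor detℤ u₂ u₁ makes
-- this independent of the orientation of (u₂ , u₁).
record SailPoints {P : LDPPolygon} (σ : Cone₂ P) (r : ℕ) : Set where
  open Cone₂ σ
  field
    p          : Fin (suc (suc r)) → ℤ²
    p-first    : p Fin.zero ≡ u₂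
    p-last     : p (fromℕ (suc r)) ≡ u₁
    p-complete : ∀ n → SailPoint n ⇔ (∃[ i ] p i ≡ n)
    p-ordered  : ∀ i j → i Fin.< j →
                 0ℤ ℤ.< detℤ u₂ u₁ ℤ.* detℤ (p i) (p j)

-- Twice the signed area of the triangle a b c.
orient : ℚ² → ℚ² → ℚ² → ℚ
orient a b c = det (b ⊖ a) (c ⊖ a)

-- [a , b] is a segment of the counterclockwise boundary of conv S between two
-- consecutive points of S: S lies to the left of the line a b, and no point of
-- S lies strictly between a and b.
BoundarySegment : List ℚ² → ℚ² × ℚ² → Set
BoundarySegment S (a , b) =
  a ≢ b × All (λ c → 0ℚ ≤ orient a b c
                   × (orient a b c ≡ 0ℚ → 0ℚ ≤ ⟨ c ⊖ a , c ⊖ b ⟩)) S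

_≟²_ : DecidableEquality ℚ²
_≟²_ = ≡-dec ℚ._≟_ ℚ._≟_

boundarySegment? : ∀ S e → Dec (BoundarySegment S e)
boundarySegment? S (a , b) =
  ¬? (a ≟² b) ×-dec
  all? (λ c → (0ℚ ≤? orient a b c) ×-dec
              ((orient a b c ℚ.≟ 0ℚ) →-dec (0ℚ ≤? ⟨ c ⊖ a , c ⊖ b ⟩))) S

boundary : List ℚ² → List (ℚ² × ℚ²)
boundary S = filter (boundarySegment? S) (cartesianProduct S′ S′)
  where S′ = deduplicate _≟²_ S

-- The normalized volume v (conv S) of a finite set S: the polygon is cut into
-- the triangles spanned by a point o of S and the boundary segments, and twice
-- their areas are added up.  If S is collinear, every summand is 0.
v-conv : List ℚ² → ℚ
v-conv []        = 0ℚ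
v-conv S@(o ∷ _) = sumℚ (map (λ (a , b) → orient o a b) (boundary S))

{-# OPTIONS --safe #-}

-- Orient the cone so that d = det u v > 0 and let u = q₀, …, q_k = v be its
-- Hirzebruch–Jung chain, q_{i-1} + q_{i+1} = b_i q_i with b_i ≥ 2.  Convexity of
-- the chain identifies it with the list of sail points, so the hull of the
-- nonzero lattice points has normalized volume d - k (subtract k unimodular
-- triangles from ∇) and the dual triangles have volumes (b_i - 2)(1 + κ(q_i)),
-- whose sum telescopes because κ is linear.  On the other side, each value
-- 0 < j < d of det u n is attained by exactly one lattice point n of the
-- half-open strip 0 ≤ det n v < d, namely with det n v = q j mod d for
-- q = det q₁ v, and the symmetry j ↦ d - j turns 12 Σ (1 + κ)² into the Dedekind
-- sum Σ j (q j mod d) up to elementary terms.  Reciprocity for Dedekind sums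
-- evaluates it by induction along the chain.
module Submission where

open import Defs
open import Algebra.Properties.AbelianGroup using (∙-cancelˡ)
open import Algebra.Properties.CommutativeSemigroup using () renaming (interchange to +-interchange)
open import Data.Fin.Base as Fin using (Fin; inject₁)
import Data.Fin.Properties as Fin
open import Data.Integer.Base as ℤ using (ℤ; 0ℤ; 1ℤ; +_; -[1+_]; +≤+; +<+)
open import Data.Integer.DivMod using (_/ℕ_; _%ℕ_; n%ℕd<d; a≡a%ℕn+[a/ℕn]*n)
import Data.Integer.Properties as ℤ
open import Data.List.Base using (List; []; _∷_; _++_; map; filter; deduplicate; foldr; tabulate; allFin; applyUpTo; downFrom)
open import Data.List.Membership.Propositional using (_∈_)
open import Data.List.Membership.Propositional.Properties
open import Data.List.Membership.Propositional.Properties.WithK using (unique∧set⇒bag)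
import Data.List.Properties as List
open import Data.List.Relation.Binary.BagAndSetEquality using (∼bag⇒↭)
open import Data.List.Relation.Binary.Permutation.Propositional using (_↭_; ↭⇒↭ₛ)
import Data.List.Relation.Binary.Permutation.Propositional.Properties as ↭
import Data.List.Relation.Binary.Permutation.Setoid.Properties as Permutation
open import Data.List.Relation.Unary.All as All using (All; []; _∷_)
import Data.List.Relation.Unary.All.Properties as All
open import Data.List.Relation.Unary.AllPairs using (AllPairs; []; _∷_)
import Data.List.Relation.Unary.AllPairs.Properties as AllPairs
open import Data.List.Relation.Unary.Any using (here; there)
open import Data.List.Relation.Unary.Unique.DecPropositional.Properties _≟²_ using (deduplicate-!)
open import Data.List.Relation.Unary.Unique.Propositional using (Unique)
open import Data.List.Relation.Unary.Unique.Propositional.Properties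
  using (map⁺; ++⁺; filter⁺; cartesianProduct⁺; applyUpTo⁺₁; applyDownFrom⁺₁; downFrom⁺; allFin⁺)
open import Data.Nat.Base as ℕ using (ℕ; zero; suc; z≤n; s≤s; _%_)
open import Data.Nat.Coprimality using (coprime-Bézout; coprime-/gcd) renaming (Coprime to Coprimeℕ)
open import Data.Nat.Divisibility using (_∣_; divides; m%n≡0⇒n∣m; n∣m⇒m%n≡0; n∣m*n; m∣m*n; ∣n⇒∣m*n; ∣m⇒∣m*n)
open import Data.Nat.DivMod using (m/n*n≡m)
import Data.Nat.DivMod as ℕ
open import Data.Nat.GCD using (gcd; gcd[m,n]∣m; gcd[m,n]∣n; gcd[m,n]≡0⇒m≡0; gcd[m,n]≡0⇒n≡0; module Bézout)
import Data.Nat.Properties as ℕ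
open import Data.Product.Base using (_×_; _,_; proj₁; proj₂; ∃-syntax) renaming (swap to ×-swap)
open import Data.Rational.Base as ℚ using (ℚ; 0ℚ; 1ℚ; toℚᵘ)
import Data.Rational.Properties as ℚ
open import Data.Rational.Unnormalised.Base as ℚᵘ using (mkℚᵘ; *≤*; *<*)
import Data.Rational.Unnormalised.Properties as ℚᵘ
import Data.Sign.Base as Sign
import Data.Sign.Properties as Sign
open import Data.Sum.Base using (_⊎_; inj₁; inj₂)
open import Function.Base using (_∘_; id; case_of_)
open import Function.Bundles using (_⇔_; mk⇔; Equivalence)
open import Level using (0ℓ)
open import Relation.Binary.Definitions using (tri<; tri≈; tri>)
open import Relation.Binary.PropositionalEquality hiding ([_])
open import Relation.Nullary using (¬_; Dec; yes; no; contradiction)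
open import Relation.Nullary.Decidable using (dec⇒maybe)
open import Tactic.RingSolver using (solve-∀)
open import Tactic.RingSolver.Core.AlmostCommutativeRing using (AlmostCommutativeRing; fromCommutativeRing)
open import Tactic.RingSolver.Core.Expression using (Expr) renaming (_⊕_ to _:+_; _⊗_ to _:*_; ⊝_ to :-_; Κ to con)

-- A lattice point n enters only through α = det n v and β = det u n: then d (1 + κ(n)) = d - (α +
-- β) is an integer, and d² times the theorem is an identity in ℤ. Both sides, multiplied by d once,
-- equal d² + 2 + d (Σ (b_i - 2) - k - 2) + q + q*, where q* = det u w for the penultimate point w
-- of the chain. The Plücker relation shows that q* inverts q modulo d, and a chain without its
-- first point has the same w, so the inverses needed in the induction come with the chain. In these
-- terms the Dedekind sum has the classical value 12 s(q, d) = Σ (b_i - 3) + (q + q*) / d, hence the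
-- factor 12. Sail points, interior points, lattice points and boundary segments are all given by
-- predicates or arbitrary enumerations. The geometric work is therefore to show that each of these
-- sets is exactly one that is built from the chain.

ℤ-ring ℚ-ring : AlmostCommutativeRing 0ℓ 0ℓ
ℤ-ring = fromCommutativeRing ℤ.+-*-commutativeRing (λ x → dec⇒maybe (0ℤ ℤ.≟ x))
ℚ-ring = fromCommutativeRing ℚ.+-*-commutativeRing (λ x → dec⇒maybe (0ℚ ℚ.≟ x))

open import Tactic.RingSolver.NonReflective ℤ-ring using () renaming (solve to solveℤ)

infixl 6 _:-_
infix 4 _:=_

_:=_ : ∀ {a n} {A : Set a} → Expr A n → Expr A n → Expr A n × Expr A n
_:=_ = _,_

_:-_ : ∀ {a n} {A : Set a} → Expr A n → Expr A n → Expr A n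
x :- y = x :+ (:- y)

:det : ∀ {a n} {A : Set a} → Expr A n × Expr A n → Expr A n × Expr A n → Expr A n
:det (a , b) (c , d) = a :* d :- b :* c

plucker : ∀ a b c d → detℤ a b ℤ.* detℤ c d ℤ.- detℤ a c ℤ.* detℤ b d ℤ.+ detℤ a d ℤ.* detℤ b c ≡ 0ℤ
plucker (a , a′) (b , b′) (c , c′) (d , d′) = solveℤ 8
  (λ a a′ b b′ c c′ d d′ → let A = (a , a′); B = (b , b′); C = (c , c′); D = (d , d′) in
    (:det A B :* :det C D) :- (:det A C :* :det B D) :+ (:det A D :* :det B C) := con 0ℤ) refl a a′ b b′ c c′ d d′

sumℤ : List ℤ → ℤ
sumℤ = foldr ℤ._+_ 0ℤ

-- This makes sums independent of the enumeration: a sum over any duplicate-free list can be moved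
-- to a list with the same elements that suits the computation.
unique⇒↭ : {A : Set} {xs ys : List A} → Unique xs → Unique ys → (∀ {x} → x ∈ xs ⇔ x ∈ ys) → xs ↭ ys
unique⇒↭ xs! ys! xs≈ys = ∼bag⇒↭ (unique∧set⇒bag xs! ys! xs≈ys)

sumℤ-↭ : {A : Set} {xs ys : List A} (f : A → ℤ) → xs ↭ ys → sumℤ (map f xs) ≡ sumℤ (map f ys)
sumℤ-↭ f xs↭ys = Permutation.foldr-commMonoid (setoid ℤ) ℤ.+-0-isCommutativeMonoid (↭⇒↭ₛ (↭.map⁺ f xs↭ys))

sumℚ-↭ : {A : Set} {xs ys : List A} (f : A → ℚ) → xs ↭ ys → sumℚ (map f xs) ≡ sumℚ (map f ys)
sumℚ-↭ f xs↭ys = Permutation.foldr-commMonoid (setoid ℚ) ℚ.+-0-isCommutativeMonoid (↭⇒↭ₛ (↭.map⁺ f xs↭ys))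

-- Ordered-ring arithmetic in ℤ and ℚ.

module ℤO where
  open import Data.Integer.Base using (_+_; _*_; _-_; -_; _≤_; _<_)

  diff : ∀ {a b} → a ≤ b → 0ℤ ≤ b - a
  diff = ℤ.i≤j⇒0≤j-i

  undiff : ∀ {a b} → 0ℤ ≤ b - a → a ≤ b
  undiff = ℤ.0≤i-j⇒j≤i

  diff< : ∀ {a b} → a < b → 0ℤ < b - a
  diff< {a} {b} a<b = subst (_< b - a) (ℤ.+-inverseʳ a) (ℤ.+-monoˡ-< (- a) a<b)

  undiff< : ∀ {a b} → 0ℤ < b - a → a < b
  undiff< {a} {b} 0<b-a = subst₂ _<_ (ℤ.+-identityˡ a) (poly a b) (ℤ.+-monoˡ-< a 0<b-a)
    where
    poly : ∀ a b → b - a + a ≡ b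
    poly = solve-∀ ℤ-ring

  0≤+ : ∀ {a b} → 0ℤ ≤ a → 0ℤ ≤ b → 0ℤ ≤ a + b
  0≤+ = ℤ.+-mono-≤

  0<+ : ∀ {a b} → 0ℤ < a → 0ℤ ≤ b → 0ℤ < a + b
  0<+ = ℤ.+-mono-<-≤

  0≤* : ∀ {a b} → 0ℤ ≤ a → 0ℤ ≤ b → 0ℤ ≤ a * b
  0≤* {a} {b} 0≤a 0≤b = subst (_≤ a * b) (ℤ.*-zeroʳ a) (ℤ.*-monoˡ-≤-nonNeg a {{ℤ.nonNegative 0≤a}} 0≤b)

  0<* : ∀ {a b} → 0ℤ < a → 0ℤ < b → 0ℤ < a * b
  0<* {a} {b} 0<a 0<b = subst (_< a * b) (ℤ.*-zeroʳ a) (ℤ.*-monoˡ-<-pos a {{ℤ.positive 0<a}} 0<b)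

  0≤-cancel : ∀ {a b} → 0ℤ < a → 0ℤ ≤ a * b → 0ℤ ≤ b
  0≤-cancel {a} {b} 0<a 0≤ab =
    ℤ.*-cancelˡ-≤-pos 0ℤ b a {{ℤ.positive 0<a}} (subst (_≤ a * b) (sym (ℤ.*-zeroʳ a)) 0≤ab)

  0<-cancel : ∀ {a b} → 0ℤ ≤ a → 0ℤ < a * b → 0ℤ < b
  0<-cancel {a} {b} 0≤a 0<ab =
    ℤ.*-cancelˡ-<-nonNeg a {{ℤ.nonNegative 0≤a}} (subst (_< a * b) (sym (ℤ.*-zeroʳ a)) 0<ab)

  0<⇒1≤ : ∀ {a} → 0ℤ < a → 1ℤ ≤ a
  0<⇒1≤ = ℤ.i<j⇒suc[i]≤j

  -- There is no integer strictly between 0 and 1.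
  0≤t[t-1] : ∀ t → 0ℤ ≤ t * (t - 1ℤ)
  0≤t[t-1] (+ 0)      = ℤ.≤-refl
  0≤t[t-1] (+ suc n)  = 0≤* {+ suc n} (ℤ.+≤+ ℕ.z≤n) (ℤ.+≤+ ℕ.z≤n)
  0≤t[t-1] -[1+ n ]   = ℤ.+≤+ ℕ.z≤n

module ℚO where
  open import Data.Rational.Base using (_+_; _*_; _-_; -_; _≤_; _<_)

  diff : ∀ {a b} → a ≤ b → 0ℚ ≤ b - a
  diff {a} {b} a≤b = subst (_≤ b - a) (ℚ.+-inverseʳ a) (ℚ.+-monoˡ-≤ (- a) a≤b)

  undiff : ∀ {a b} → 0ℚ ≤ b - a → a ≤ b
  undiff {a} {b} 0≤b-a = subst₂ _≤_ (ℚ.+-identityˡ a) (poly a b) (ℚ.+-monoˡ-≤ a 0≤b-a)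
    where
    poly : ∀ a b → b - a + a ≡ b
    poly = solve-∀ ℚ-ring

  diff< : ∀ {a b} → a < b → 0ℚ < b - a
  diff< {a} {b} a<b = subst (_< b - a) (ℚ.+-inverseʳ a) (ℚ.+-monoˡ-< (- a) a<b)

  undiff< : ∀ {a b} → 0ℚ < b - a → a < b
  undiff< {a} {b} 0<b-a = subst₂ _<_ (ℚ.+-identityˡ a) (poly a b) (ℚ.+-monoˡ-< a 0<b-a)
    where
    poly : ∀ a b → b - a + a ≡ b
    poly = solve-∀ ℚ-ring

  0≤+ : ∀ {a b} → 0ℚ ≤ a → 0ℚ ≤ b → 0ℚ ≤ a + b
  0≤+ = ℚ.+-mono-≤

  0<+ : ∀ {a b} → 0ℚ < a → 0ℚ ≤ b → 0ℚ < a + b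
  0<+ = ℚ.+-mono-<-≤

  0≤* : ∀ {a b} → 0ℚ ≤ a → 0ℚ ≤ b → 0ℚ ≤ a * b
  0≤* {a} {b} 0≤a 0≤b = subst (_≤ a * b) (ℚ.*-zeroʳ a) (ℚ.*-monoˡ-≤-nonNeg a {{ℚ.nonNegative 0≤a}} 0≤b)

  0<* : ∀ {a b} → 0ℚ < a → 0ℚ < b → 0ℚ < a * b
  0<* {a} {b} 0<a 0<b = subst (_< a * b) (ℚ.*-zeroʳ a) (ℚ.*-monoʳ-<-pos a {{ℚ.positive 0<a}} 0<b)

  0≤-cancel : ∀ {a b} → 0ℚ < a → 0ℚ ≤ a * b → 0ℚ ≤ b
  0≤-cancel {a} {b} 0<a 0≤ab =
    ℚ.*-cancelˡ-≤-pos a {{ℚ.positive 0<a}} (subst (_≤ a * b) (sym (ℚ.*-zeroʳ a)) 0≤ab)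

  0<-cancel : ∀ {a b} → 0ℚ ≤ a → 0ℚ < a * b → 0ℚ < b
  0<-cancel {a} {b} 0≤a 0<ab =
    ℚ.*-cancelˡ-<-nonNeg a {{ℚ.nonNegative 0≤a}} (subst (_< a * b) (sym (ℚ.*-zeroʳ a)) 0<ab)

  0≤sq : ∀ a → 0ℚ ≤ a * a
  0≤sq a with ℚ.≤-total 0ℚ a
  ... | inj₁ 0≤a = 0≤* 0≤a 0≤a
  ... | inj₂ a≤0 = subst (0ℚ ≤_) (poly a) (0≤* (diff a≤0) (diff a≤0))
    where
    poly : ∀ a → (0ℚ - a) * (0ℚ - a) ≡ a * a
    poly = solve-∀ ℚ-ring

  0<sq : ∀ {a} → a ≢ 0ℚ → 0ℚ < a * a
  0<sq {a} a≢0 with ℚ.<-cmp 0ℚ a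
  ... | tri< 0<a _ _ = 0<* 0<a 0<a
  ... | tri≈ _ 0≡a _ = contradiction (sym 0≡a) a≢0
  ... | tri> _ _ a<0 = subst (0ℚ <_) (poly a) (0<* (diff< a<0) (diff< a<0))
    where
    poly : ∀ a → (0ℚ - a) * (0ℚ - a) ≡ a * a
    poly = solve-∀ ℚ-ring

  ≤∧≢⇒< : ∀ {a b} → a ≤ b → a ≢ b → a < b
  ≤∧≢⇒< a≤b a≢b = ℚ.≰⇒> (λ b≤a → a≢b (ℚ.≤-antisym a≤b b≤a))

  *-cancel : ∀ {a b c} → 0ℚ < a → a * b ≡ a * c → b ≡ c
  *-cancel {a} 0<a eq = ℚ.≤-antisym
    (ℚ.*-cancelˡ-≤-pos a {{ℚ.positive 0<a}} (ℚ.≤-reflexive eq))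
    (ℚ.*-cancelˡ-≤-pos a {{ℚ.positive 0<a}} (ℚ.≤-reflexive (sym eq)))

-- The embedding of ℤ in ℚ.

fromℤ : ℤ → ℚ
fromℤ z = z ℚ./ 1

toℚᵘ-fromℤ : ∀ z → toℚᵘ (fromℤ z) ℚᵘ.≃ mkℚᵘ z 0
toℚᵘ-fromℤ z = ℚ.toℚᵘ-fromℚᵘ (mkℚᵘ z 0)

fromℤ-+ : ∀ a b → fromℤ (a ℤ.+ b) ≡ fromℤ a ℚ.+ fromℤ b
fromℤ-+ a b = ℚ.toℚᵘ-injective (ℚᵘ.≃-trans (toℚᵘ-fromℤ (a ℤ.+ b)) (ℚᵘ.≃-trans
  (ℚᵘ.*≡* (poly a b))
  (ℚᵘ.≃-sym (ℚᵘ.≃-trans (ℚ.toℚᵘ-homo-+ (fromℤ a) (fromℤ b)) (ℚᵘ.+-cong (toℚᵘ-fromℤ a) (toℚᵘ-fromℤ b))))))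
  where
  poly : ∀ a b → (a ℤ.+ b) ℤ.* (1ℤ ℤ.* 1ℤ) ≡ (a ℤ.* 1ℤ ℤ.+ b ℤ.* 1ℤ) ℤ.* 1ℤ
  poly = solve-∀ ℤ-ring

fromℤ-* : ∀ a b → fromℤ (a ℤ.* b) ≡ fromℤ a ℚ.* fromℤ b
fromℤ-* a b = ℚ.toℚᵘ-injective (ℚᵘ.≃-trans (toℚᵘ-fromℤ (a ℤ.* b)) (ℚᵘ.≃-trans
  (ℚᵘ.*≡* (poly a b))
  (ℚᵘ.≃-sym (ℚᵘ.≃-trans (ℚ.toℚᵘ-homo-* (fromℤ a) (fromℤ b)) (ℚᵘ.*-cong (toℚᵘ-fromℤ a) (toℚᵘ-fromℤ b))))))
  where
  poly : ∀ a b → a ℤ.* b ℤ.* (1ℤ ℤ.* 1ℤ) ≡ a ℤ.* b ℤ.* 1ℤ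
  poly = solve-∀ ℤ-ring

fromℤ-neg : ∀ a → fromℤ (ℤ.- a) ≡ ℚ.- fromℤ a
fromℤ-neg a = ℚ.toℚᵘ-injective (ℚᵘ.≃-trans (toℚᵘ-fromℤ (ℤ.- a))
  (ℚᵘ.≃-sym (ℚᵘ.≃-trans (ℚ.toℚᵘ-homo‿- (fromℤ a)) (ℚᵘ.-‿cong (toℚᵘ-fromℤ a)))))

fromℤ-- : ∀ a b → fromℤ (a ℤ.- b) ≡ fromℤ a ℚ.- fromℤ b
fromℤ-- a b = trans (fromℤ-+ a (ℤ.- b)) (cong (ℚ._+_ (fromℤ a)) (fromℤ-neg b))

fromℤ-mono-≤ : ∀ {a b} → a ℤ.≤ b → fromℤ a ℚ.≤ fromℤ b
fromℤ-mono-≤ {a} {b} a≤b = ℚ.toℚᵘ-cancel-≤ (ℚᵘ.≤-respʳ-≃ (ℚᵘ.≃-sym (toℚᵘ-fromℤ b))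
  (ℚᵘ.≤-respˡ-≃ (ℚᵘ.≃-sym (toℚᵘ-fromℤ a)) (*≤* (ℤ.*-monoʳ-≤-nonNeg 1ℤ a≤b))))

fromℤ-cancel-≤ : ∀ {a b} → fromℤ a ℚ.≤ fromℤ b → a ℤ.≤ b
fromℤ-cancel-≤ {a} {b} le = ℤ.*-cancelʳ-≤-pos a b 1ℤ (ℚᵘ.drop-*≤* (ℚᵘ.≤-respʳ-≃ (toℚᵘ-fromℤ b)
  (ℚᵘ.≤-respˡ-≃ (toℚᵘ-fromℤ a) (ℚ.toℚᵘ-mono-≤ le))))

fromℤ-mono-< : ∀ {a b} → a ℤ.< b → fromℤ a ℚ.< fromℤ b
fromℤ-mono-< {a} {b} a<b = ℚ.toℚᵘ-cancel-< (ℚᵘ.<-respʳ-≃ (ℚᵘ.≃-sym (toℚᵘ-fromℤ b))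
  (ℚᵘ.<-respˡ-≃ (ℚᵘ.≃-sym (toℚᵘ-fromℤ a)) (*<* (ℤ.*-monoʳ-<-pos 1ℤ a<b))))

fromℤ-cancel-< : ∀ {a b} → fromℤ a ℚ.< fromℤ b → a ℤ.< b
fromℤ-cancel-< {a} {b} lt = ℤ.*-cancelʳ-<-nonNeg 1ℤ (ℚᵘ.drop-*<* (ℚᵘ.<-respʳ-≃ (toℚᵘ-fromℤ b)
  (ℚᵘ.<-respˡ-≃ (toℚᵘ-fromℤ a) (ℚ.toℚᵘ-mono-< lt))))

fromℤ-injective : ∀ {a b} → fromℤ a ≡ fromℤ b → a ≡ b
fromℤ-injective eq = ℤ.≤-antisym (fromℤ-cancel-≤ (ℚ.≤-reflexive eq)) (fromℤ-cancel-≤ (ℚ.≤-reflexive (sym eq)))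

ι-injective : ∀ {x y} → ι x ≡ ι y → x ≡ y
ι-injective eq = cong₂ _,_ (fromℤ-injective (cong proj₁ eq)) (fromℤ-injective (cong proj₂ eq))

-- Dedekind sums and their reciprocity.

module Dedekind where
  open import Data.Integer.Base using (_+_; _*_; -_; _-_; _≤_; _<_)

  ∑ : ℕ → (ℕ → ℤ) → ℤ
  ∑ n f = sumℤ (map f (downFrom n))

  ∑-cong : ∀ n {f g : ℕ → ℤ} → (∀ {i} → i ℕ.< n → f i ≡ g i) → ∑ n f ≡ ∑ n g
  ∑-cong zero    eq = refl
  ∑-cong (suc n) eq = cong₂ _+_ (eq (ℕ.n<1+n n)) (∑-cong n (λ i<n → eq (ℕ.m<n⇒m<1+n i<n)))

  ∑-+ : ∀ n f g → ∑ n (λ i → f i + g i) ≡ ∑ n f + ∑ n g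
  ∑-+ zero    f g = refl
  ∑-+ (suc n) f g rewrite ∑-+ n f g = interchange (f n) (g n) (∑ n f) (∑ n g)
    where
    interchange : ∀ a b c d → a + b + (c + d) ≡ a + c + (b + d)
    interchange = solve-∀ ℤ-ring

  ∑-* : ∀ n c f → ∑ n (λ i → c * f i) ≡ c * ∑ n f
  ∑-* zero    c f = sym (ℤ.*-zeroʳ c)
  ∑-* (suc n) c f rewrite ∑-* n c f = sym (ℤ.*-distribˡ-+ c (f n) (∑ n f))

  ∑-0 : ∀ n → ∑ n (λ _ → 0ℤ) ≡ 0ℤ
  ∑-0 zero    = refl
  ∑-0 (suc n) = trans (ℤ.+-identityˡ _) (∑-0 n)

  ∑-const : ∀ n c → ∑ n (λ _ → c) ≡ + n * c
  ∑-const zero    c = refl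
  ∑-const (suc n) c rewrite ∑-const n c = sym (ℤ.suc-* (+ n) c)

  ∑-swap : ∀ m n (f : ℕ → ℕ → ℤ) → ∑ m (λ i → ∑ n (f i)) ≡ ∑ n (λ j → ∑ m (λ i → f i j))
  ∑-swap zero    n f = sym (∑-0 n)
  ∑-swap (suc m) n f rewrite ∑-swap m n f = sym (∑-+ n (f m) (λ j → ∑ m (λ i → f i j)))

  ∑-front : ∀ n (f : ℕ → ℤ) → ∑ (suc n) f ≡ f 0 + ∑ n (λ i → f (suc i))
  ∑-front zero    f = refl
  ∑-front (suc n) f rewrite ∑-front n f = swap (f (suc n)) (f 0) _
    where
    swap : ∀ a b c → a + (b + c) ≡ b + (a + c)
    swap = solve-∀ ℤ-ring

  -- With d = n + 1 and j = `suc i` this is the substitution j ↦ d - j on the range 0 < j < d.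
  ∑-reflect : ∀ n (f : ℕ → ℤ) → ∑ n (λ i → f (suc i)) ≡ ∑ n (λ i → f (n ℕ.∸ i))
  ∑-reflect zero    f = refl
  ∑-reflect (suc n) f =
    trans (cong (_+_ (f (suc n))) (∑-reflect n f)) (sym (∑-front n (λ i → f (suc n ℕ.∸ i))))

  ∑-linear : ∀ n → + 2 * ∑ n (λ i → + suc i) ≡ + n * + suc n
  ∑-linear zero    = refl
  ∑-linear (suc n) = trans (ℤ.*-distribˡ-+ (+ 2) (+ suc n) (∑ n (λ i → + suc i)))
    (trans (cong (_+_ (+ 2 * + suc n)) (∑-linear n)) (poly (+ n)))
    where
    poly : ∀ x → + 2 * (1ℤ + x) + x * (1ℤ + x) ≡ (1ℤ + x) * (+ 2 + x)
    poly = solve-∀ ℤ-ring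

  ∑-squares : ∀ n → + 6 * ∑ n (λ i → + suc i * + suc i) ≡ + n * + suc n * (+ n + + suc n)
  ∑-squares zero    = refl
  ∑-squares (suc n) = trans (ℤ.*-distribˡ-+ (+ 6) (+ suc n * + suc n) (∑ n (λ i → + suc i * + suc i)))
    (trans (cong (_+_ (+ 6 * (+ suc n * + suc n))) (∑-squares n)) (poly (+ n)))
    where
    poly : ∀ x → + 6 * ((1ℤ + x) * (1ℤ + x)) + x * (1ℤ + x) * (x + (1ℤ + x))
               ≡ (1ℤ + x) * (+ 2 + x) * ((1ℤ + x) + (+ 2 + x))
    poly = solve-∀ ℤ-ring

  ∑-odd : ∀ n → ∑ n (λ i → + suc i + + i) ≡ + n * + n
  ∑-odd zero    = refl
  ∑-odd (suc n) = trans (cong (_+_ (+ suc n + + n)) (∑-odd n)) (poly (+ n))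
    where
    poly : ∀ x → (1ℤ + x) + x + x * x ≡ (1ℤ + x) * (1ℤ + x)
    poly = solve-∀ ℤ-ring

  -- The hypothesis makes x an inverse of q modulo d. Invertibility is expressed by x and y, and not
  -- by coprimality, because a chain provides both numbers as determinants.
  residue-inverse : ∀ d q x y .{{_ : ℕ.NonZero d}} → q ℕ.* x ≡ 1 ℕ.+ y ℕ.* d →
                    ∀ {j} → j ℕ.< d → (x ℕ.* ((q ℕ.* j) % d)) % d ≡ j
  residue-inverse d q x y qx≡1 {j} j<d = begin
      (x ℕ.* ((q ℕ.* j) % d)) % d              ≡⟨ ℕ.%-distribˡ-* x ((q ℕ.* j) % d) d ⟩
      (x % d ℕ.* ((q ℕ.* j) % d % d)) % d      ≡⟨ cong (λ z → (x % d ℕ.* z) % d) (ℕ.m%n%n≡m%n (q ℕ.* j) d) ⟩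
      (x % d ℕ.* ((q ℕ.* j) % d)) % d          ≡⟨ ℕ.%-distribˡ-* x (q ℕ.* j) d ⟨
      (x ℕ.* (q ℕ.* j)) % d                    ≡⟨ cong (_% d) (trans (sym (ℕ.*-assoc x q j)) (cong (ℕ._* j) (trans (ℕ.*-comm x q) qx≡1))) ⟩
      (j ℕ.+ y ℕ.* d ℕ.* j) % d                ≡⟨ cong (λ z → (j ℕ.+ z) % d) (trans (ℕ.*-assoc y d j) (trans (cong (y ℕ.*_) (ℕ.*-comm d j)) (sym (ℕ.*-assoc y j d)))) ⟩
      (j ℕ.+ y ℕ.* j ℕ.* d) % d                ≡⟨ ℕ.[m+kn]%n≡m%n j (y ℕ.* j) d ⟩
      j % d                                    ≡⟨ ℕ.m<n⇒m%n≡m j<d ⟩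
      j                                        ∎
    where open ≡-Reasoning

  -- Multiplication by q permutes the residues: it is injective by `residue-inverse`, and surjective
  -- by the same lemma with q and x exchanged.
  ∑-residues : ∀ d q x y .{{_ : ℕ.NonZero d}} → q ℕ.* x ≡ 1 ℕ.+ y ℕ.* d →
               ∀ f → ∑ d (λ j → f ((q ℕ.* j) % d)) ≡ ∑ d f
  ∑-residues d q x y qx≡1 f = begin
    sumℤ (map (f ∘ r) (downFrom d))       ≡⟨ cong sumℤ (List.map-∘ (downFrom d)) ⟩
    sumℤ (map f (map r (downFrom d)))     ≡⟨ sumℤ-↭ f (unique⇒↭ unique (downFrom⁺ d) (mk⇔ to from)) ⟩
    sumℤ (map f (downFrom d))             ∎
    where
    open ≡-Reasoning
    r : ℕ → ℕ
    r j = (q ℕ.* j) % d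
    unique : Unique (map r (downFrom d))
    unique = subst Unique (sym (List.map-downFrom r d)) (applyDownFrom⁺₁ r d λ {i} {j} j<i i<d eq →
      ℕ.<⇒≢ j<i (trans (sym (residue-inverse d q x y qx≡1 (ℕ.<-trans j<i i<d)))
                (trans (cong (λ z → (x ℕ.* z) % d) (sym eq)) (residue-inverse d q x y qx≡1 i<d))))
    to : ∀ {n} → n ∈ map r (downFrom d) → n ∈ downFrom d
    to n∈ with j , _ , refl ← ∈-map⁻ r n∈ = ∈-downFrom⁺ (ℕ.m%n<n (q ℕ.* j) d)
    from : ∀ {n} → n ∈ downFrom d → n ∈ map r (downFrom d)
    from {n} n∈ = subst (_∈ map r (downFrom d))
      (residue-inverse d x q y (trans (ℕ.*-comm x q) qx≡1) (∈-downFrom⁻ n∈))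
      (∈-map⁺ r (∈-downFrom⁺ (ℕ.m%n<n (x ℕ.* n) d)))

  -- The modulus is d = `suc n`, so it is never zero, and a sum over 0 < j < d becomes a sum over i
  -- < n with j = `suc i`.
  residue : ℕ → ℕ → ℕ → ℕ
  residue n q j = (q ℕ.* j) % suc n

  floor : ℕ → ℕ → ℕ → ℕ
  floor n q j = (q ℕ.* j) ℕ./ suc n

  residue-0 : ∀ n q → residue n q 0 ≡ 0
  residue-0 n q rewrite ℕ.*-zeroʳ q = refl

  residue-floor : ∀ n q j → + residue n q j ≡ + q * + j - + floor n q j * + suc n
  residue-floor n q j = begin
    + residue n q j                                              ≡⟨ poly (+ residue n q j) (+ floor n q j * + suc n) ⟩
    (+ residue n q j + + floor n q j * + suc n) - + floor n q j * + suc n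
      ≡⟨ cong (_- + floor n q j * + suc n) (trans (cong (_+_ (+ residue n q j)) (sym (ℤ.pos-* (floor n q j) (suc n))))
           (trans (cong +_ (sym (ℕ.m≡m%n+[m/n]*n (q ℕ.* j) (suc n)))) (ℤ.pos-* q j))) ⟩
    + q * + j - + floor n q j * + suc n                          ∎
    where
    open ≡-Reasoning
    poly : ∀ a b → a ≡ (a + b) - b
    poly = solve-∀ ℤ-ring

  -- The residue 0 is fixed, so the permutation restricts to the nonzero residues.
  ∑₁-residues : ∀ n q x y → q ℕ.* x ≡ 1 ℕ.+ y ℕ.* suc n → ∀ h →
                ∑ n (λ i → h (residue n q (suc i))) ≡ ∑ n (λ i → h (suc i))
  ∑₁-residues n q x y qx≡1 h = ∙-cancelˡ ℤ.+-0-abelianGroup (h 0) _ _ (begin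
    h 0 + ∑ n (λ i → h (residue n q (suc i)))                ≡⟨ cong (λ z → h z + ∑ n (λ i → h (residue n q (suc i)))) (residue-0 n q) ⟨
    h (residue n q 0) + ∑ n (λ i → h (residue n q (suc i)))  ≡⟨ ∑-front n (λ i → h (residue n q i)) ⟨
    ∑ (suc n) (λ i → h (residue n q i))                      ≡⟨ ∑-residues (suc n) q x y qx≡1 h ⟩
    ∑ (suc n) h                                              ≡⟨ ∑-front n h ⟩
    h 0 + ∑ n (λ i → h (suc i))                              ∎)
    where open ≡-Reasoning

  residue≢0 : ∀ n q x y → q ℕ.* x ≡ 1 ℕ.+ y ℕ.* suc n → ∀ {j} → j ℕ.< n → residue n q (suc j) ≢ 0
  residue≢0 n q x y qx≡1 j<n r≡0
    with () ← trans (sym (residue-inverse (suc n) q x y qx≡1 (s≤s j<n)))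
                    (trans (cong (λ z → (x ℕ.* z) % suc n) r≡0) (residue-0 n x))

  -- The Iverson bracket. It turns a floor into a count of lattice points, so that the order of
  -- summation can be exchanged.
  [_<_] : ℕ → ℕ → ℤ
  [ i < k ] with i ℕ.<? k
  ... | yes _ = 1ℤ
  ... | no  _ = 0ℤ

  [<]-true : ∀ {i k} → i ℕ.< k → [ i < k ] ≡ 1ℤ
  [<]-true {i} {k} i<k with i ℕ.<? k
  ... | yes _  = refl
  ... | no i≮k = contradiction i<k i≮k

  [<]-false : ∀ {i k} → ¬ i ℕ.< k → [ i < k ] ≡ 0ℤ
  [<]-false {i} {k} i≮k with i ℕ.<? k
  ... | yes i<k = contradiction i<k i≮k
  ... | no _    = refl

  ∑-[<] : ∀ m k c → k ℕ.≤ m → ∑ m (λ i → [ i < k ] * c i) ≡ ∑ k c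
  ∑-[<] zero    zero c z≤n = refl
  ∑-[<] (suc m) k    c k≤1+m with k ℕ.≤? m
  ... | yes k≤m = begin
    [ m < k ] * c m + ∑ m (λ i → [ i < k ] * c i)  ≡⟨ cong₂ (λ z w → z * c m + w) ([<]-false (ℕ.≤⇒≯ k≤m)) (∑-[<] m k c k≤m) ⟩
    0ℤ * c m + ∑ k c                               ≡⟨ ℤ.+-identityˡ (∑ k c) ⟩
    ∑ k c                                          ∎
    where open ≡-Reasoning
  ... | no k≰m rewrite ℕ.≤-antisym k≤1+m (ℕ.≰⇒> k≰m) =
    ∑-cong (suc m) (λ {i} i<1+m → trans (cong (_* c i) ([<]-true i<1+m)) (ℤ.*-identityˡ (c i)))

  ≤-floor : ∀ n a k → k ℕ.* suc n ℕ.≤ a → k ℕ.≤ a ℕ./ suc n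
  ≤-floor n a k kn≤a = ℕ.≮⇒≥ bad
    where
    bad : ¬ a ℕ./ suc n ℕ.< k
    bad lt = ℕ.<⇒≱ (begin-strict
      a                                     ≡⟨ ℕ.m≡m%n+[m/n]*n a (suc n) ⟩
      a % suc n ℕ.+ (a ℕ./ suc n) ℕ.* suc n  <⟨ ℕ.+-monoˡ-< ((a ℕ./ suc n) ℕ.* suc n) (ℕ.m%n<n a (suc n)) ⟩
      suc n ℕ.+ (a ℕ./ suc n) ℕ.* suc n      ≤⟨ ℕ.*-monoˡ-≤ (suc n) lt ⟩
      k ℕ.* suc n                           ∎) kn≤a
      where open ℕ.≤-Reasoning

  -- The lattice points (j+1, i+1) of the open (n+1) × (m+1) rectangle split into
  -- those below and those above its diagonal.
  diagonal : ∀ n m x y → suc m ℕ.* x ≡ 1 ℕ.+ y ℕ.* suc n → ∀ {i j} → j ℕ.< n →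
             [ i < floor n (suc m) (suc j) ] + [ j < floor m (suc n) (suc i) ] ≡ 1ℤ
  diagonal n m x y qx≡1 {i} {j} j<n
    with i ℕ.<? floor n (suc m) (suc j) | j ℕ.<? floor m (suc n) (suc i)
  ... | yes _ | no _ = refl
  ... | no _ | yes _ = refl
  -- Such a point would lie on the diagonal, (i + 1) (n + 1) = (m + 1) (j + 1), and its residue
  -- would be 0.
  ... | yes i<f | yes j<g = contradiction
    (trans (cong (_% suc n) (ℕ.≤-antisym below above)) (ℕ.m*n%n≡0 (suc i) (suc n)))
    (residue≢0 n (suc m) x y qx≡1 j<n)
    where
    above : suc i ℕ.* suc n ℕ.≤ suc m ℕ.* suc j
    above = ℕ.≤-trans (ℕ.*-monoˡ-≤ (suc n) i<f) (ℕ.m/n*n≤m (suc m ℕ.* suc j) (suc n))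
    below : suc m ℕ.* suc j ℕ.≤ suc i ℕ.* suc n
    below = subst₂ ℕ._≤_ (ℕ.*-comm (suc j) (suc m)) (ℕ.*-comm (suc n) (suc i))
      (ℕ.≤-trans (ℕ.*-monoˡ-≤ (suc m) j<g) (ℕ.m/n*n≤m (suc n ℕ.* suc i) (suc m)))
  ... | no i≮f | no j≮g with ℕ.≤-total (suc i ℕ.* suc n) (suc m ℕ.* suc j)
  ...   | inj₁ le = contradiction (≤-floor n _ _ le) i≮f
  ...   | inj₂ ge = contradiction
    (≤-floor m _ _ (subst₂ ℕ._≤_ (ℕ.*-comm (suc m) (suc j)) (ℕ.*-comm (suc i) (suc n)) ge)) j≮g

  -- A square is a sum of odd numbers, so the first sum gives weight 2 i + 1 to each lattice point
  -- below the diagonal. The second gives the same weight to each point above it. Together they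
  -- cover n columns, each of total weight m².
  ∑-floor² : ∀ n m x y → suc m ℕ.* x ≡ 1 ℕ.+ y ℕ.* suc n →
    ∑ n (λ j → + floor n (suc m) (suc j) * + floor n (suc m) (suc j))
      + ∑ m (λ i → (+ suc i + + i) * + floor m (suc n) (suc i)) ≡ + n * (+ m * + m)
  ∑-floor² n m x y qx≡1 = begin
    ∑ n (λ j → + f j * + f j) + ∑ m (λ i → odd i * + g i)
      ≡⟨ cong₂ _+_ (∑-cong n below) (trans (∑-cong m above) (∑-swap m n _)) ⟩
    ∑ n (λ j → ∑ m (λ i → [ i < f j ] * odd i)) + ∑ n (λ j → ∑ m (λ i → odd i * [ j < g i ]))
      ≡⟨ ∑-+ n _ _ ⟨
    ∑ n (λ j → ∑ m (λ i → [ i < f j ] * odd i) + ∑ m (λ i → odd i * [ j < g i ]))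
      ≡⟨ ∑-cong n (λ j<n → trans (sym (∑-+ m _ _)) (trans (∑-cong m (λ _ → both j<n)) (∑-odd m))) ⟩
    ∑ n (λ _ → + m * + m)
      ≡⟨ ∑-const n (+ m * + m) ⟩
    + n * (+ m * + m) ∎
    where
    open ≡-Reasoning
    f g : ℕ → ℕ
    f j = floor n (suc m) (suc j)
    g i = floor m (suc n) (suc i)
    odd : ℕ → ℤ
    odd i = + suc i + + i
    f≤m : ∀ {j} → j ℕ.< n → f j ℕ.≤ m
    f≤m j<n = ℕ.≤-pred (ℕ.m<n*o⇒m/o<n (ℕ.*-monoʳ-< (suc m) (s≤s j<n)))
    g≤n : ∀ {i} → i ℕ.< m → g i ℕ.≤ n
    g≤n i<m = ℕ.≤-pred (ℕ.m<n*o⇒m/o<n (ℕ.*-monoʳ-< (suc n) (s≤s i<m)))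
    below : ∀ {j} → j ℕ.< n → + f j * + f j ≡ ∑ m (λ i → [ i < f j ] * odd i)
    below {j} j<n = sym (trans (∑-[<] m (f j) odd (f≤m j<n)) (∑-odd (f j)))
    above : ∀ {i} → i ℕ.< m → odd i * + g i ≡ ∑ n (λ j → odd i * [ j < g i ])
    above {i} i<m = sym (trans (∑-* n (odd i) (λ j → [ j < g i ])) (cong (odd i *_)
      (trans (∑-cong n (λ _ → sym (ℤ.*-identityʳ _))) (trans (∑-[<] n (g i) (λ _ → 1ℤ) (g≤n i<m))
      (trans (∑-const (g i) 1ℤ) (ℤ.*-identityʳ _))))))
    factor : ∀ a b c → a * c + c * b ≡ (a + b) * c
    factor = solve-∀ ℤ-ring
    both : ∀ {i j} → j ℕ.< n → [ i < f j ] * odd i + odd i * [ j < g i ] ≡ odd i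
    both {i} {j} j<n = trans (factor [ i < f j ] [ j < g i ] (odd i))
      (trans (cong (_* odd i) (diagonal n m x y qx≡1 j<n)) (ℤ.*-identityˡ (odd i)))

  -- The sum of the two residues is a multiple of d that is positive and less than 2 d.
  %-complement : ∀ d .{{_ : ℕ.NonZero d}} a b → d ∣ a ℕ.+ b → a % d ≢ 0 → a % d ℕ.+ b % d ≡ d
  %-complement d a b d∣a+b a%d≢0 with m%n≡0⇒n∣m (a % d ℕ.+ b % d) d
    (trans (sym (ℕ.%-distribˡ-+ a b d)) (n∣m⇒m%n≡0 (a ℕ.+ b) d d∣a+b))
  ... | divides 0 s≡0 = contradiction (ℕ.m+n≡0⇒m≡0 (a % d) s≡0) a%d≢0
  ... | divides 1 s≡d = trans s≡d (ℕ.+-identityʳ d)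
  ... | divides (suc (suc k)) s≡kd = contradiction (ℕ.+-mono-< (ℕ.m%n<n a d) (ℕ.m%n<n b d))
    (ℕ.≤⇒≯ (begin
      d ℕ.+ d                  ≤⟨ ℕ.m≤m+n (d ℕ.+ d) (k ℕ.* d) ⟩
      d ℕ.+ d ℕ.+ k ℕ.* d      ≡⟨ ℕ.+-assoc d d (k ℕ.* d) ⟩
      d ℕ.+ (d ℕ.+ k ℕ.* d)    ≡⟨ s≡kd ⟨
      a % d ℕ.+ b % d          ∎))
    where open ℕ.≤-Reasoning

  residue-reflect : ∀ n q {j} → j ℕ.< n → residue n q (suc j) ≢ 0 →
                    residue n q (suc j) ℕ.+ residue n q (n ℕ.∸ j) ≡ suc n
  residue-reflect n q {j} j<n r≢0 = %-complement (suc n) (q ℕ.* suc j) (q ℕ.* (n ℕ.∸ j))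
    (subst (suc n ∣_) (sym (trans (sym (ℕ.*-distribˡ-+ q (suc j) (n ℕ.∸ j)))
      (cong (λ z → q ℕ.* suc z) (ℕ.m+[n∸m]≡n (ℕ.<⇒≤ j<n))))) (n∣m*n q))
    r≢0

  -- The residues of q j and q (d - j) add up to d, so twice either sum is n d. Nonvanishing is the
  -- hypothesis because the lemma also serves the other modulus of the reciprocity step, where the
  -- inverse is the negative number -y.
  ∑-residue : ∀ n q → (∀ {j} → j ℕ.< n → residue n q (suc j) ≢ 0) →
              ∑ n (λ i → + residue n q (suc i)) ≡ ∑ n (λ i → + suc i)
  ∑-residue n q r≢0 = ℤ.*-cancelˡ-≡ (+ 2) _ _ (begin
    + 2 * R                                              ≡⟨ double R ⟩
    R + R                                                ≡⟨ cong (_+_ R) (∑-reflect n (λ i → + residue n q i)) ⟩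
    R + ∑ n (λ i → + residue n q (n ℕ.∸ i))              ≡⟨ ∑-+ n _ _ ⟨
    ∑ n (λ i → + residue n q (suc i) + + residue n q (n ℕ.∸ i))
      ≡⟨ ∑-cong n (λ i<n → cong +_ (residue-reflect n q i<n (r≢0 i<n))) ⟩
    ∑ n (λ _ → + suc n)                                  ≡⟨ ∑-const n (+ suc n) ⟩
    + n * + suc n                                        ≡⟨ ∑-linear n ⟨
    + 2 * ∑ n (λ i → + suc i)                            ∎)
    where
    open ≡-Reasoning
    R : ℤ
    R = ∑ n (λ i → + residue n q (suc i))
    double : ∀ a → + 2 * a ≡ a + a
    double = solve-∀ ℤ-ring

  -- For q coprime to d = n + 1 this is d² s(q, d) + d² (d - 1) / 4, with s the classical Dedekind
  -- sum.
  dedekindSum : ℕ → ℕ → ℤ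
  dedekindSum n q = ∑ n (λ i → + suc i * + residue n q (suc i))

  -- Modulo q = m + 1 the hypothesis reads y d ≡ -1, so if q divided d (i + 1) it would divide i +
  -- 1, which is smaller than q.
  coresidue≢0 : ∀ n m x y → suc m ℕ.* x ≡ 1 ℕ.+ y ℕ.* suc n → ∀ {i} → i ℕ.< m → residue m (suc n) (suc i) ≢ 0
  coresidue≢0 n m x y qx≡1 {i} i<m r≡0 = ℕ.<⇒≢ (s≤s z≤n) (sym (begin
    suc i                                             ≡⟨ ℕ.m<n⇒m%n≡m (s≤s i<m) ⟨
    suc i % suc m                                     ≡⟨ ℕ.%-remove-+ʳ (suc i) (∣n⇒∣m*n y (m%n≡0⇒n∣m (suc n ℕ.* suc i) (suc m) r≡0)) ⟨
    (suc i ℕ.+ y ℕ.* (suc n ℕ.* suc i)) % suc m       ≡⟨ cong (_% suc m) (trans (cong (suc i ℕ.+_) (sym (ℕ.*-assoc y (suc n) (suc i)))) (cong (ℕ._* suc i) (sym qx≡1))) ⟩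
    (suc m ℕ.* x ℕ.* suc i) % suc m                   ≡⟨ n∣m⇒m%n≡0 _ _ (∣m⇒∣m*n (suc i) (m∣m*n x)) ⟩
    0                                                 ∎))
    where open ≡-Reasoning

  -- Used for certificates: the difference of the two sides of a claim is written as a combination
  -- of such differences for known equations. The ring solver checks the combination and this lemma
  -- removes its summands.
  vanish : ∀ k {a b} → a ≡ b → k * (a - b) ≡ 0ℤ
  vanish k {a} refl = trans (cong (k *_) (ℤ.+-inverseʳ a)) (ℤ.*-zeroʳ k)

  -- Reciprocity exchanges the sum of q modulo d for that of d modulo q. As q′ ≡ -d modulo q, the
  -- latter is complementary to the sum of q′ modulo q, which belongs to the chain without its first
  -- point. There y plays the part of x, since y q′ ≡ 1 modulo q. Here `b` is the whole coefficient
  -- b_i, not its excess over 2.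
  reciprocity-step : ∀ n m q′ b x y c → suc m ℕ.* x ≡ 1 ℕ.+ y ℕ.* suc n → q′ ℕ.+ suc n ≡ b ℕ.* suc m →
    let d = + suc n; q = + suc m in
    + 12 * dedekindSum m q′ ≡ q * (+ 3 * q * q + q * c + + q′ + + y) →
    + 12 * dedekindSum n (suc m) ≡ d * (+ 3 * d * d + d * (c + + b - + 3) + q + + x)
  -- Reciprocity is a relation between q² G₁ and d² G₂, hence the factor q². The multipliers are
  -- chosen so that A, O, G₂, G₃ and the power sums cancel.
  reciprocity-step n m q′ b x y c qx≡1 q′+d≡bq ih = ℤ.*-cancelˡ-≡ (q * q) _ _
    (ℤ.i-j≡0⇒i≡j _ _ (trans
      (combine (+ n) (+ m) (+ q′) (+ b) (+ x) (+ y) c G₁ G₂ G₃ A O S₁ S₂ₙ S₂ₘ)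
      (cong₂ _+_ (cong₂ _+_ (cong₂ _+_ (cong₂ _+_ (cong₂ _+_ (cong₂ _+_ (cong₂ _+_ (cong₂ _+_ (cong₂ _+_
        (vanish (+ 6 * q) e₁)
        (vanish (q * (q * q + 1ℤ)) (∑-squares n)))
        (vanish (- (+ 6 * q * d * d)) (∑-floor² n m x y qx≡1)))
        (vanish (+ 6 * d * d) e₃))
        (vanish (+ 2 * d * d * d) (∑-squares m)))
        (vanish (- (+ 12 * d * d)) e₄))
        (vanish (d * d) ih))
        (vanish (+ 3 * d * d * (1ℤ - d - + 2 * q)) (∑-linear m)))
        (vanish (d * d * q) e₆))
        (vanish (- (q * d)) e₇))))
    where
    open ≡-Reasoning
    d q G₁ G₂ G₃ A O S₁ S₂ₙ S₂ₘ : ℤ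
    d = + suc n
    q = + suc m
    G₁ = dedekindSum n (suc m)
    G₂ = dedekindSum m (suc n)
    G₃ = dedekindSum m q′
    A = ∑ n (λ j → + floor n (suc m) (suc j) * + floor n (suc m) (suc j))
    O = ∑ m (λ i → (+ suc i + + i) * + floor m (suc n) (suc i))
    S₁ = ∑ m (λ i → + suc i)
    S₂ₙ = ∑ n (λ i → + suc i * + suc i)
    S₂ₘ = ∑ m (λ i → + suc i * + suc i)
    -- The sum of the squares of f d = q j - r, where the r² have the same sum as the j².
    e₁ : d * d * A ≡ q * q * S₂ₙ + S₂ₙ - + 2 * q * G₁
    e₁ = begin
      d * d * A
        ≡⟨ ∑-* n (d * d) _ ⟨
      ∑ n (λ j → d * d * (+ f j * + f j))
        ≡⟨ ∑-cong n (λ {j} _ → square (+ r j) (+ suc j) (+ f j) q d (residue-floor n (suc m) (suc j))) ⟩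
      ∑ n (λ j → q * q * (+ suc j * + suc j) + + r j * + r j + - (+ 2 * q) * (+ suc j * + r j))
        ≡⟨ trans (∑-+ n _ _) (cong₂ _+_ (trans (∑-+ n _ _) (cong₂ _+_ (∑-* n (q * q) _)
             (∑₁-residues n (suc m) x y qx≡1 (λ j → + j * + j)))) (∑-* n (- (+ 2 * q)) _)) ⟩
      q * q * S₂ₙ + S₂ₙ + - (+ 2 * q) * G₁
        ≡⟨ cong (_+_ (q * q * S₂ₙ + S₂ₙ)) (sym (ℤ.neg-distribˡ-* (+ 2 * q) G₁)) ⟩
      q * q * S₂ₙ + S₂ₙ - + 2 * q * G₁ ∎
      where
      f r : ℕ → ℕ
      f j = floor n (suc m) (suc j)
      r j = residue n (suc m) (suc j)
      square : ∀ r j f q d → r ≡ q * j - f * d → d * d * (f * f) ≡ q * q * (j * j) + r * r + - (+ 2 * q) * (j * r)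
      square _ j f q d refl = poly j f q d
        where
        poly : ∀ j f q d → let r = q * j - f * d in
               d * d * (f * f) ≡ q * q * (j * j) + r * r + - (+ 2 * q) * (j * r)
        poly = solve-∀ ℤ-ring
    -- The sum of (2 i + 1) g q, with 2 i + 1 = 2 (i + 1) - 1 and g q = d (i + 1) - s.
    e₃ : q * O ≡ + 2 * d * S₂ₘ - + 2 * G₂ - d * S₁ + S₁
    e₃ = begin
      q * O
        ≡⟨ ∑-* m q _ ⟨
      ∑ m (λ i → q * ((+ suc i + + i) * + g i))
        ≡⟨ ∑-cong m (λ {i} _ → odd (+ s i) (+ i) (+ g i) q d (residue-floor m (suc n) (suc i))) ⟩
      ∑ m (λ i → + 2 * d * (+ suc i * + suc i) + - + 2 * (+ suc i * + s i) + - d * + suc i + + s i)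
        ≡⟨ trans (∑-+ m _ _) (cong₂ _+_ (trans (∑-+ m _ _) (cong₂ _+_ (trans (∑-+ m _ _) (cong₂ _+_
             (∑-* m (+ 2 * d) _) (∑-* m (- + 2) _))) (∑-* m (- d) _)))
             (∑-residue m (suc n) (coresidue≢0 n m x y qx≡1))) ⟩
      + 2 * d * S₂ₘ + - + 2 * G₂ + - d * S₁ + S₁
        ≡⟨ signs (+ 2 * d * S₂ₘ) G₂ d S₁ ⟩
      + 2 * d * S₂ₘ - + 2 * G₂ - d * S₁ + S₁ ∎
      where
      g s : ℕ → ℕ
      g i = floor m (suc n) (suc i)
      s i = residue m (suc n) (suc i)
      odd : ∀ s i g q d → s ≡ d * (1ℤ + i) - g * q →
            q * (((1ℤ + i) + i) * g) ≡ + 2 * d * ((1ℤ + i) * (1ℤ + i)) + - + 2 * ((1ℤ + i) * s) + - d * (1ℤ + i) + s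
      odd _ i g q d refl = poly i g q d
        where
        poly : ∀ i g q d → let s = d * (1ℤ + i) - g * q in
               q * (((1ℤ + i) + i) * g) ≡ + 2 * d * ((1ℤ + i) * (1ℤ + i)) + - + 2 * ((1ℤ + i) * s) + - d * (1ℤ + i) + s
        poly = solve-∀ ℤ-ring
      signs : ∀ a g d s → a + - + 2 * g + - d * s + s ≡ a - + 2 * g - d * s + s
      signs = solve-∀ ℤ-ring
    -- d (i + 1) and q′ (i + 1) add up to b q (i + 1), so their residues modulo q are complementary.
    e₄ : G₂ + G₃ ≡ q * S₁
    e₄ = begin
      G₂ + G₃
        ≡⟨ ∑-+ m _ _ ⟨
      ∑ m (λ i → + suc i * + residue m (suc n) (suc i) + + suc i * + residue m q′ (suc i))
        ≡⟨ ∑-cong m (λ {i} i<m → trans (sym (ℤ.*-distribˡ-+ (+ suc i) (+ residue m (suc n) (suc i)) (+ residue m q′ (suc i)))) (trans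
             (cong (λ z → + suc i * + z) (%-complement (suc m) (suc n ℕ.* suc i) (q′ ℕ.* suc i) (multiple i) (coresidue≢0 n m x y qx≡1 i<m)))
             (ℤ.*-comm (+ suc i) q))) ⟩
      ∑ m (λ i → q * + suc i)
        ≡⟨ ∑-* m q _ ⟩
      q * S₁ ∎
      where
      multiple : ∀ i → suc m ∣ suc n ℕ.* suc i ℕ.+ q′ ℕ.* suc i
      multiple i = subst (suc m ∣_) (trans (cong (ℕ._* suc i) (trans (sym q′+d≡bq) (ℕ.+-comm q′ (suc n))))
        (ℕ.*-distribʳ-+ (suc i) (suc n) q′)) (∣m⇒∣m*n (suc i) (n∣m*n b))
    e₆ : + q′ + d ≡ + b * q
    e₆ = trans (cong +_ q′+d≡bq) (ℤ.pos-* b (suc m))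
    e₇ : q * + x ≡ 1ℤ + + y * d
    e₇ = trans (sym (ℤ.pos-* (suc m) x)) (trans (cong +_ qx≡1) (cong (_+_ 1ℤ) (ℤ.pos-* y (suc n))))
    combine : ∀ n m q′ b x y c G₁ G₂ G₃ A O S₁ S₂ₙ S₂ₘ → let d = 1ℤ + n; q = 1ℤ + m in
      q * q * (+ 12 * G₁) - q * q * (d * (+ 3 * d * d + d * (c + b - + 3) + q + x)) ≡
        + 6 * q * (d * d * A - (q * q * S₂ₙ + S₂ₙ - + 2 * q * G₁))
        + q * (q * q + 1ℤ) * (+ 6 * S₂ₙ - n * d * (n + d))
        + - (+ 6 * q * d * d) * (A + O - n * (m * m))
        + + 6 * d * d * (q * O - (+ 2 * d * S₂ₘ - + 2 * G₂ - d * S₁ + S₁))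
        + + 2 * d * d * d * (+ 6 * S₂ₘ - m * q * (m + q))
        + - (+ 12 * d * d) * (G₂ + G₃ - q * S₁)
        + d * d * (+ 12 * G₃ - q * (+ 3 * q * q + q * c + q′ + y))
        + + 3 * d * d * (1ℤ - d - + 2 * q) * (+ 2 * S₁ - m * q)
        + d * d * q * (q′ + d - b * q)
        + - (q * d) * (q * x - (1ℤ + y * d))
    combine = solve-∀ ℤ-ring

  sumℤ-filter : ∀ (a : ℕ → ℕ) k f is →
                sumℤ (map f (filter (λ i → a i ℕ.<? k) is)) ≡ sumℤ (map (λ i → [ a i < k ] * f i) is)
  sumℤ-filter a k f [] = refl
  sumℤ-filter a k f (i ∷ is) = case a i ℕ.<? k of λ where
    (yes lt) → trans (cong (sumℤ ∘ map f) (List.filter-accept (λ i → a i ℕ.<? k) lt))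
      (cong₂ _+_ (sym (trans (cong (_* f i) ([<]-true lt)) (ℤ.*-identityˡ (f i)))) (sumℤ-filter a k f is))
    (no ≮)   → trans (cong (sumℤ ∘ map f) (List.filter-reject (λ i → a i ℕ.<? k) ≮))
      (trans (sumℤ-filter a k f is) (sym (trans (cong (λ z → z * f i + sumℤ (map (λ i → [ a i < k ] * f i) is)) ([<]-false ≮)) (ℤ.+-identityˡ _))))

  -- The value of d (1 + κ) at a lattice point n with det u n = j and det n v equal to the residue
  -- of q j.
  defect : ℕ → ℕ → ℕ → ℤ
  defect n q j = + suc n - + j - + residue n q j

  -- The bracket selects the positive defects, that is, the points strictly on the origin's side of
  -- the edge.
  defectSum : ℕ → ℕ → ℤ
  defectSum n q = ∑ n (λ i → [ suc i ℕ.+ residue n q (suc i) < suc n ] * (defect n q (suc i) * defect n q (suc i)))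

  -- Passing from j to d - j negates the defect, so of two opposite nonzero defects exactly one is
  -- counted. Twice the sum is therefore the sum of all squared defects, without the bracket, and
  -- this expands into power sums and the Dedekind sum.
  ∑-defect² : ∀ n q x y → q ℕ.* x ≡ 1 ℕ.+ y ℕ.* suc n →
    + 12 * defectSum n q ≡ + 12 * dedekindSum n q - + 2 * (+ n * + suc n * (+ suc n + 1ℤ))
  ∑-defect² n q x y qx≡1 = ℤ.i-j≡0⇒i≡j _ _ (trans
    (combine (+ n) K G S₁ S₂)
    (cong₂ _+_ (cong₂ _+_ (vanish (+ 6) twice) (vanish (+ 2) (∑-squares n))) (vanish (- (+ 12 * d)) (∑-linear n))))
    where
    open ≡-Reasoning
    d K G S₁ S₂ : ℤ
    d = + suc n
    r : ℕ → ℕ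
    r = residue n q
    h : ℕ → ℤ
    h j = [ j ℕ.+ r j < suc n ] * (defect n q j * defect n q j)
    K = defectSum n q
    G = dedekindSum n q
    S₁ = ∑ n (λ i → + suc i)
    S₂ = ∑ n (λ i → + suc i * + suc i)

    pair : ∀ {i} → i ℕ.< n → h (suc i) + h (n ℕ.∸ i) ≡ defect n q (suc i) * defect n q (suc i)
    pair {i} i<n = pair′ (suc i) (n ℕ.∸ i) (r (suc i)) (r (n ℕ.∸ i))
      (cong suc (ℕ.m+[n∸m]≡n (ℕ.<⇒≤ i<n))) (residue-reflect n q i<n (residue≢0 n q x y qx≡1 i<n))
      where
      square : ℕ → ℕ → ℤ
      square j r = (d - + j - + r) * (d - + j - + r)
      opposite : ∀ j j′ r r′ → j + j′ ≡ d → r + r′ ≡ d → d - j′ - r′ ≡ - (d - j - r)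
      opposite j j′ r r′ j+j′≡d r+r′≡d = ℤ.i-j≡0⇒i≡j _ _ (trans (poly d j j′ r r′)
        (cong₂ (λ a b → - a + - b) (ℤ.i≡j⇒i-j≡0 j+j′≡d) (ℤ.i≡j⇒i-j≡0 r+r′≡d)))
        where
        poly : ∀ d j j′ r r′ → (d - j′ - r′) - (- (d - j - r)) ≡ - (j + j′ - d) + - (r + r′ - d)
        poly = solve-∀ ℤ-ring
      square-opposite : ∀ j j′ r r′ → j ℕ.+ j′ ≡ suc n → r ℕ.+ r′ ≡ suc n → square j′ r′ ≡ square j r
      square-opposite j j′ r r′ j+j′≡d r+r′≡d = trans
        (cong (λ a → a * a) (opposite (+ j) (+ j′) (+ r) (+ r′) (cong +_ j+j′≡d) (cong +_ r+r′≡d)))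
        (poly (d - + j - + r))
        where
        poly : ∀ a → - a * - a ≡ a * a
        poly = solve-∀ ℤ-ring
      total : ∀ j j′ r r′ → j ℕ.+ j′ ≡ suc n → r ℕ.+ r′ ≡ suc n → (j ℕ.+ r) ℕ.+ (j′ ℕ.+ r′) ≡ suc n ℕ.+ suc n
      total j j′ r r′ j+j′≡d r+r′≡d = trans (+-interchange ℕ.+-commutativeSemigroup j r j′ r′) (cong₂ ℕ._+_ j+j′≡d r+r′≡d)
      pair′ : ∀ j j′ r r′ → j ℕ.+ j′ ≡ suc n → r ℕ.+ r′ ≡ suc n →
              [ j ℕ.+ r < suc n ] * square j r + [ j′ ℕ.+ r′ < suc n ] * square j′ r′ ≡ square j r
      pair′ j j′ r r′ j+j′≡d r+r′≡d
        rewrite square-opposite j j′ r r′ j+j′≡d r+r′≡d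
        with ℕ.<-cmp (j ℕ.+ r) (suc n) | total j j′ r r′ j+j′≡d r+r′≡d
      ... | tri< lt _ _ | t
        rewrite [<]-true lt
              | [<]-false {j′ ℕ.+ r′} {suc n} (λ lt′ → ℕ.<⇒≢ (ℕ.+-mono-< lt lt′) t)
        = trans (ℤ.+-identityʳ _) (ℤ.*-identityˡ _)
      ... | tri> _ _ gt | t
        rewrite [<]-false (ℕ.<⇒≯ gt)
              | [<]-true {j′ ℕ.+ r′} {suc n} (ℕ.≰⇒> (λ ge → ℕ.<⇒≢ (ℕ.+-mono-<-≤ gt ge) (sym t)))
        = trans (ℤ.+-identityˡ _) (ℤ.*-identityˡ _)
      -- On the edge the defect itself is 0, whatever the value of the other bracket.
      ... | tri≈ ¬lt eq _ | _ rewrite [<]-false ¬lt = begin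
        0ℤ + [ j′ ℕ.+ r′ < suc n ] * square j r
          ≡⟨ cong (λ z → 0ℤ + [ j′ ℕ.+ r′ < suc n ] * (z * z)) zero-defect ⟩
        0ℤ + [ j′ ℕ.+ r′ < suc n ] * 0ℤ
          ≡⟨ cong (_+_ 0ℤ) (ℤ.*-zeroʳ [ j′ ℕ.+ r′ < suc n ]) ⟩
        0ℤ * 0ℤ
          ≡⟨ cong (λ z → z * z) zero-defect ⟨
        square j r ∎
        where
        poly : ∀ d j r → d - j - r ≡ d - (j + r)
        poly = solve-∀ ℤ-ring
        zero-defect : d - + j - + r ≡ 0ℤ
        zero-defect = trans (poly d (+ j) (+ r)) (ℤ.i≡j⇒i-j≡0 (cong +_ (sym eq)))

    twice : + 2 * K ≡ + n * (d * d) + + 2 * S₂ + + 2 * G - + 4 * d * S₁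
    twice = begin
      + 2 * K
        ≡⟨ double K ⟩
      K + K
        ≡⟨ cong (_+_ K) (∑-reflect n h) ⟩
      K + ∑ n (λ i → h (n ℕ.∸ i))
        ≡⟨ ∑-+ n _ _ ⟨
      ∑ n (λ i → h (suc i) + h (n ℕ.∸ i))
        ≡⟨ ∑-cong n pair ⟩
      ∑ n (λ i → defect n q (suc i) * defect n q (suc i))
        ≡⟨ ∑-cong n (λ {i} _ → expand d (+ suc i) (+ r (suc i))) ⟩
      ∑ n (λ i → d * d + + suc i * + suc i + + r (suc i) * + r (suc i) + + 2 * (+ suc i * + r (suc i))
                 + - (+ 2 * d) * + suc i + - (+ 2 * d) * + r (suc i))
        ≡⟨ trans (∑-+ n _ _) (cong₂ _+_ (trans (∑-+ n _ _) (cong₂ _+_ (trans (∑-+ n _ _) (cong₂ _+_ (trans (∑-+ n _ _)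
             (cong₂ _+_ (trans (∑-+ n _ _) (cong₂ _+_ (∑-const n (d * d)) refl))
             (∑₁-residues n q x y qx≡1 (λ j → + j * + j)))) (∑-* n (+ 2) _))) (∑-* n (- (+ 2 * d)) _)))
             (trans (∑-* n (- (+ 2 * d)) _) (cong (- (+ 2 * d) *_) (∑-residue n q (residue≢0 n q x y qx≡1))))) ⟩
      + n * (d * d) + S₂ + S₂ + + 2 * G + - (+ 2 * d) * S₁ + - (+ 2 * d) * S₁
        ≡⟨ collect (+ n * (d * d)) d G S₁ S₂ ⟩
      + n * (d * d) + + 2 * S₂ + + 2 * G - + 4 * d * S₁ ∎
      where
      double : ∀ a → + 2 * a ≡ a + a
      double = solve-∀ ℤ-ring
      expand : ∀ d j r → (d - j - r) * (d - j - r) ≡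
               d * d + j * j + r * r + + 2 * (j * r) + - (+ 2 * d) * j + - (+ 2 * d) * r
      expand = solve-∀ ℤ-ring
      collect : ∀ a d G S₁ S₂ → a + S₂ + S₂ + + 2 * G + - (+ 2 * d) * S₁ + - (+ 2 * d) * S₁ ≡
                a + + 2 * S₂ + + 2 * G - + 4 * d * S₁
      collect = solve-∀ ℤ-ring

    combine : ∀ n K G S₁ S₂ → let d = 1ℤ + n in
      + 12 * K - (+ 12 * G - + 2 * (n * d * (d + 1ℤ))) ≡
        + 6 * (+ 2 * K - (n * (d * d) + + 2 * S₂ + + 2 * G - + 4 * d * S₁))
        + + 2 * (+ 6 * S₂ - n * d * (n + d))
        + - (+ 12 * d) * (+ 2 * S₁ - n * d)
    combine = solve-∀ ℤ-ring

open Dedekind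

-- Hirzebruch-Jung chains.

module Chains where
  open import Data.Integer.Base using (_+_; _*_; -_; _-_; _≤_; _<_; ∣_∣)

  det-self : ∀ p → detℤ p p ≡ 0ℤ
  det-self (a , b) = poly a b
    where
    poly : ∀ a b → a * b - b * a ≡ 0ℤ
    poly = solve-∀ ℤ-ring

  det-anti : ∀ p q → detℤ q p ≡ - detℤ p q
  det-anti (a , a′) (b , b′) = solveℤ 4 (λ a a′ b b′ → :det (b , b′) (a , a′) := :- :det (a , a′) (b , b′)) refl a a′ b b′

  next : ℕ → ℤ² → ℤ² → ℤ²
  next b (p , p′) (q , q′) = + (2 ℕ.+ b) * q - p , + (2 ℕ.+ b) * q′ - p′

  det-next : ∀ x b p q → detℤ x (next b p q) ≡ + (2 ℕ.+ b) * detℤ x q - detℤ x p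
  det-next (x , x′) b (p , p′) (q , q′) = solveℤ 7
    (λ x x′ b p p′ q q′ → :det (x , x′) (b :* q :- p , b :* q′ :- p′) := b :* :det (x , x′) (q , q′) :- :det (x , x′) (p , p′))
    refl x x′ (+ (2 ℕ.+ b)) p p′ q q′

  next-det : ∀ x b p q → detℤ (next b p q) x ≡ + (2 ℕ.+ b) * detℤ q x - detℤ p x
  next-det (x , x′) b (p , p′) (q , q′) = solveℤ 7
    (λ x x′ b p p′ q q′ → :det (b :* q :- p , b :* q′ :- p′) (x , x′) := b :* :det (q , q′) (x , x′) :- :det (p , p′) (x , x′))
    refl x x′ (+ (2 ℕ.+ b)) p p′ q q′

  -- Hirzebruch–Jung chains from p to v with second point q: consecutive points
  -- p, q, s satisfy p + s = (2 + b) q, and convexity is built into b : ℕ.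
  data Chain (v : ℤ²) : ℤ² → ℤ² → Set where
    end  : ∀ {p} → detℤ p v ≡ 1ℤ → Chain v p v
    step : ∀ {p q} b → detℤ p q ≡ 1ℤ → Chain v q (next b p q) → Chain v p q

  points : ∀ {v p q} → Chain v p q → List ℤ²
  points {v} {p} (end _)      = p ∷ v ∷ []
  points {p = p} (step _ _ c) = p ∷ points c

  segments : ∀ {v p q} → Chain v p q → List (ℤ² × ℤ²)
  segments {v} {p} (end _)      = (p , v) ∷ []
  segments {p = p} {q} (step _ _ c) = (p , q) ∷ segments c

  penultimate : ∀ {v p q} → Chain v p q → ℤ²
  penultimate {p = p} (end _) = p
  penultimate (step _ _ c)    = penultimate c

  size : ∀ {v p q} → Chain v p q → ℤ
  size (end _)      = 1ℤ
  size (step _ _ c) = 1ℤ + size c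

  excess : ∀ {v p q} → Chain v p q → ℤ
  excess (end _)      = 0ℤ
  excess (step b _ c) = + b + excess c

  -- The sum of (b_i - 2) f(q_i) over the inner points. For f = d (1 + κ) it is d times the total
  -- volume of the dual triangles.
  weighted : ∀ {v p q} → (ℤ² → ℤ) → Chain v p q → ℤ
  weighted f (end _)            = 0ℤ
  weighted f (step {q = q} b _ c) = + b * f q + weighted f c

  first-det : ∀ {v p q} → Chain v p q → detℤ p q ≡ 1ℤ
  first-det (end e)      = e
  first-det (step _ e _) = e

  first∈ : ∀ {v p q} (c : Chain v p q) → p ∈ points c
  first∈ (end _)      = here refl
  first∈ (step _ _ _) = here refl

  last∈ : ∀ {v p q} (c : Chain v p q) → v ∈ points c
  last∈ (end _)      = there (here refl)
  last∈ (step _ _ c) = there (last∈ c)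

  segment-points : ∀ {v p q} (c : Chain v p q) {x y} → (x , y) ∈ segments c → x ∈ points c × y ∈ points c
  segment-points (end _)      (here refl) = here refl , there (here refl)
  segment-points (step _ _ c) (here refl) = here refl , there (first∈ c)
  segment-points (step _ _ c) (there s)   with x∈ , y∈ ← segment-points c s = there x∈ , there y∈

  segment-det : ∀ {v p q} (c : Chain v p q) {x y} → (x , y) ∈ segments c → detℤ x y ≡ 1ℤ
  segment-det (end e)      (here refl) = e
  segment-det (step _ e _) (here refl) = e
  segment-det (step _ _ c) (there s)   = segment-det c s

  successor : ∀ {v p q} (c : Chain v p q) {x} → x ∈ points c → x ≡ v ⊎ ∃[ y ] (x , y) ∈ segments c
  successor (end _)      (here refl)         = inj₂ (_ , here refl)
  successor (end _)      (there (here refl)) = inj₁ refl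
  successor (step _ _ c) (here refl)         = inj₂ (_ , here refl)
  successor (step _ _ c) (there x∈) with successor c x∈
  ... | inj₁ x≡v      = inj₁ x≡v
  ... | inj₂ (y , s∈) = inj₂ (y , there s∈)

  -- Induction from the end of the chain: det p v - det q v = (det q v - det s v) + b det q v for
  -- the next point s, so a positive decrease after q gives one before q.
  det-end-range : ∀ {v p q} → Chain v p q → 0ℤ ≤ detℤ q v × detℤ q v < detℤ p v
  det-end-range {v} (end {p} e) = ℤ.≤-reflexive (sym (det-self v)) , subst₂ _<_ (sym (det-self v)) (sym e) (+<+ (s≤s z≤n))
  det-end-range {v} (step {p} {q} b e c) with 0≤s , s<q ← det-end-range c =
    ℤ.≤-trans 0≤s (ℤ.<⇒≤ s<q) ,
    ℤO.undiff< (subst (0ℤ <_) (trans (cong (λ z → detℤ q v - z + + b * detℤ q v) (next-det v b p q)) (poly (+ b) (detℤ p v) (detℤ q v)))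
      (ℤO.0<+ (ℤO.diff< s<q) (ℤO.0≤* {+ b} (+≤+ z≤n) (ℤ.≤-trans 0≤s (ℤ.<⇒≤ s<q)))))
    where
    poly : ∀ b p q → q - ((+ 2 + b) * q - p) + b * q ≡ p - q
    poly = solve-∀ ℤ-ring

  det-end>0 : ∀ {v p q} → Chain v p q → 0ℤ < detℤ p v
  det-end>0 c with 0≤q , q<p ← det-end-range c = ℤ.≤-<-trans 0≤q q<p

  det-last≥0 : ∀ {v p q} (c : Chain v p q) → All (λ x → 0ℤ ≤ detℤ x v) (points c)
  det-last≥0 {v} c@(end _)      = ℤ.<⇒≤ (det-end>0 c) ∷ ℤ.≤-reflexive (sym (det-self v)) ∷ []
  det-last≥0     c@(step _ _ t) = ℤ.<⇒≤ (det-end>0 c) ∷ det-last≥0 t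

  -- Since b ≥ 0, the increments of det z _ do not shrink as long as its values are nonnegative.
  det-increasing : ∀ {v p q} z (c : Chain v p q) → 0ℤ ≤ detℤ z p → detℤ z p < detℤ z q →
                   All (λ x → detℤ z p ≤ detℤ z x) (points c)
  det-increasing z (end _)      0≤p p<q = ℤ.≤-refl ∷ ℤ.<⇒≤ p<q ∷ []
  det-increasing z (step {p} {q} b e c) 0≤p p<q =
    ℤ.≤-refl ∷ All.map (ℤ.≤-trans (ℤ.<⇒≤ p<q)) (det-increasing z c 0≤q
      (ℤO.undiff< (subst (0ℤ <_) (trans (poly (+ b) (detℤ z p) (detℤ z q)) (cong (_- detℤ z q) (sym (det-next z b p q))))
        (ℤO.0<+ (ℤO.diff< p<q) (ℤO.0≤* {+ b} (+≤+ z≤n) 0≤q)))))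
    where
    0≤q : 0ℤ ≤ detℤ z q
    0≤q = ℤ.≤-trans 0≤p (ℤ.<⇒≤ p<q)
    poly : ∀ b p q → (q - p) + b * q ≡ ((+ 2 + b) * q - p) - q
    poly = solve-∀ ℤ-ring

  -- The first two values of det p _ are 1 and 2 + b, and from there on `det-increasing` applies.
  det-first>0 : ∀ {v p q s} b → detℤ p q ≡ 1ℤ → (c : Chain v q s) → s ≡ next b p q →
                All (λ x → 0ℤ < detℤ p x) (points c)
  det-first>0 {v} {p} {q} b e c refl = All.map (ℤ.<-≤-trans 0<q) (det-increasing p c (ℤ.<⇒≤ 0<q)
      (ℤO.undiff< (subst (0ℤ <_) (sym eq) (ℤO.0<+ {1ℤ} {+ b} (+<+ (s≤s z≤n)) (+≤+ z≤n)))))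
    where
    0<q : 0ℤ < detℤ p q
    0<q = subst (0ℤ <_) (sym e) (+<+ (s≤s z≤n))
    poly : ∀ b → (+ 2 + b) * 1ℤ - 0ℤ - 1ℤ ≡ 1ℤ + b
    poly = solve-∀ ℤ-ring
    eq : detℤ p (next b p q) - detℤ p q ≡ 1ℤ + + b
    eq = trans (cong₂ _-_ (trans (det-next p b p q) (cong₂ (λ y z → + (2 ℕ.+ b) * y - z) e (det-self p))) e) (poly (+ b))

  ordered : ∀ {v p q} (c : Chain v p q) → AllPairs (λ x y → 0ℤ < detℤ x y) (points c)
  ordered (end e)      = (subst (0ℤ <_) (sym e) (+<+ (s≤s z≤n)) ∷ []) ∷ [] ∷ []
  ordered (step b e c) = det-first>0 b e c refl ∷ ordered c

  det-first≥0 : ∀ {v p q} (c : Chain v p q) → All (λ x → 0ℤ ≤ detℤ p x) (points c)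
  det-first≥0 {p = p} (end e)      = ℤ.≤-reflexive (sym (det-self p)) ∷ subst (0ℤ ≤_) (sym e) (+≤+ z≤n) ∷ []
  det-first≥0 {p = p} (step b e c) = ℤ.≤-reflexive (sym (det-self p)) ∷ All.map ℤ.<⇒≤ (det-first>0 b e c refl)

  Linear : (ℤ² → ℤ) → Set
  Linear f = ∀ b p q → f (next b p q) ≡ + (2 ℕ.+ b) * f q - f p

  -- A linear function that is nonnegative on the chain is convex along it.
  convex-monotone : ∀ {v p q} f → Linear f → (c : Chain v p q) → All (λ x → 0ℤ ≤ f x) (points c) →
                    f p ≤ f q → All (λ x → f x ≤ f v) (points c)
  convex-monotone f lin (end _) _ p≤q = p≤q ∷ ℤ.≤-refl ∷ []
  convex-monotone f lin (step {p} {q} b _ c) (_ ∷ 0≤f) p≤q = ℤ.≤-trans p≤q (All.lookup bounds (first∈ c)) ∷ bounds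
    where
    poly : ∀ b p q → (q - p) + b * q ≡ ((+ 2 + b) * q - p) - q
    poly = solve-∀ ℤ-ring
    bounds = convex-monotone f lin c 0≤f (ℤO.undiff (subst (0ℤ ≤_)
      (trans (poly (+ b) (f p) (f q)) (cong (_- f q) (sym (lin b p q))))
      (ℤO.0≤+ (ℤO.diff p≤q) (ℤO.0≤* {+ b} (+≤+ z≤n) (All.lookup 0≤f (first∈ c))))))

  -- A convex function is largest at an end: points are discarded while f decreases, and once it
  -- does not decrease it stays below its value at v.
  convex-bound : ∀ {v p q} f → Linear f → (c : Chain v p q) → All (λ x → 0ℤ ≤ f x) (points c) →
                 ∀ {m} → f p ≤ m → f v ≤ m → All (λ x → f x ≤ m) (points c)
  convex-bound f lin (end _) _ p≤m v≤m = p≤m ∷ v≤m ∷ []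
  convex-bound f lin c@(step {p} {q} b _ t) 0≤f@(_ ∷ 0≤f′) p≤m v≤m with ℤ.≤-total (f p) (f q)
  ... | inj₁ p≤q = All.map (λ x≤v → ℤ.≤-trans x≤v v≤m) (convex-monotone f lin c 0≤f p≤q)
  ... | inj₂ q≤p = p≤m ∷ convex-bound f lin t 0≤f′ (ℤ.≤-trans q≤p p≤m) v≤m

  -- Each term b f(q) is the second difference f(p) - 2 f(q) + f(s), so only the first and the last
  -- increment survive.
  weighted-telescope : ∀ {v p q} f → Linear f → (c : Chain v p q) →
                       weighted f c ≡ f p + f v - f q - f (penultimate c)
  weighted-telescope {v} f lin (end {p} _) = poly (f p) (f v)
    where
    poly : ∀ p v → 0ℤ ≡ p + v - v - p
    poly = solve-∀ ℤ-ring
  weighted-telescope {v} f lin (step {p} {q} b _ c)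
    rewrite weighted-telescope f lin c | lin b p q = poly (+ b) (f p) (f q) (f v) (f (penultimate c))
    where
    poly : ∀ b p q v w → b * q + (q + v - ((+ 2 + b) * q - p) - w) ≡ p + v - q - w
    poly = solve-∀ ℤ-ring

  weighted-const : ∀ {v p q} k f (c : Chain v p q) → weighted (λ x → k - f x) c ≡ k * excess c - weighted f c
  weighted-const k f (end _) = poly k
    where
    poly : ∀ k → 0ℤ ≡ k * 0ℤ - 0ℤ
    poly = solve-∀ ℤ-ring
  weighted-const k f (step {q = q} b _ c) rewrite weighted-const k f c = poly k (+ b) (f q) (excess c) (weighted f c)
    where
    poly : ∀ k b q e w → b * (k - q) + (k * e - w) ≡ k * (b + e) - (b * q + w)
    poly = solve-∀ ℤ-ring

  penultimate∈ : ∀ {v p q} (c : Chain v p q) → penultimate c ∈ points c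
  penultimate∈ (end _)      = here refl
  penultimate∈ (step _ _ c) = there (penultimate∈ c)

  penultimate-det : ∀ {v p q} (c : Chain v p q) → detℤ (penultimate c) v ≡ 1ℤ
  penultimate-det (end e)      = e
  penultimate-det (step _ _ c) = penultimate-det c

  -- The Plücker relation for p, q, w, v with det p q = det w v = 1, where w is the penultimate
  -- point. Hence det p w inverts det q v modulo det p v.
  inverse-relation : ∀ {v p q} (c : Chain v p q) →
                     detℤ q v * detℤ p (penultimate c) ≡ 1ℤ + detℤ q (penultimate c) * detℤ p v
  inverse-relation {v} {p} {q} c = ℤ.i-j≡0⇒i≡j _ _ (trans
    (poly (detℤ p q) (detℤ w v) (detℤ p v) (detℤ q w) (detℤ q v) (detℤ p w))
    (trans (cong₂ _+_ (cong₂ _+_ (vanish (detℤ w v) (first-det c)) (vanish 1ℤ (penultimate-det c)))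
                      (cong -_ (plucker p q w v)))
           refl))
    where
    w = penultimate c
    poly : ∀ pq wv pv qw qv pw → qv * pw - (1ℤ + qw * pv) ≡
           wv * (pq - 1ℤ) + 1ℤ * (wv - 1ℤ) + - (pq * wv - pw * qv + pv * qw)
    poly = solve-∀ ℤ-ring

  nonneg⇒ℕ : ∀ {z} → 0ℤ ≤ z → ∃[ n ] z ≡ + n
  nonneg⇒ℕ {z} 0≤z = ∣ z ∣ , sym (ℤ.0≤i⇒+∣i∣≡i 0≤z)

  pos⇒ℕ : ∀ {z} → 0ℤ < z → ∃[ n ] z ≡ + suc n
  pos⇒ℕ {+ suc n} _ = n , refl
  pos⇒ℕ {+ 0} (+<+ ())

  -- The inverse of det q v modulo det p v, read off the penultimate point.
  module _ {v p q : ℤ²} (b : ℕ) (e : detℤ p q ≡ 1ℤ) (c : Chain v q (next b p q)) {n m : ℕ}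
           (p-eq : detℤ p v ≡ + suc n) (q-eq : detℤ q v ≡ + suc m) where

    private
      x-ex = nonneg⇒ℕ (All.lookup (det-first≥0 (step b e c)) (penultimate∈ (step b e c)))
      y-ex = nonneg⇒ℕ (All.lookup (det-first≥0 c) (penultimate∈ c))

    inverseˣ inverseʸ : ℕ
    inverseˣ = proj₁ x-ex
    inverseʸ = proj₁ y-ex

    inverse-ℕ : suc m ℕ.* inverseˣ ≡ 1 ℕ.+ inverseʸ ℕ.* suc n
    inverse-ℕ = ℤ.+-injective (begin
      + (suc m ℕ.* inverseˣ)                       ≡⟨ ℤ.pos-* (suc m) inverseˣ ⟩
      + suc m * + inverseˣ                         ≡⟨ cong₂ _*_ q-eq (proj₂ x-ex) ⟨
      detℤ q v * detℤ p (penultimate c)            ≡⟨ inverse-relation (step b e c) ⟩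
      1ℤ + detℤ q (penultimate c) * detℤ p v       ≡⟨ cong (_+_ 1ℤ) (cong₂ _*_ (proj₂ y-ex) p-eq) ⟩
      1ℤ + + inverseʸ * + suc n                    ≡⟨ cong (_+_ 1ℤ) (ℤ.pos-* inverseʸ (suc n)) ⟨
      + (1 ℕ.+ inverseʸ ℕ.* suc n)                 ∎)
      where open ≡-Reasoning

  -- Divided by d² and freed of elementary terms, this is 12 s(q, d) = Σ (b_i - 3) + (q + q*) / d,
  -- summed over the inner points of the chain. For a chain with one segment d = 1 and both sides
  -- are 0.
  dedekind : ∀ {v p q} (c : Chain v p q) n q′ → detℤ p v ≡ + suc n → detℤ q v ≡ + q′ →
    let d = + suc n in
    + 12 * dedekindSum n q′ ≡ d * (+ 3 * d * d + d * (excess c - size c - + 2) + + q′ + detℤ p (penultimate c))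
  dedekind {v} (end {p} e) n q′ p-eq q-eq
    with refl ← trans (sym e) p-eq | refl ← trans (sym (det-self v)) q-eq rewrite det-self p = refl
  dedekind {v} (step {p} {q} b e c) n q′ p-eq q-eq
    with m , q-eq′ ← pos⇒ℕ (det-end>0 c)
    with refl ← trans (sym q-eq) q-eq′
    with s , s-eq ← nonneg⇒ℕ (proj₁ (det-end-range c)) =
    trans (reciprocity-step n m s (2 ℕ.+ b) x y (excess c - size c - + 2) (inverse-ℕ b e c p-eq q-eq) recurrence
            (trans (dedekind c m s q-eq s-eq) (cong (λ z → q″ * (+ 3 * q″ * q″ + q″ * (excess c - size c - + 2) + + s + z)) y-eq)))
          (cong₂ (λ k z → d * (+ 3 * d * d + d * k + q″ + z)) (poly (+ b) (excess c) (size c)) (sym x-eq))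
    where
    d = + suc n
    q″ = + suc m
    x = inverseˣ b e c p-eq q-eq
    y = inverseʸ b e c p-eq q-eq
    x-eq : detℤ p (penultimate c) ≡ + x
    x-eq = proj₂ (nonneg⇒ℕ (All.lookup (det-first≥0 (step b e c)) (penultimate∈ (step b e c))))
    y-eq : detℤ q (penultimate c) ≡ + y
    y-eq = proj₂ (nonneg⇒ℕ (All.lookup (det-first≥0 c) (penultimate∈ c)))
    poly : ∀ b e k → (e - k - + 2) + (+ 2 + b) - + 3 ≡ (b + e) - (1ℤ + k) - + 2
    poly = solve-∀ ℤ-ring
    cancel : ∀ a b → a - b + b ≡ a
    cancel = solve-∀ ℤ-ring
    recurrence : s ℕ.+ suc n ≡ (2 ℕ.+ b) ℕ.* suc m
    recurrence = ℤ.+-injective (begin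
      + s + + suc n                                    ≡⟨ cong₂ _+_ s-eq p-eq ⟨
      detℤ (next b p q) v + detℤ p v                   ≡⟨ cong (_+ detℤ p v) (next-det v b p q) ⟩
      + (2 ℕ.+ b) * detℤ q v - detℤ p v + detℤ p v     ≡⟨ cancel _ _ ⟩
      + (2 ℕ.+ b) * detℤ q v                           ≡⟨ cong (+ (2 ℕ.+ b) *_) q-eq ⟩
      + (2 ℕ.+ b) * + suc m                            ≡⟨ ℤ.pos-* (2 ℕ.+ b) (suc m) ⟨
      + ((2 ℕ.+ b) ℕ.* suc m)                          ∎)
      where open ≡-Reasoning

  defect-sum : ∀ {v p q} (c : Chain v p q) n q′ → detℤ p v ≡ + suc n → detℤ q v ≡ + q′ →
    let d = + suc n in
    + 12 * defectSum n q′
      ≡ d * (d * d + + 2 + d * (excess c - size c - + 2) + + q′ + detℤ p (penultimate c))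
  defect-sum {v} (end {p} e) n q′ p-eq q-eq
    with refl ← trans (sym e) p-eq | refl ← trans (sym (det-self v)) q-eq rewrite det-self p = refl
  defect-sum {v} (step {p} {q} b e c) n q′ p-eq q-eq
    with m , q-eq′ ← pos⇒ℕ (det-end>0 c)
    with refl ← trans (sym q-eq) q-eq′ =
    trans (∑-defect² n (suc m) (inverseˣ b e c p-eq q-eq) (inverseʸ b e c p-eq q-eq) (inverse-ℕ b e c p-eq q-eq))
    (trans (cong (_- + 2 * (+ n * + suc n * (+ suc n + 1ℤ))) (dedekind (step b e c) n (suc m) p-eq q-eq))
           (poly (+ n) (excess (step b e c) - size (step b e c) - + 2) (+ suc m) (detℤ p (penultimate c))))
    where
    poly : ∀ n k q x → let d = 1ℤ + n in
           d * (+ 3 * d * d + d * k + q + x) - + 2 * (n * d * (d + 1ℤ)) ≡ d * (d * d + + 2 + d * k + q + x)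
    poly = solve-∀ ℤ-ring

  cramer : ∀ p q v → detℤ p q ≡ 1ℤ → v ≡ (detℤ p v * proj₁ q - detℤ q v * proj₁ p , detℤ p v * proj₂ q - detℤ q v * proj₂ p)
  cramer (p , p′) (q , q′) (v , v′) e = cong₂ _,_
    (trans (sym (trans (cong (_* v) e) (ℤ.*-identityˡ v))) (poly₁ p p′ q q′ v v′))
    (trans (sym (trans (cong (_* v′) e) (ℤ.*-identityˡ v′))) (poly₂ p p′ q q′ v v′))
    where
    poly₁ : ∀ p p′ q q′ v v′ → (p * q′ - p′ * q) * v ≡ (p * v′ - p′ * v) * q - (q * v′ - q′ * v) * p
    poly₁ = solve-∀ ℤ-ring
    poly₂ : ∀ p p′ q q′ v v′ → (p * q′ - p′ * q) * v′ ≡ (p * v′ - p′ * v) * q′ - (q * v′ - q′ * v) * p′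
    poly₂ = solve-∀ ℤ-ring

  primitive-multiple : ∀ n q v → Primitive v → v ≡ (+ n * proj₁ q , + n * proj₂ q) → n ≡ 1
  primitive-multiple n (q , q′) _ coprime refl = coprime (divisible q , divisible q′)
    where
    divisible : ∀ z → n ∣ ∣ + n * z ∣
    divisible z = subst (n ∣_) (sym (ℤ.abs-* (+ n) z)) (m∣m*n ∣ z ∣)

  -- The Euclidean algorithm with quotients rounded up: det p v + r = (2 + b) det q v with 0 ≤ r <
  -- det q v, and r is the determinant of the next point with v. The fuel bounds det q v, which
  -- decreases strictly. When it reaches 0, v is a multiple of q, and primitivity of v gives v = q.
  extend : ∀ fuel {p q v} → detℤ p q ≡ 1ℤ → Primitive v → 0ℤ ≤ detℤ q v → detℤ q v < detℤ p v →
           detℤ q v ≤ + fuel → Chain v p q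
  extend fuel {p} {q} {v} e prim 0≤q q<p q≤fuel with detℤ q v in q-eq | pos⇒ℕ (ℤ.≤-<-trans 0≤q q<p)
  extend fuel {p} {q} {v} e prim 0≤q q<p q≤fuel | + 0 | n , p-eq =
    subst (Chain v p) v≡q (end (trans p-eq (cong +_ d≡1)))
    where
    multiple : v ≡ (+ suc n * proj₁ q , + suc n * proj₂ q)
    multiple = trans (cramer p q v e) (cong₂ _,_ (simplify (proj₁ q) (proj₁ p)) (simplify (proj₂ q) (proj₂ p)))
      where
      poly : ∀ d q p → d * q - 0ℤ * p ≡ d * q
      poly = solve-∀ ℤ-ring
      simplify : ∀ a b → detℤ p v * a - detℤ q v * b ≡ + suc n * a
      simplify a b = trans (cong₂ (λ y z → y * a - z * b) p-eq q-eq) (poly (+ suc n) a b)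
    d≡1 : suc n ≡ 1
    d≡1 = primitive-multiple (suc n) q v prim multiple
    v≡q : v ≡ q
    v≡q = trans multiple (cong₂ _,_ (trans (cong (λ z → + z * proj₁ q) d≡1) (ℤ.*-identityˡ _))
                                    (trans (cong (λ z → + z * proj₂ q) d≡1) (ℤ.*-identityˡ _)))
  extend fuel e prim 0≤q q<p q≤fuel | -[1+ _ ] | _ = contradiction (subst (0ℤ ≤_) q-eq 0≤q) λ ()
  extend zero e prim 0≤q q<p (+≤+ ()) | + suc m | _
  extend (suc fuel) {p} {q} {v} e prim 0≤q q<p q≤fuel | + suc m | n , p-eq =
    step b e (extend fuel (trans (det-next q b p q) flip) prim
      (subst (0ℤ ≤_) (sym s-eq) (+≤+ z≤n))
      (subst₂ _<_ (sym s-eq) (sym q-eq) (+<+ r<q))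
      (subst (_≤ + fuel) (sym s-eq) (+≤+ (ℕ.≤-trans (ℕ.≤-pred r<q) (ℕ.≤-pred (ℤ.drop‿+≤+ q≤fuel))))))
    where
    r : ℕ
    r = (- detℤ p v) %ℕ suc m
    k : ℤ
    k = - ((- detℤ p v) /ℕ suc m)
    r<q : r ℕ.< suc m
    r<q = n%ℕd<d (- detℤ p v) (suc m)
    r-eq : k * + suc m ≡ + r + detℤ p v
    r-eq = ℤ.i-j≡0⇒i≡j _ _ (trans (poly (detℤ p v) ((- detℤ p v) /ℕ suc m) (+ suc m) (+ r))
      (cong -_ (trans (cong (_-_ (+ r + (- detℤ p v) /ℕ suc m * + suc m)) (a≡a%ℕn+[a/ℕn]*n (- detℤ p v) (suc m)))
                      (ℤ.+-inverseʳ (+ r + (- detℤ p v) /ℕ suc m * + suc m)))))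
      where
      poly : ∀ p f q r → - f * q - (r + p) ≡ - ((r + f * q) - - p)
      poly = solve-∀ ℤ-ring
    -- det q v < det p v forces a quotient of at least 2, which is why b = k - 2 is a natural
    -- number.
    1<k : 1ℤ < k
    1<k = ℤ.*-cancelʳ-<-nonNeg (+ suc m) (subst₂ _<_ (sym (ℤ.*-identityˡ (+ suc m))) (sym r-eq)
      (ℤ.<-≤-trans (subst (_< detℤ p v) q-eq q<p) (ℤ.i≤j+i _ (+ r))))
    b : ℕ
    b = proj₁ (nonneg⇒ℕ (ℤO.diff (ℤ.i<j⇒suc[i]≤j 1<k)))
    b-eq : + (2 ℕ.+ b) ≡ k
    b-eq = trans (cong (_+_ (+ 2)) (sym (proj₂ (nonneg⇒ℕ (ℤO.diff (ℤ.i<j⇒suc[i]≤j 1<k)))))) (poly k)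
      where
      poly : ∀ k → + 2 + (k - + 2) ≡ k
      poly = solve-∀ ℤ-ring
    s-eq : detℤ (next b p q) v ≡ + r
    s-eq = trans (next-det v b p q) (trans (cong₂ (λ y z → y * z - detℤ p v) b-eq q-eq)
      (trans (cong (_- detℤ p v) r-eq) (poly (+ r) (detℤ p v))))
      where
      poly : ∀ r p → r + p - p ≡ r
      poly = solve-∀ ℤ-ring
    flip : + (2 ℕ.+ b) * detℤ q q - detℤ q p ≡ 1ℤ
    flip rewrite det-self q | det-anti p q | e = poly (+ (2 ℕ.+ b))
      where
      poly : ∀ b → b * 0ℤ - - 1ℤ ≡ 1ℤ
      poly = solve-∀ ℤ-ring

  ∣-∣-sign : ∀ z → ∃[ s ] + ∣ z ∣ ≡ s * z
  ∣-∣-sign (+ n)      = 1ℤ , sym (ℤ.*-identityˡ (+ n))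
  ∣-∣-sign -[1+ n ]   = - 1ℤ , sym (ℤ.-1*i≡-i -[1+ n ])

  primitive⇒basis : ∀ u → Primitive u → ∃[ e ] detℤ u e ≡ 1ℤ
  primitive⇒basis (u , u′) coprime with ∣-∣-sign u | ∣-∣-sign u′ | coprime-Bézout coprime
  ... | s , ∣u∣ | s′ , ∣u′∣ | Bézout.+- x y eq = (+ y * s′ , + x * s) , ℤ.i-j≡0⇒i≡j _ _ (trans
    (poly u u′ (+ x) (+ y) s s′) (ℤ.i≡j⇒i-j≡0 (trans (cong₂ (λ a b → + x * a - + y * b) (sym ∣u∣) (sym ∣u′∣)) (trans
      (cong₂ _-_ (trans (sym (ℤ.pos-* x ∣ u ∣)) (cong +_ (sym eq))) (sym (ℤ.pos-* y ∣ u′ ∣))) (cancel (+ (y ℕ.* ∣ u′ ∣)))))))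
    where
    poly : ∀ u u′ x y s s′ → u * (x * s) - u′ * (y * s′) - 1ℤ ≡ x * (s * u) - y * (s′ * u′) - 1ℤ
    poly = solve-∀ ℤ-ring
    cancel : ∀ a → 1ℤ + a - a ≡ 1ℤ
    cancel = solve-∀ ℤ-ring
  ... | s , ∣u∣ | s′ , ∣u′∣ | Bézout.-+ x y eq = (- (+ y * s′) , - (+ x * s)) , ℤ.i-j≡0⇒i≡j _ _ (trans
    (poly u u′ (+ x) (+ y) s s′) (ℤ.i≡j⇒i-j≡0 (trans (cong₂ (λ a b → + y * b - + x * a) (sym ∣u∣) (sym ∣u′∣)) (trans
      (cong₂ _-_ (trans (sym (ℤ.pos-* y ∣ u′ ∣)) (cong +_ (sym eq))) (sym (ℤ.pos-* x ∣ u ∣))) (cancel (+ (x ℕ.* ∣ u ∣)))))))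
    where
    poly : ∀ u u′ x y s s′ → u * - (x * s) - u′ * - (y * s′) - 1ℤ ≡ y * (s′ * u′) - x * (s * u) - 1ℤ
    poly = solve-∀ ℤ-ring
    cancel : ∀ a → 1ℤ + a - a ≡ 1ℤ
    cancel = solve-∀ ℤ-ring

  -- A vector e with det u e = 1 may be changed by multiples of u. Subtracting t u lowers det e v by
  -- t d, so with t the integer quotient of det e v by d the second point q satisfies 0 ≤ det q v <
  -- d.
  chain-exists : ∀ u v → Primitive u → Primitive v → 0ℤ < detℤ u v → ∃[ q ] Chain v u q
  chain-exists u@(u₁ , u₂) v@(v₁ , v₂) u-prim v-prim 0<d
    with e@(e₁ , e₂) , ue≡1 ← primitive⇒basis u u-prim | n , d-eq ← pos⇒ℕ 0<d =
    q , extend (suc n) uq≡1 v-prim (subst (0ℤ ≤_) (sym qv-eq) (+≤+ z≤n))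
          (subst₂ _<_ (sym qv-eq) (sym d-eq) (+<+ (n%ℕd<d (detℤ e v) (suc n))))
          (subst (_≤ + suc n) (sym qv-eq) (+≤+ (ℕ.<⇒≤ (n%ℕd<d (detℤ e v) (suc n)))))
    where
    t : ℤ
    t = detℤ e v /ℕ suc n
    q : ℤ²
    q = e₁ - t * u₁ , e₂ - t * u₂
    uq≡1 : detℤ u q ≡ 1ℤ
    uq≡1 = trans (poly u₁ u₂ e₁ e₂ t) ue≡1
      where
      poly : ∀ u₁ u₂ e₁ e₂ t → u₁ * (e₂ - t * u₂) - u₂ * (e₁ - t * u₁) ≡ u₁ * e₂ - u₂ * e₁
      poly = solve-∀ ℤ-ring
    qv-eq : detℤ q v ≡ + (detℤ e v %ℕ suc n)
    qv-eq = trans (poly₁ u₁ u₂ e₁ e₂ v₁ v₂ t) (trans (cong₂ (λ a b → a - t * b) (a≡a%ℕn+[a/ℕn]*n (detℤ e v) (suc n)) d-eq)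
      (poly₂ (+ (detℤ e v %ℕ suc n)) (t * + suc n)))
      where
      poly₁ : ∀ u₁ u₂ e₁ e₂ v₁ v₂ t → (e₁ - t * u₁) * v₂ - (e₂ - t * u₂) * v₁ ≡ (e₁ * v₂ - e₂ * v₁) - t * (u₁ * v₂ - u₂ * v₁)
      poly₁ = solve-∀ ℤ-ring
      poly₂ : ∀ r t → r + t - t ≡ r
      poly₂ = solve-∀ ℤ-ring

open Chains

-- Half-planes, convex hulls, interiors and closures.

module Regions where
  open import Data.Rational.Base using (_+_; _*_; -_; _-_; 1/_; _≤_; _<_; ∣_∣; positive)

  det-ι : ∀ a b → det (ι a) (ι b) ≡ fromℤ (detℤ a b)
  det-ι (a , a′) (b , b′) = sym (trans (fromℤ-- (a ℤ.* b′) (a′ ℤ.* b)) (cong₂ _-_ (fromℤ-* a b′) (fromℤ-* a′ b)))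

  -- A half-plane ⟨ m , x ⟩ ≤ c is represented by (m , c).
  HalfPlane : Set
  HalfPlane = ℚ² × ℚ

  _⊨_ _⊨°_ : ℚ² → HalfPlane → Set
  x ⊨ (m , c)  = ⟨ m , x ⟩ ≤ c
  x ⊨° (m , c) = ⟨ m , x ⟩ < c

  Polyhedron : List HalfPlane → Region
  Polyhedron hs x = All (x ⊨_) hs

  conv-⊨ : ∀ {P x} h → (∀ y → P y → y ⊨ h) → Conv P x → x ⊨ h
  conv-⊨ {P} {x} (m@(m₁ , m₂) , c) P⊨h (ws , pos , total , refl) =
    subst (⟨ m , x ⟩ ≤_) (trans (cong (_* c) total) (ℚ.*-identityˡ c)) (bound ws pos)
    where
    bound : ∀ ws → All (λ (w , y) → 0ℚ ≤ w × P y) ws →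
            ⟨ m , sumℚ² (map (λ (w , y) → w • y) ws) ⟩ ≤ sumℚ (map proj₁ ws) * c
    bound [] [] = ℚ.≤-reflexive (poly m₁ m₂ c)
      where
      poly : ∀ a b c → a * 0ℚ + b * 0ℚ ≡ 0ℚ * c
      poly = solve-∀ ℚ-ring
    bound ((w , y@(y₁ , y₂)) ∷ ws) ((0≤w , Py) ∷ pos) = ℚO.undiff (subst (0ℚ ≤_)
      (poly m₁ m₂ c w y₁ y₂ (proj₁ s) (proj₂ s) (sumℚ (map proj₁ ws)))
      (ℚO.0≤+ (ℚO.0≤* 0≤w (ℚO.diff (P⊨h y Py))) (ℚO.diff (bound ws pos))))
      where
      s = sumℚ² (map (λ (w , y) → w • y) ws)
      poly : ∀ m₁ m₂ c w y₁ y₂ s₁ s₂ t →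
             w * (c - (m₁ * y₁ + m₂ * y₂)) + (t * c - (m₁ * s₁ + m₂ * s₂)) ≡
             (w + t) * c - (m₁ * (w * y₁ + s₁) + m₂ * (w * y₂ + s₂))
      poly = solve-∀ ℚ-ring

  -- One more than the sum norm, which is dual to the maximum norm of `Near`. The summand 1 keeps it
  -- positive at 0 and strictly above the absolute value of each coordinate.
  gauge : ℚ² → ℚ
  gauge (a , b) = 1ℚ + (∣ a ∣ + ∣ b ∣)

  0<1ℚ : 0ℚ < 1ℚ
  0<1ℚ = ℚ.positive⁻¹ 1ℚ

  size>0 : ∀ m → 0ℚ < gauge m
  size>0 (a , b) = ℚO.0<+ 0<1ℚ (ℚO.0≤+ (ℚ.0≤∣p∣ a) (ℚ.0≤∣p∣ b))

  divide : ∀ a b → 0ℚ < a → 0ℚ < b → ∃[ t ] 0ℚ < t × t * b ≡ a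
  divide a b 0<a 0<b = a * 1/ b , ℚO.0<* 0<a (ℚ.positive⁻¹ (1/ b) {{ℚ.1/pos⇒pos b}}) ,
    trans (ℚ.*-assoc a (1/ b) b) (trans (cong (a *_) (ℚ.*-inverseˡ b)) (ℚ.*-identityʳ a))
    where
    instance
      b-pos = positive 0<b
      b-nonZero = ℚ.pos⇒nonZero b

  ≤∣∣ : ∀ a → a ≤ ∣ a ∣
  ≤∣∣ a with ℚ.≤-total 0ℚ a
  ... | inj₁ 0≤a = ℚ.≤-reflexive (sym (ℚ.0≤p⇒∣p∣≡p 0≤a))
  ... | inj₂ a≤0 = ℚ.≤-trans a≤0 (ℚ.0≤∣p∣ a)

  product-bound : ∀ {m d ε} → ∣ d ∣ < ε → m * d ≤ ∣ m ∣ * ε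
  product-bound {m} {d} {ε} d<ε = ℚ.≤-trans (≤∣∣ (m * d)) (subst (_≤ ∣ m ∣ * ε) (sym (ℚ.∣p*q∣≡∣p∣*∣q∣ m d))
    (ℚ.*-monoˡ-≤-nonNeg ∣ m ∣ {{ℚ.∣-∣-nonNeg m}} (ℚ.<⇒≤ d<ε)))

  halfPlane-open : ∀ x h → x ⊨° h → ∃[ ε ] 0ℚ < ε × (∀ y → Near ε x y → y ⊨° h)
  halfPlane-open x@(x₁ , x₂) (m@(m₁ , m₂) , c) lt
    = ε , proj₁ (proj₂ quotient) , near
    where
    -- A displacement below ε in the maximum norm changes the pairing with m by at most ε (|m₁| +
    -- |m₂|), which is less than ε `gauge m`, the distance left to c.
    quotient = divide (c - ⟨ m , x ⟩) (gauge m) (ℚO.diff< lt) (size>0 m)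
    ε = proj₁ quotient
    near : ∀ y → Near ε x y → ⟨ m , y ⟩ < c
    near (y₁ , y₂) (d₁<ε , d₂<ε) = ℚO.undiff< (subst (0ℚ <_)
      (trans (poly₁ ε m₁ m₂ ∣ m₁ ∣ ∣ m₂ ∣ (y₁ - x₁) (y₂ - x₂))
        (trans (cong (_- (m₁ * (y₁ - x₁) + m₂ * (y₂ - x₂))) (proj₂ (proj₂ quotient))) (poly₂ m₁ m₂ x₁ x₂ y₁ y₂ c)))
      (ℚO.0<+ (proj₁ (proj₂ quotient)) (ℚO.0≤+ (ℚO.diff (product-bound {m₁} d₁<ε)) (ℚO.diff (product-bound {m₂} d₂<ε)))))
      where
      poly₁ : ∀ ε m₁ m₂ a₁ a₂ d₁ d₂ →
        ε + ((a₁ * ε - m₁ * d₁) + (a₂ * ε - m₂ * d₂)) ≡ ε * (1ℚ + (a₁ + a₂)) - (m₁ * d₁ + m₂ * d₂)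
      poly₁ = solve-∀ ℚ-ring
      poly₂ : ∀ m₁ m₂ x₁ x₂ y₁ y₂ c →
        c - (m₁ * x₁ + m₂ * x₂) - (m₁ * (y₁ - x₁) + m₂ * (y₂ - x₂)) ≡ c - (m₁ * y₁ + m₂ * y₂)
      poly₂ = solve-∀ ℚ-ring

  near-weaken : ∀ {ε δ x y} → ε ≤ δ → Near ε x y → Near δ x y
  near-weaken ε≤δ (a , b) = ℚ.<-≤-trans a ε≤δ , ℚ.<-≤-trans b ε≤δ

  smaller : ∀ {ε δ} → 0ℚ < ε → 0ℚ < δ → ∃[ η ] 0ℚ < η × η ≤ ε × η ≤ δ
  smaller {ε} {δ} 0<ε 0<δ with ℚ.≤-total ε δ
  ... | inj₁ ε≤δ = ε , 0<ε , ℚ.≤-refl , ε≤δ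
  ... | inj₂ δ≤ε = δ , 0<δ , δ≤ε , ℚ.≤-refl

  polyhedron-open : ∀ x hs → All (x ⊨°_) hs → ∃[ ε ] 0ℚ < ε × (∀ y → Near ε x y → All (y ⊨°_) hs)
  polyhedron-open x [] [] = 1ℚ , 0<1ℚ , λ _ _ → []
  polyhedron-open x (h ∷ hs) (x⊨h ∷ x⊨hs) =
    let ε , 0<ε , near  = halfPlane-open x h x⊨h
        δ , 0<δ , nears = polyhedron-open x hs x⊨hs
        η , 0<η , η≤ε , η≤δ = smaller 0<ε 0<δ
    in η , 0<η , λ y ny → near y (near-weaken {x = x} {y} η≤ε ny) ∷ nears y (near-weaken {x = x} {y} η≤δ ny)

  ⟨⟩-neg : ∀ m x → ⟨ (- proj₁ m , - proj₂ m) , x ⟩ ≡ - ⟨ m , x ⟩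
  ⟨⟩-neg (m₁ , m₂) (x₁ , x₂) = poly m₁ m₂ x₁ x₂
    where
    poly : ∀ a b c d → - a * c + - b * d ≡ - (a * c + b * d)
    poly = solve-∀ ℚ-ring

  neg-cancel-< : ∀ {a b} → - a < - b → b < a
  neg-cancel-< {a} {b} lt = ℚO.undiff< (subst (0ℚ <_) (poly a b) (ℚO.diff< lt))
    where
    poly : ∀ a b → - b - - a ≡ a - b
    poly = solve-∀ ℚ-ring

  -- Outside the half-plane, x would have a whole neighbourhood outside it, and that neighbourhood
  -- contains a point of P.
  closure-⊨ : ∀ {P x} h → (∀ y → P y → y ⊨ h) → Closure P x → x ⊨ h
  closure-⊨ {P} {x} (m , c) P⊨h closure = ℚ.≮⇒≥ λ c<mx →
    let ε , 0<ε , near = halfPlane-open x ((- proj₁ m , - proj₂ m) , - c)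
                           (subst (_< - c) (sym (⟨⟩-neg m x)) (ℚ.neg-antimono-< c<mx))
        y , ny , Py = closure ε 0<ε
    in ℚ.<-irrefl refl (ℚ.<-≤-trans (neg-cancel-< (subst (_< - c) (⟨⟩-neg m y) (near y ny))) (P⊨h y Py))

  -- Moving from x in the direction m increases ⟨ m , _ ⟩.
  interior-⊨° : ∀ {P x} m c → m ≢ 0ℚ² → (∀ y → P y → y ⊨ (m , c)) → Interior P x → x ⊨° (m , c)
  interior-⊨° {P} {x@(x₁ , x₂)} m@(m₁ , m₂) c m≢0 P⊨h (ε , 0<ε , near)
    = ℚ.<-≤-trans (ℚO.undiff< (subst (0ℚ <_) (poly t m₁ m₂ x₁ x₂) (ℚO.0<* 0<t norm>0)))
      (P⊨h y (near y (close m₁ x₁ ∣m₁∣-small , close m₂ x₂ ∣m₂∣-small)))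
    where
    quotient = divide ε (gauge m) 0<ε (size>0 m)
    t = proj₁ quotient
    0<t = proj₁ (proj₂ quotient)
    y = x₁ + t * m₁ , x₂ + t * m₂
    poly : ∀ t m₁ m₂ x₁ x₂ → t * (m₁ * m₁ + m₂ * m₂) ≡ (m₁ * (x₁ + t * m₁) + m₂ * (x₂ + t * m₂)) - (m₁ * x₁ + m₂ * x₂)
    poly = solve-∀ ℚ-ring
    norm>0 : 0ℚ < m₁ * m₁ + m₂ * m₂
    norm>0 with m₁ ℚ.≟ 0ℚ | m₂ ℚ.≟ 0ℚ
    ... | no m₁≢0 | _       = ℚO.0<+ (ℚO.0<sq m₁≢0) (ℚO.0≤sq m₂)
    ... | yes _   | no m₂≢0 = subst (0ℚ <_) (ℚ.+-comm (m₂ * m₂) (m₁ * m₁)) (ℚO.0<+ (ℚO.0<sq m₂≢0) (ℚO.0≤sq m₁))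
    ... | yes refl | yes refl = contradiction refl m≢0
    ∣m₁∣-small : 0ℚ < gauge m - ∣ m₁ ∣
    ∣m₁∣-small = subst (0ℚ <_) (poly′ ∣ m₁ ∣ ∣ m₂ ∣) (ℚO.0<+ 0<1ℚ (ℚ.0≤∣p∣ m₂))
      where
      poly′ : ∀ a b → 1ℚ + b ≡ (1ℚ + (a + b)) - a
      poly′ = solve-∀ ℚ-ring
    ∣m₂∣-small : 0ℚ < gauge m - ∣ m₂ ∣
    ∣m₂∣-small = subst (0ℚ <_) (poly′ ∣ m₁ ∣ ∣ m₂ ∣) (ℚO.0<+ 0<1ℚ (ℚ.0≤∣p∣ m₁))
      where
      poly′ : ∀ a b → 1ℚ + a ≡ (1ℚ + (a + b)) - b
      poly′ = solve-∀ ℚ-ring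
    close : ∀ k z → 0ℚ < gauge m - ∣ k ∣ → ∣ z + t * k - z ∣ < ε
    close k z small = subst₂ _<_ (sym abs) (proj₂ (proj₂ quotient))
      (ℚO.undiff< (subst (0ℚ <_) (distrib t (gauge m) ∣ k ∣) (ℚO.0<* 0<t small)))
      where
      distrib : ∀ t s k → t * (s - k) ≡ t * s - t * k
      distrib = solve-∀ ℚ-ring
      cancel : ∀ z w → z + w - z ≡ w
      cancel = solve-∀ ℚ-ring
      abs : ∣ z + t * k - z ∣ ≡ t * ∣ k ∣
      abs = trans (cong ∣_∣ (cancel z (t * k))) (trans (ℚ.∣p*q∣≡∣p∣*∣q∣ t k) (cong (_* ∣ k ∣) (ℚ.0≤p⇒∣p∣≡p (ℚ.<⇒≤ 0<t))))

  interior-polyhedron : ∀ {P} hs → All (λ h → proj₁ h ≢ 0ℚ²) hs → (∀ x → P x ⇔ Polyhedron hs x) →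
                        ∀ x → Interior P x ⇔ All (x ⊨°_) hs
  interior-polyhedron {P} hs hs≢0 P⇔ x = mk⇔
    (λ int → All.tabulate λ {h} h∈ → interior-⊨° (proj₁ h) (proj₂ h) (All.lookup hs≢0 h∈)
      (λ y Py → All.lookup (Equivalence.to (P⇔ y) Py) h∈) int)
    (λ x⊨ → let ε , 0<ε , near = polyhedron-open x hs x⊨
            in ε , 0<ε , λ y ny → Equivalence.from (P⇔ y) (All.map ℚ.<⇒≤ (near y ny)))

open Regions

-- Triangles with apex 0 in determinant coordinates.

module Triangles where
  open import Data.Rational.Base using (_+_; _*_; -_; _-_; _≤_; _<_)

  det-antiℚ : ∀ p q → det q p ≡ - det p q
  det-antiℚ (a , a′) (b , b′) = poly a a′ b b′
    where
    poly : ∀ a a′ b b′ → b * a′ - b′ * a ≡ - (a * b′ - a′ * b)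
    poly = solve-∀ ℚ-ring

  det-selfℚ : ∀ p → det p p ≡ 0ℚ
  det-selfℚ (a , b) = poly a b
    where
    poly : ∀ a b → a * b - b * a ≡ 0ℚ
    poly = solve-∀ ℚ-ring

  -- The triangle with vertices 0, u and v, where det u v > 0.
  InTriangle : ℚ² → ℚ² → ℚ² → Set
  InTriangle u v x = 0ℚ ≤ det x v × 0ℚ ≤ det u x × det x v + det u x ≤ det u v

  InTriangle° : ℚ² → ℚ² → ℚ² → Set
  InTriangle° u v x = 0ℚ < det x v × 0ℚ < det u x × det x v + det u x < det u v

  sides : ℚ² → ℚ² → List HalfPlane
  sides (u₁ , u₂) (v₁ , v₂) = ((- v₂ , v₁) , 0ℚ) ∷ ((u₂ , - u₁) , 0ℚ) ∷ ((v₂ - u₂ , u₁ - v₁) , det (u₁ , u₂) (v₁ , v₂)) ∷ []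

  module Sides (u₁ u₂ v₁ v₂ x₁ x₂ : ℚ) where
    side₁ : det (x₁ , x₂) (v₁ , v₂) - 0ℚ ≡ 0ℚ - ⟨ (- v₂ , v₁) , (x₁ , x₂) ⟩
    side₁ = poly v₁ v₂ x₁ x₂
      where
      poly : ∀ v₁ v₂ x₁ x₂ → (x₁ * v₂ - x₂ * v₁) - 0ℚ ≡ 0ℚ - (- v₂ * x₁ + v₁ * x₂)
      poly = solve-∀ ℚ-ring
    side₂ : det (u₁ , u₂) (x₁ , x₂) - 0ℚ ≡ 0ℚ - ⟨ (u₂ , - u₁) , (x₁ , x₂) ⟩
    side₂ = poly u₁ u₂ x₁ x₂
      where
      poly : ∀ u₁ u₂ x₁ x₂ → (u₁ * x₂ - u₂ * x₁) - 0ℚ ≡ 0ℚ - (u₂ * x₁ + - u₁ * x₂)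
      poly = solve-∀ ℚ-ring
    side₃ : det (x₁ , x₂) (v₁ , v₂) + det (u₁ , u₂) (x₁ , x₂) ≡ ⟨ (v₂ - u₂ , u₁ - v₁) , (x₁ , x₂) ⟩
    side₃ = poly u₁ u₂ v₁ v₂ x₁ x₂
      where
      poly : ∀ u₁ u₂ v₁ v₂ x₁ x₂ → (x₁ * v₂ - x₂ * v₁) + (u₁ * x₂ - u₂ * x₁) ≡ (v₂ - u₂) * x₁ + (u₁ - v₁) * x₂
      poly = solve-∀ ℚ-ring

  triangle⇔sides : ∀ u v x → InTriangle u v x ⇔ Polyhedron (sides u v) x
  triangle⇔sides (u₁ , u₂) (v₁ , v₂) (x₁ , x₂) = mk⇔
    (λ (a , b , c) → ℚO.undiff (subst (0ℚ ≤_) side₁ (ℚO.diff a)) ∷ ℚO.undiff (subst (0ℚ ≤_) side₂ (ℚO.diff b)) ∷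
                     subst (_≤ _) side₃ c ∷ [])
    (λ { (a ∷ b ∷ c ∷ []) → ℚO.undiff (subst (0ℚ ≤_) (sym side₁) (ℚO.diff a)) ,
                            ℚO.undiff (subst (0ℚ ≤_) (sym side₂) (ℚO.diff b)) , subst (_≤ _) (sym side₃) c })
    where open Sides u₁ u₂ v₁ v₂ x₁ x₂

  triangle°⇔sides : ∀ u v x → InTriangle° u v x ⇔ All (x ⊨°_) (sides u v)
  triangle°⇔sides (u₁ , u₂) (v₁ , v₂) (x₁ , x₂) = mk⇔
    (λ (a , b , c) → ℚO.undiff< (subst (0ℚ <_) side₁ (ℚO.diff< a)) ∷ ℚO.undiff< (subst (0ℚ <_) side₂ (ℚO.diff< b)) ∷
                     subst (_< _) side₃ c ∷ [])
    (λ { (a ∷ b ∷ c ∷ []) → ℚO.undiff< (subst (0ℚ <_) (sym side₁) (ℚO.diff< a)) ,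
                            ℚO.undiff< (subst (0ℚ <_) (sym side₂) (ℚO.diff< b)) , subst (_< _) (sym side₃) c })
    where open Sides u₁ u₂ v₁ v₂ x₁ x₂

  neg≡0 : ∀ {a} → - a ≡ 0ℚ → a ≡ 0ℚ
  neg≡0 {a} eq = trans (poly a) (cong -_ eq)
    where
    poly : ∀ a → a ≡ - - a
    poly = solve-∀ ℚ-ring

  sub≡0 : ∀ {a b} → a - b ≡ 0ℚ → a ≡ b
  sub≡0 {a} {b} eq = trans (poly a b) (trans (cong (_+ b) eq) (ℚ.+-identityˡ b))
    where
    poly : ∀ a b → a ≡ (a - b) + b
    poly = solve-∀ ℚ-ring

  sides≢0 : ∀ u v → 0ℚ < det u v → All (λ h → proj₁ h ≢ 0ℚ²) (sides u v)
  sides≢0 u@(u₁ , u₂) v@(v₁ , v₂) 0<d =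
    (λ eq → no-zero (trans (cong₂ (λ a b → u₁ * a - u₂ * b) (neg≡0 (cong proj₁ eq)) (cong proj₂ eq)) (zeroʳ u₁ u₂))) ∷
    (λ eq → no-zero (trans (cong₂ (λ a b → a * v₂ - b * v₁) (neg≡0 (cong proj₂ eq)) (cong proj₁ eq)) (zeroˡ v₁ v₂))) ∷
    (λ eq → no-zero (trans (cong₂ (λ a b → a * v₂ - b * v₁) (sub≡0 {u₁} {v₁} (cong proj₂ eq)) (sym (sub≡0 {v₂} {u₂} (cong proj₁ eq)))) (det-selfℚ v))) ∷ []
    where
    no-zero : det u v ≢ 0ℚ
    no-zero eq = ℚ.<-irrefl (sym eq) 0<d
    zeroʳ : ∀ a b → a * 0ℚ - b * 0ℚ ≡ 0ℚ
    zeroʳ = solve-∀ ℚ-ring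
    zeroˡ : ∀ a b → 0ℚ * b - 0ℚ * a ≡ 0ℚ
    zeroˡ = solve-∀ ℚ-ring

  triangle-0 : ∀ u v → 0ℚ < det u v → InTriangle u v 0ℚ²
  triangle-0 (u₁ , u₂) (v₁ , v₂) 0<d =
    ℚ.≤-reflexive (poly₁ v₁ v₂) , ℚ.≤-reflexive (poly₂ u₁ u₂) ,
    ℚ.≤-trans (ℚ.≤-reflexive (sym (cong₂ _+_ (poly₁ v₁ v₂) (poly₂ u₁ u₂)))) (ℚ.<⇒≤ 0<d)
    where
    poly₁ : ∀ v₁ v₂ → 0ℚ ≡ 0ℚ * v₂ - 0ℚ * v₁
    poly₁ = solve-∀ ℚ-ring
    poly₂ : ∀ u₁ u₂ → 0ℚ ≡ u₁ * 0ℚ - u₂ * 0ℚ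
    poly₂ = solve-∀ ℚ-ring

  triangle-u : ∀ u v → 0ℚ < det u v → InTriangle u v u
  triangle-u u v 0<d = ℚ.<⇒≤ 0<d , ℚ.≤-reflexive (sym (det-selfℚ u)) ,
    ℚ.≤-reflexive (trans (cong (_+_ (det u v)) (det-selfℚ u)) (ℚ.+-identityʳ (det u v)))

  triangle-v : ∀ u v → 0ℚ < det u v → InTriangle u v v
  triangle-v u v 0<d = ℚ.≤-reflexive (sym (det-selfℚ v)) , ℚ.<⇒≤ 0<d ,
    ℚ.≤-reflexive (trans (cong (_+ det u v) (det-selfℚ v)) (ℚ.+-identityˡ (det u v)))

  cramerℚ : ∀ u v x → det u v • x ≡ det x v • u ⊕ det u x • v
  cramerℚ (u₁ , u₂) (v₁ , v₂) (x₁ , x₂) = cong₂ _,_ (poly₁ u₁ u₂ v₁ v₂ x₁ x₂) (poly₂ u₁ u₂ v₁ v₂ x₁ x₂)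
    where
    poly₁ : ∀ u₁ u₂ v₁ v₂ x₁ x₂ → (u₁ * v₂ - u₂ * v₁) * x₁ ≡ (x₁ * v₂ - x₂ * v₁) * u₁ + (u₁ * x₂ - u₂ * x₁) * v₁
    poly₁ = solve-∀ ℚ-ring
    poly₂ : ∀ u₁ u₂ v₁ v₂ x₁ x₂ → (u₁ * v₂ - u₂ * v₁) * x₂ ≡ (x₁ * v₂ - x₂ * v₁) * u₂ + (u₁ * x₂ - u₂ * x₁) * v₂
    poly₂ = solve-∀ ℚ-ring

  •-cancel : ∀ t d x → t * d ≡ 1ℚ → ∀ {y} → d • x ≡ y → t • y ≡ x
  •-cancel t d (x₁ , x₂) td≡1 refl = cong₂ _,_ (unscale x₁) (unscale x₂)
    where
    unscale : ∀ a → t * (d * a) ≡ a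
    unscale a = trans (sym (ℚ.*-assoc t d a)) (trans (cong (_* a) td≡1) (ℚ.*-identityˡ a))

  triangle⇒conv : ∀ u v → 0ℚ < det u v → ∀ {L} → 0ℚ² ∈ L → u ∈ L → v ∈ L → ∀ x → InTriangle u v x → conv L x
  triangle⇒conv u@(u₁ , u₂) v@(v₁ , v₂) 0<d 0∈ u∈ v∈ x@(x₁ , x₂) (0≤α , 0≤β , α+β≤d) =
    -- The barycentric coordinates of x, with t = 1 / det u v.
    (t * (det u v - (det x v + det u x)) , 0ℚ²) ∷ (t * det x v , u) ∷ (t * det u x , v) ∷ [] ,
    (ℚO.0≤* 0≤t (ℚO.diff α+β≤d) , 0∈) ∷ (ℚO.0≤* 0≤t 0≤α , u∈) ∷ (ℚO.0≤* 0≤t 0≤β , v∈) ∷ [] ,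
    trans (total t (det u v) (det x v) (det u x)) td≡1 ,
    trans (cong₂ _,_ (collect t (det u v) (det x v) (det u x) u₁ v₁) (collect t (det u v) (det x v) (det u x) u₂ v₂))
          (•-cancel t (det u v) x td≡1 (cramerℚ u v x))
    where
    quotient = divide 1ℚ (det u v) 0<1ℚ 0<d
    t = proj₁ quotient
    0≤t = ℚ.<⇒≤ (proj₁ (proj₂ quotient))
    td≡1 = proj₂ (proj₂ quotient)
    total : ∀ t d a b → t * (d - (a + b)) + (t * a + (t * b + 0ℚ)) ≡ t * d
    total = solve-∀ ℚ-ring
    collect : ∀ t d a b u v → t * (d - (a + b)) * 0ℚ + (t * a * u + (t * b * v + 0ℚ)) ≡ t * (a * u + b * v)
    collect = solve-∀ ℚ-ring

  conv⇒triangle : ∀ u v {P} → (∀ y → P y → InTriangle u v y) → ∀ x → Conv P x → InTriangle u v x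
  conv⇒triangle u v P⊆ x Px = Equivalence.from (triangle⇔sides u v x)
    (All.tabulate λ {h} h∈ → conv-⊨ h (λ y Py → All.lookup (Equivalence.to (triangle⇔sides u v y) (P⊆ y Py)) h∈) Px)

  closure⇒triangle : ∀ u v {P} → (∀ y → P y → InTriangle u v y) → ∀ x → Closure P x → InTriangle u v x
  closure⇒triangle u v P⊆ x Px = Equivalence.from (triangle⇔sides u v x)
    (All.tabulate λ {h} h∈ → closure-⊨ h (λ y Py → All.lookup (Equivalence.to (triangle⇔sides u v y) (P⊆ y Py)) h∈) Px)

  interior⇔triangle° : ∀ u v → 0ℚ < det u v → ∀ {P} → (∀ x → P x ⇔ InTriangle u v x) →
                       ∀ x → Interior P x ⇔ InTriangle° u v x
  interior⇔triangle° u v 0<d P⇔ x = mk⇔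
    (λ int → Equivalence.from (triangle°⇔sides u v x) (Equivalence.to sides⇔ int))
    (λ tri → Equivalence.from sides⇔ (Equivalence.to (triangle°⇔sides u v x) tri))
    where
    sides⇔ = interior-polyhedron (sides u v) (sides≢0 u v 0<d)
      (λ y → mk⇔ (λ Py → Equivalence.to (triangle⇔sides u v y) (Equivalence.to (P⇔ y) Py))
                 (λ py → Equivalence.from (P⇔ y) (Equivalence.from (triangle⇔sides u v y) py))) x

  Triangleℤ Triangle°ℤ : ℤ² → ℤ² → ℤ² → Set
  Triangleℤ u v n  = 0ℤ ℤ.≤ detℤ n v × 0ℤ ℤ.≤ detℤ u n × detℤ n v ℤ.+ detℤ u n ℤ.≤ detℤ u v
  Triangle°ℤ u v n = 0ℤ ℤ.< detℤ n v × 0ℤ ℤ.< detℤ u n × detℤ n v ℤ.+ detℤ u n ℤ.< detℤ u v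

  det+det-ι : ∀ a b c d → det (ι a) (ι b) + det (ι c) (ι d) ≡ fromℤ (detℤ a b ℤ.+ detℤ c d)
  det+det-ι a b c d = trans (cong₂ _+_ (det-ι a b) (det-ι c d)) (sym (fromℤ-+ (detℤ a b) (detℤ c d)))

  triangle-ι : ∀ u v n → InTriangle (ι u) (ι v) (ι n) ⇔ Triangleℤ u v n
  triangle-ι u v n = mk⇔
    (λ (a , b , c) → fromℤ-cancel-≤ (subst (0ℚ ≤_) (det-ι n v) a) , fromℤ-cancel-≤ (subst (0ℚ ≤_) (det-ι u n) b) ,
                     fromℤ-cancel-≤ (subst₂ _≤_ (det+det-ι n v u n) (det-ι u v) c))
    (λ (a , b , c) → subst (0ℚ ≤_) (sym (det-ι n v)) (fromℤ-mono-≤ a) , subst (0ℚ ≤_) (sym (det-ι u n)) (fromℤ-mono-≤ b) ,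
                     subst₂ _≤_ (sym (det+det-ι n v u n)) (sym (det-ι u v)) (fromℤ-mono-≤ c))

  triangle°-ι : ∀ u v n → InTriangle° (ι u) (ι v) (ι n) ⇔ Triangle°ℤ u v n
  triangle°-ι u v n = mk⇔
    (λ (a , b , c) → fromℤ-cancel-< (subst (0ℚ <_) (det-ι n v) a) , fromℤ-cancel-< (subst (0ℚ <_) (det-ι u n) b) ,
                     fromℤ-cancel-< (subst₂ _<_ (det+det-ι n v u n) (det-ι u v) c))
    (λ (a , b , c) → subst (0ℚ <_) (sym (det-ι n v)) (fromℤ-mono-< a) , subst (0ℚ <_) (sym (det-ι u n)) (fromℤ-mono-< b) ,
                     subst₂ _<_ (sym (det+det-ι n v u n)) (sym (det-ι u v)) (fromℤ-mono-< c))

open Triangles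

-- Identification of the sail points with the chain.

module Sails where
  open import Data.Rational.Base using (_+_; _*_; -_; _-_; _≤_; _<_; ∣_∣)

  -- The linear form with value 1 at both ends of a segment of a chain.
  height : ℤ² × ℤ² → ℚ² → ℚ
  height (a , b) x = det (ι a) x + det x (ι b)

  next-coordinate : ∀ b p q → fromℤ (+ (2 ℕ.+ b) ℤ.* q ℤ.- p) ≡ (1ℚ + 1ℚ + fromℤ (+ b)) * fromℤ q - fromℤ p
  next-coordinate b p q = trans (fromℤ-- (+ (2 ℕ.+ b) ℤ.* q) p) (cong (_- fromℤ p)
    (trans (fromℤ-* (+ (2 ℕ.+ b)) q) (cong (_* fromℤ q) (fromℤ-+ (+ 2) (+ b)))))

  next-detℚ : ∀ b p q x → det (ι (next b p q)) x ≡ (1ℚ + 1ℚ + fromℤ (+ b)) * det (ι q) x - det (ι p) x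
  next-detℚ b (p₁ , p₂) (q₁ , q₂) (x₁ , x₂) =
    trans (cong₂ (λ y z → y * x₂ - z * x₁) (next-coordinate b p₁ q₁) (next-coordinate b p₂ q₂))
          (poly (fromℤ (+ b)) (fromℤ p₁) (fromℤ p₂) (fromℤ q₁) (fromℤ q₂) x₁ x₂)
    where
    poly : ∀ b p₁ p₂ q₁ q₂ x₁ x₂ →
      ((1ℚ + 1ℚ + b) * q₁ - p₁) * x₂ - ((1ℚ + 1ℚ + b) * q₂ - p₂) * x₁ ≡
      (1ℚ + 1ℚ + b) * (q₁ * x₂ - q₂ * x₁) - (p₁ * x₂ - p₂ * x₁)
    poly = solve-∀ ℚ-ring

  0≤fromℕ : ∀ b → 0ℚ ≤ fromℤ (+ b)
  0≤fromℕ b = fromℤ-mono-≤ {0ℤ} {+ b} (ℤ.+≤+ z≤n)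

  -- Both forms are 1 at q, so they differ by a multiple of det q _, and b measures the bend of the
  -- chain at q. The sign of det q x thus tells which of the two forms is smaller at x.
  height-next : ∀ b p q x → height (q , next b p q) x - height (p , q) x ≡ - (fromℤ (+ b) * det (ι q) x)
  height-next b p q x = trans
    (cong₂ (λ y z → det (ι q) x + y - (det (ι p) x + z))
      (trans (det-antiℚ (ι (next b p q)) x) (cong -_ (next-detℚ b p q x))) (det-antiℚ (ι q) x))
    (poly (fromℤ (+ b)) (det (ι p) x) (det (ι q) x))
    where
    poly : ∀ b p q → q + - ((1ℚ + 1ℚ + b) * q - p) - (p + - q) ≡ - (b * q)
    poly = solve-∀ ℚ-ring

  first-segment : ∀ {v p q} (c : Chain v p q) → (p , q) ∈ segments c
  first-segment (end _)      = here refl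
  first-segment (step _ _ _) = here refl

  0≤-a : ∀ {a} → a ≤ 0ℚ → 0ℚ ≤ - a
  0≤-a a≤0 = subst (0ℚ ≤_) (ℚ.+-identityˡ _) (ℚO.diff a≤0)

  height-increases : ∀ b p q x → det (ι q) x ≤ 0ℚ → height (p , q) x ≤ height (q , next b p q) x
  height-increases b p q x q≤0 = ℚO.undiff (subst (0ℚ ≤_)
    (trans (poly (fromℤ (+ b)) (det (ι q) x)) (sym (height-next b p q x))) (ℚO.0≤* (0≤fromℕ b) (0≤-a q≤0)))
    where
    poly : ∀ b q → b * - q ≡ - (b * q)
    poly = solve-∀ ℚ-ring

  heights-increase : ∀ {v p q} (c : Chain v p q) x → det (ι p) x ≤ 0ℚ → det (ι q) x ≤ det (ι p) x →
                     All (λ s → height (p , q) x ≤ height s x) (segments c)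
  heights-increase (end _) x p≤0 q≤p = ℚ.≤-refl ∷ []
  heights-increase (step {p} {q} b _ c) x p≤0 q≤p =
    ℚ.≤-refl ∷ All.map (ℚ.≤-trans (height-increases b p q x q≤0))
                       (heights-increase c x q≤0 (ℚO.undiff (subst (0ℚ ≤_)
                         (trans (poly₂ (fromℤ (+ b)) (det (ι p) x) (det (ι q) x)) (cong (_-_ (det (ι q) x)) (sym (next-detℚ b p q x))))
                         (ℚO.0≤+ (ℚO.diff q≤p) (ℚO.0≤* (0≤fromℕ b) (0≤-a q≤0))))))
    where
    q≤0 : det (ι q) x ≤ 0ℚ
    q≤0 = ℚ.≤-trans q≤p p≤0
    poly₂ : ∀ b p q → (p - q) + b * - q ≡ q - ((1ℚ + 1ℚ + b) * q - p)
    poly₂ = solve-∀ ℚ-ring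

  -- Convexity of the chain: the form of the segment whose cone contains x is the
  -- smallest one at x.
  locate : ∀ {v p q} (c : Chain v p q) x → 0ℚ ≤ det (ι p) x → 0ℚ ≤ det x (ι v) →
           ∃[ s ] s ∈ segments c × 0ℚ ≤ det (ι (proj₁ s)) x × 0ℚ ≤ det x (ι (proj₂ s)) ×
                  All (λ s′ → height s x ≤ height s′ x) (segments c)
  locate (end _) x 0≤p 0≤v = _ , here refl , 0≤p , 0≤v , ℚ.≤-refl ∷ []
  locate (step {p} {q} b e c) x 0≤p 0≤v = decide (ℚ.≤-total 0ℚ (det (ι q) x))
    where
    decide : 0ℚ ≤ det (ι q) x ⊎ det (ι q) x ≤ 0ℚ →
             ∃[ s ] s ∈ segments (step b e c) × 0ℚ ≤ det (ι (proj₁ s)) x × 0ℚ ≤ det x (ι (proj₂ s)) ×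
                    All (λ s′ → height s x ≤ height s′ x) (segments (step b e c))
    decide (inj₁ 0≤q) =
      let s , s∈ , left , right , minimal = locate c x 0≤q 0≤v
      in s , there s∈ , left , right ,
         ℚ.≤-trans (All.lookup minimal (first-segment c)) (ℚO.undiff (subst (0ℚ ≤_) flip (ℚO.0≤* (0≤fromℕ b) 0≤q))) ∷ minimal
      where
      poly : ∀ a b → b - a ≡ - (a - b)
      poly = solve-∀ ℚ-ring
      double : ∀ a → - - a ≡ a
      double = solve-∀ ℚ-ring
      flip : fromℤ (+ b) * det (ι q) x ≡ height (p , q) x - height (q , next b p q) x
      flip = trans (trans (sym (double _)) (cong -_ (sym (height-next b p q x)))) (sym (poly (height (q , next b p q) x) (height (p , q) x)))
    decide (inj₂ q≤0) = (p , q) , here refl , 0≤p , subst (0ℚ ≤_) (sym (det-antiℚ (ι q) x)) (0≤-a q≤0) ,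
      ℚ.≤-refl ∷ All.map (ℚ.≤-trans (height-increases b p q x q≤0))
        (heights-increase c x q≤0 (ℚO.undiff (subst (0ℚ ≤_)
          (trans (poly₂ (fromℤ (+ b)) (det (ι p) x) (det (ι q) x)) (cong (_-_ (det (ι q) x)) (sym (next-detℚ b p q x))))
          (ℚO.0≤+ 0≤p (ℚO.0≤+ (0≤-a q≤0) (ℚO.0≤* (0≤fromℕ b) (0≤-a q≤0)))))))
      where
      poly₂ : ∀ b p q → p + (- q + b * - q) ≡ q - ((1ℚ + 1ℚ + b) * q - p)
      poly₂ = solve-∀ ℚ-ring

  heightℤ : ℤ² × ℤ² → ℤ² → ℤ
  heightℤ (a , b) n = detℤ a n ℤ.+ detℤ n b

  height-ι : ∀ s n → height s (ι n) ≡ fromℤ (heightℤ s n)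
  height-ι (a , b) n = det+det-ι a n n b

  locateℤ : ∀ {v p q} (c : Chain v p q) n → 0ℤ ℤ.≤ detℤ p n → 0ℤ ℤ.≤ detℤ n v →
            ∃[ s ] s ∈ segments c × 0ℤ ℤ.≤ detℤ (proj₁ s) n × 0ℤ ℤ.≤ detℤ n (proj₂ s) ×
                   All (λ s′ → heightℤ s n ℤ.≤ heightℤ s′ n) (segments c)
  locateℤ {v} {p} c n 0≤p 0≤v =
    let s , s∈ , left , right , minimal = locate c (ι n) (subst (0ℚ ≤_) (sym (det-ι p n)) (fromℤ-mono-≤ 0≤p))
                                                         (subst (0ℚ ≤_) (sym (det-ι n v)) (fromℤ-mono-≤ 0≤v))
    in s , s∈ , fromℤ-cancel-≤ (subst (0ℚ ≤_) (det-ι (proj₁ s) n) left) , fromℤ-cancel-≤ (subst (0ℚ ≤_) (det-ι n (proj₂ s)) right) ,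
       All.map (λ {s′} le → fromℤ-cancel-≤ (subst₂ _≤_ (height-ι s n) (height-ι s′ n) le)) minimal

  basis-expansion : ∀ a b n → detℤ a b ≡ 1ℤ →
                    n ≡ (detℤ n b ℤ.* proj₁ a ℤ.+ detℤ a n ℤ.* proj₁ b , detℤ n b ℤ.* proj₂ a ℤ.+ detℤ a n ℤ.* proj₂ b)
  basis-expansion a@(a₁ , a₂) b@(b₁ , b₂) n@(n₁ , n₂) e = trans (cramer a b n e) (cong₂ _,_ (poly₁ a₁ a₂ b₁ b₂ n₁ n₂) (poly₂ a₁ a₂ b₁ b₂ n₁ n₂))
    where
    poly₁ : ∀ a₁ a₂ b₁ b₂ n₁ n₂ → (a₁ ℤ.* n₂ ℤ.- a₂ ℤ.* n₁) ℤ.* b₁ ℤ.- (b₁ ℤ.* n₂ ℤ.- b₂ ℤ.* n₁) ℤ.* a₁ ≡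
                                  (n₁ ℤ.* b₂ ℤ.- n₂ ℤ.* b₁) ℤ.* a₁ ℤ.+ (a₁ ℤ.* n₂ ℤ.- a₂ ℤ.* n₁) ℤ.* b₁
    poly₁ = solve-∀ ℤ-ring
    poly₂ : ∀ a₁ a₂ b₁ b₂ n₁ n₂ → (a₁ ℤ.* n₂ ℤ.- a₂ ℤ.* n₁) ℤ.* b₂ ℤ.- (b₁ ℤ.* n₂ ℤ.- b₂ ℤ.* n₁) ℤ.* a₂ ≡
                                  (n₁ ℤ.* b₂ ℤ.- n₂ ℤ.* b₁) ℤ.* a₂ ℤ.+ (a₁ ℤ.* n₂ ℤ.- a₂ ℤ.* n₁) ℤ.* b₂
    poly₂ = solve-∀ ℤ-ring

  combination : ∀ a b n {i j} → detℤ a b ≡ 1ℤ → detℤ n b ≡ i → detℤ a n ≡ j →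
                n ≡ (i ℤ.* proj₁ a ℤ.+ j ℤ.* proj₁ b , i ℤ.* proj₂ a ℤ.+ j ℤ.* proj₂ b)
  combination a b n e refl refl = basis-expansion a b n e

  -- The height is the sum of the coordinates of n in the basis a, b, which are nonnegative
  -- integers. Sum 0 means n = 0 and sum 1 means a basis vector.
  height-cases : ∀ a b n → detℤ a b ≡ 1ℤ → n ≢ 0ℤ² → 0ℤ ℤ.≤ detℤ a n → 0ℤ ℤ.≤ detℤ n b →
                 n ≡ a ⊎ n ≡ b ⊎ + 2 ℤ.≤ heightℤ (a , b) n
  height-cases a b n e n≢0 0≤j 0≤i = cases (nonneg⇒ℕ 0≤i) (nonneg⇒ℕ 0≤j)
    where
    first : ∀ a b → 1ℤ ℤ.* a ℤ.+ 0ℤ ℤ.* b ≡ a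
    first = solve-∀ ℤ-ring
    second : ∀ a b → 0ℤ ℤ.* a ℤ.+ 1ℤ ℤ.* b ≡ b
    second = solve-∀ ℤ-ring
    neither : ∀ a b → 0ℤ ℤ.* a ℤ.+ 0ℤ ℤ.* b ≡ 0ℤ
    neither = solve-∀ ℤ-ring
    large : ∀ {i j} → detℤ n b ≡ + i → detℤ a n ≡ + j → 2 ℕ.≤ j ℕ.+ i → + 2 ℤ.≤ heightℤ (a , b) n
    large i-eq j-eq le = subst (+ 2 ℤ.≤_) (sym (cong₂ ℤ._+_ j-eq i-eq)) (ℤ.+≤+ le)
    cases : ∃[ i ] detℤ n b ≡ + i → ∃[ j ] detℤ a n ≡ + j → n ≡ a ⊎ n ≡ b ⊎ + 2 ℤ.≤ heightℤ (a , b) n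
    cases (0 , i-eq) (0 , j-eq) = contradiction (trans (combination a b n e i-eq j-eq)
      (cong₂ _,_ (neither (proj₁ a) (proj₁ b)) (neither (proj₂ a) (proj₂ b)))) n≢0
    cases (1 , i-eq) (0 , j-eq) = inj₁ (trans (combination a b n e i-eq j-eq)
      (cong₂ _,_ (first (proj₁ a) (proj₁ b)) (first (proj₂ a) (proj₂ b))))
    cases (0 , i-eq) (1 , j-eq) = inj₂ (inj₁ (trans (combination a b n e i-eq j-eq)
      (cong₂ _,_ (second (proj₁ a) (proj₁ b)) (second (proj₂ a) (proj₂ b)))))
    cases (suc (suc i) , i-eq) (0 , j-eq)         = inj₂ (inj₂ (large i-eq j-eq (s≤s (s≤s z≤n))))
    cases (0 , i-eq) (suc (suc j) , j-eq)         = inj₂ (inj₂ (large i-eq j-eq (s≤s (s≤s z≤n))))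
    cases (suc i , i-eq) (suc j , j-eq) = inj₂ (inj₂ (large i-eq j-eq
      (subst (2 ℕ.≤_) (sym (cong suc (ℕ.+-suc j i))) (s≤s (s≤s z≤n)))))

  basis-nonzero : ∀ {a b} → detℤ a b ≡ 1ℤ → a ≢ 0ℤ² × b ≢ 0ℤ²
  basis-nonzero {a₁ , a₂} {b₁ , b₂} e =
    (λ eq → one≢zero (trans (sym e) (trans (cong₂ (λ x y → x ℤ.* b₂ ℤ.- y ℤ.* b₁) (cong proj₁ eq) (cong proj₂ eq)) (zeroˡ b₁ b₂)))) ,
    (λ eq → one≢zero (trans (sym e) (trans (cong₂ (λ x y → a₁ ℤ.* y ℤ.- a₂ ℤ.* x) (cong proj₁ eq) (cong proj₂ eq)) (zeroʳ a₁ a₂))))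
    where
    one≢zero : 1ℤ ≢ 0ℤ
    one≢zero ()
    zeroˡ : ∀ a b → 0ℤ ℤ.* b ℤ.- 0ℤ ℤ.* a ≡ 0ℤ
    zeroˡ = solve-∀ ℤ-ring
    zeroʳ : ∀ a b → a ℤ.* 0ℤ ℤ.- b ℤ.* 0ℤ ≡ 0ℤ
    zeroʳ = solve-∀ ℤ-ring

  predecessor : ∀ {v p q} (c : Chain v p q) {x} → x ∈ points c → ∃[ s ] s ∈ segments c × (x ≡ proj₁ s ⊎ x ≡ proj₂ s)
  predecessor (end _)      (here refl)         = _ , here refl , inj₁ refl
  predecessor (end _)      (there (here refl)) = _ , here refl , inj₂ refl
  predecessor (step _ _ c) (here refl)         = _ , here refl , inj₁ refl
  predecessor (step _ _ c) (there x∈)          = let s , s∈ , x-end = predecessor c x∈ in s , there s∈ , x-end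

  LatticePoint : ℤ² → ℤ² → ℤ² → Set
  LatticePoint u v n = Triangleℤ u v n × n ≢ 0ℤ²

  -- By `locateℤ` only the segment whose unimodular cone contains n has to be considered, and there
  -- `height-cases` applies.
  height≥1 : ∀ {v u q} (c : Chain v u q) n → LatticePoint u v n → All (λ s → 1ℤ ℤ.≤ heightℤ s n) (segments c)
  height≥1 c n ((0≤α , 0≤β , _) , n≢0) =
    let s , s∈ , left , right , minimal = locateℤ c n 0≤β 0≤α
    in All.map (ℤ.≤-trans (at-least-1 s (height-cases (proj₁ s) (proj₂ s) n (segment-det c s∈) n≢0 left right) (segment-det c s∈))) minimal
    where
    at-least-1 : ∀ s → n ≡ proj₁ s ⊎ n ≡ proj₂ s ⊎ + 2 ℤ.≤ heightℤ s n → detℤ (proj₁ s) (proj₂ s) ≡ 1ℤ → 1ℤ ℤ.≤ heightℤ s n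
    at-least-1 (a , b) (inj₁ refl)        e = ℤ.≤-reflexive (sym (cong₂ ℤ._+_ (det-self a) e))
    at-least-1 (a , b) (inj₂ (inj₁ refl)) e = ℤ.≤-reflexive (sym (cong₂ ℤ._+_ e (det-self b)))
    at-least-1 (a , b) (inj₂ (inj₂ 2≤))   e = ℤ.≤-trans (ℤ.+≤+ (s≤s z≤n)) 2≤

  -- The linear function - d κ with d = det u v. It takes the value d on the edge from u to v.
  weight : ℤ² → ℤ² → ℤ² → ℤ
  weight u v n = detℤ n v ℤ.+ detℤ u n

  weight-linear : ∀ u v → Linear (weight u v)
  weight-linear u v b p q = trans (cong₂ ℤ._+_ (next-det v b p q) (det-next u b p q))
    (poly (+ (2 ℕ.+ b)) (detℤ p v) (detℤ q v) (detℤ u p) (detℤ u q))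
    where
    poly : ∀ b p q p′ q′ → b ℤ.* q ℤ.- p ℤ.+ (b ℤ.* q′ ℤ.- p′) ≡ b ℤ.* (q ℤ.+ q′) ℤ.- (p ℤ.+ p′)
    poly = solve-∀ ℤ-ring

  weight-first : ∀ u v → weight u v u ≡ detℤ u v
  weight-first u v = trans (cong (ℤ._+_ (detℤ u v)) (det-self u)) (ℤ.+-identityʳ (detℤ u v))

  weight-last : ∀ u v → weight u v v ≡ detℤ u v
  weight-last u v = trans (cong (ℤ._+ detℤ u v) (det-self v)) (ℤ.+-identityˡ (detℤ u v))

  -- The chain stays on the origin's side of the edge by convexity: the weight is linear and
  -- nonnegative on it, hence at most its common value d at the two ends.
  chain-points : ∀ {v u q} (c : Chain v u q) {n} → n ∈ points c → LatticePoint u v n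
  chain-points {v} {u} c {n} n∈ =
    (All.lookup (det-last≥0 c) n∈ , All.lookup (det-first≥0 c) n∈ ,
     All.lookup (convex-bound (weight u v) (weight-linear u v) c
       (All.tabulate λ x∈ → ℤO.0≤+ (All.lookup (det-last≥0 c) x∈) (All.lookup (det-first≥0 c) x∈))
       (ℤ.≤-reflexive (weight-first u v)) (ℤ.≤-reflexive (weight-last u v))) n∈) ,
    nonzero (predecessor c n∈)
    where
    nonzero : ∃[ s ] s ∈ segments c × (n ≡ proj₁ s ⊎ n ≡ proj₂ s) → n ≢ 0ℤ²
    nonzero (s , s∈ , inj₁ refl) = proj₁ (basis-nonzero {proj₁ s} {proj₂ s} (segment-det c s∈))
    nonzero (s , s∈ , inj₂ refl) = proj₂ (basis-nonzero {proj₁ s} {proj₂ s} (segment-det c s∈))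

  -- The half-plane height s x ≥ c.
  above : ℤ² × ℤ² → ℚ → HalfPlane
  above (a , b) c = (proj₂ (ι a) - proj₂ (ι b) , proj₁ (ι b) - proj₁ (ι a)) , - c

  above-⟨⟩ : ∀ s c x → ⟨ proj₁ (above s c) , x ⟩ ≡ - height s x
  above-⟨⟩ ((a₁ , a₂) , (b₁ , b₂)) c (x₁ , x₂) = poly (fromℤ a₁) (fromℤ a₂) (fromℤ b₁) (fromℤ b₂) x₁ x₂
    where
    poly : ∀ a₁ a₂ b₁ b₂ x₁ x₂ → (a₂ - b₂) * x₁ + (b₁ - a₁) * x₂ ≡ - (a₁ * x₂ - a₂ * x₁ + (x₁ * b₂ - x₂ * b₁))
    poly = solve-∀ ℚ-ring

  neg-cancel-≤ : ∀ {a b} → - a ≤ - b → b ≤ a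
  neg-cancel-≤ {a} {b} le = ℚO.undiff (subst (0ℚ ≤_) (poly a b) (ℚO.diff le))
    where
    poly : ∀ a b → - b - - a ≡ a - b
    poly = solve-∀ ℚ-ring

  ⊨-above : ∀ s c x → (c ≤ height s x) ⇔ (x ⊨ above s c)
  ⊨-above s c x = mk⇔
    (λ le → subst (_≤ - c) (sym (above-⟨⟩ s c x)) (ℚ.neg-antimono-≤ le))
    (λ le → neg-cancel-≤ (subst (_≤ - c) (above-⟨⟩ s c x) le))

  ⊨°-above : ∀ s c x → (c < height s x) ⇔ (x ⊨° above s c)
  ⊨°-above s c x = mk⇔
    (λ lt → subst (_< - c) (sym (above-⟨⟩ s c x)) (ℚ.neg-antimono-< lt))
    (λ lt → neg-cancel-< (subst (_< - c) (above-⟨⟩ s c x) lt))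

  near-scale : ∀ ε x → 0ℚ < ε → ∃[ t ] 0ℚ < t × t < 1ℚ × Near ε x ((1ℚ - t) • x)
  near-scale ε x@(x₁ , x₂) 0<ε = t , 0<t , t<1 , close x₁ (below₁ ε ∣ x₁ ∣ ∣ x₂ ∣) 0<rest₁ , close x₂ (below₂ ε ∣ x₁ ∣ ∣ x₂ ∣) 0<rest₂
    where
    -- For t = ε / k, the summand ε gives t < 1, since `gauge x` is positive, and `gauge x` > |x_i|
    -- gives t |x_i| < ε.
    k = ε + gauge x
    0<k : 0ℚ < k
    0<k = ℚO.0<+ 0<ε (ℚ.<⇒≤ (size>0 x))
    quotient = divide ε k 0<ε 0<k
    t = proj₁ quotient
    0<t = proj₁ (proj₂ quotient)
    tk≡ε = proj₂ (proj₂ quotient)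
    below₁ : ∀ ε a b → ε + (1ℚ + (a + b)) - a ≡ (1ℚ + b) + ε
    below₁ = solve-∀ ℚ-ring
    below₂ : ∀ ε a b → ε + (1ℚ + (a + b)) - b ≡ (1ℚ + a) + ε
    below₂ = solve-∀ ℚ-ring
    0<rest₁ : 0ℚ < (1ℚ + ∣ x₂ ∣) + ε
    0<rest₁ = ℚO.0<+ (ℚO.0<+ 0<1ℚ (ℚ.0≤∣p∣ x₂)) (ℚ.<⇒≤ 0<ε)
    0<rest₂ : 0ℚ < (1ℚ + ∣ x₁ ∣) + ε
    0<rest₂ = ℚO.0<+ (ℚO.0<+ 0<1ℚ (ℚ.0≤∣p∣ x₁)) (ℚ.<⇒≤ 0<ε)
    factor : ∀ t k a → t * (k - a) ≡ t * k - t * a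
    factor = solve-∀ ℚ-ring
    t<1 : t < 1ℚ
    t<1 = ℚO.undiff< (ℚO.0<-cancel (ℚ.<⇒≤ 0<k) (subst (0ℚ <_)
      (trans (poly₁ ε (gauge x)) (trans (cong (λ z → k - z) (sym tk≡ε)) (poly₂ k t))) (size>0 x)))
      where
      poly₁ : ∀ ε s → s ≡ (ε + s) - ε
      poly₁ = solve-∀ ℚ-ring
      poly₂ : ∀ k t → k - t * k ≡ k * (1ℚ - t)
      poly₂ = solve-∀ ℚ-ring
    close : ∀ a {r} → k - ∣ a ∣ ≡ r → 0ℚ < r → ∣ (1ℚ - t) * a - a ∣ < ε
    close a eq 0<r = subst₂ _<_ (sym abs) tk≡ε
      (ℚO.undiff< (subst (0ℚ <_) (factor t k ∣ a ∣) (ℚO.0<* 0<t (subst (0ℚ <_) (sym eq) 0<r))))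
      where
      poly : ∀ t a → (1ℚ - t) * a - a ≡ - (t * a)
      poly = solve-∀ ℚ-ring
      abs : ∣ (1ℚ - t) * a - a ∣ ≡ t * ∣ a ∣
      abs = trans (cong ∣_∣ (poly t a)) (trans (ℚ.∣-p∣≡∣p∣ (t * a))
        (trans (ℚ.∣p*q∣≡∣p∣*∣q∣ t a) (cong (_* ∣ a ∣) (ℚ.0≤p⇒∣p∣≡p (ℚ.<⇒≤ 0<t)))))

  det-•ˡ : ∀ t x y → det (t • x) y ≡ t * det x y
  det-•ˡ t (x₁ , x₂) (y₁ , y₂) = poly t x₁ x₂ y₁ y₂
    where
    poly : ∀ t x₁ x₂ y₁ y₂ → t * x₁ * y₂ - t * x₂ * y₁ ≡ t * (x₁ * y₂ - x₂ * y₁)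
    poly = solve-∀ ℚ-ring

  det-•ʳ : ∀ t x y → det x (t • y) ≡ t * det x y
  det-•ʳ t (x₁ , x₂) (y₁ , y₂) = poly t x₁ x₂ y₁ y₂
    where
    poly : ∀ t x₁ x₂ y₁ y₂ → x₁ * (t * y₂) - x₂ * (t * y₁) ≡ t * (x₁ * y₂ - x₂ * y₁)
    poly = solve-∀ ℚ-ring

  det+det-• : ∀ t a b x → det a (t • x) + det (t • x) b ≡ t * (det a x + det x b)
  det+det-• t a b x = trans (cong₂ _+_ (det-•ʳ t a x) (det-•ˡ t x b)) (sym (ℚ.*-distribˡ-+ t (det a x) (det x b)))

  triangle-• : ∀ u v t x → 0ℚ < t → t < 1ℚ → InTriangle u v x → InTriangle u v ((1ℚ - t) • x)
  triangle-• u v t x 0<t t<1 (0≤α , 0≤β , α+β≤d) =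
    subst (0ℚ ≤_) (sym (det-•ˡ (1ℚ - t) x v)) (ℚO.0≤* 0≤s 0≤α) ,
    subst (0ℚ ≤_) (sym (det-•ʳ (1ℚ - t) u x)) (ℚO.0≤* 0≤s 0≤β) ,
    subst (_≤ det u v) (sym (cong₂ _+_ (det-•ˡ (1ℚ - t) x v) (det-•ʳ (1ℚ - t) u x)))
      (ℚO.undiff (subst (0ℚ ≤_) (poly t (det x v) (det u x) (det u v)) (ℚO.0≤+ (ℚO.diff α+β≤d) (ℚO.0≤* (ℚ.<⇒≤ 0<t) (ℚO.0≤+ 0≤α 0≤β)))))
    where
    0≤s : 0ℚ ≤ 1ℚ - t
    0≤s = ℚ.<⇒≤ (ℚO.diff< t<1)
    poly : ∀ t a b d → (d - (a + b)) + t * (a + b) ≡ d - ((1ℚ - t) * a + (1ℚ - t) * b)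
    poly = solve-∀ ℚ-ring

  -- x lies between its radial projections to the segments [a , b] and [u , v].
  above-segment : ∀ u v a b x {P : Region} → P u → P v → P a → P b → det a b ≡ 1ℚ →
    InTriangle u v x → 0ℚ ≤ det a x → 0ℚ ≤ det x b → 0ℚ < det u v → 1ℚ < det a x + det x b → Conv P x
  above-segment u@(u₁ , u₂) v@(v₁ , v₂) a@(a₁ , a₂) b@(b₁ , b₂) x@(x₁ , x₂) Pu Pv Pa Pb ab≡1 (0≤α , 0≤β , α+β≤d) 0≤j 0≤i 0<d 1<h =
    -- The projection x / (i + j) to [a , b] gets the weight (d - (α + β)) (i + j) / k, and the
    -- projection d x / (α + β) to [u , v] gets (i + j - 1) (α + β) / k. Each weight is split
    -- between the two ends, which removes the denominators i + j and α + β, and t = 1 / k.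
    (t * ((d - (α + β)) * i) , a) ∷ (t * ((d - (α + β)) * j) , b) ∷ (t * ((i + j - 1ℚ) * α) , u) ∷ (t * ((i + j - 1ℚ) * β) , v) ∷ [] ,
    (ℚO.0≤* 0≤t (ℚO.0≤* (ℚO.diff α+β≤d) 0≤i) , Pa) ∷ (ℚO.0≤* 0≤t (ℚO.0≤* (ℚO.diff α+β≤d) 0≤j) , Pb) ∷
    (ℚO.0≤* 0≤t (ℚO.0≤* (ℚ.<⇒≤ 0<h-1) 0≤α) , Pu) ∷ (ℚO.0≤* 0≤t (ℚO.0≤* (ℚ.<⇒≤ 0<h-1) 0≤β) , Pv) ∷ [] ,
    trans (total t d i j α β) tk≡1 ,
    trans (cong₂ _,_ (collect t d i j α β a₁ b₁ u₁ v₁) (collect t d i j α β a₂ b₂ u₂ v₂))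
      (trans (cong₂ (λ y z → t * ((d - (α + β)) * proj₁ y + (i + j - 1ℚ) * proj₁ z) , t * ((d - (α + β)) * proj₂ y + (i + j - 1ℚ) * proj₂ z))
                (trans (sym (cramerℚ a b x)) (cong (_• x) ab≡1)) (sym (cramerℚ u v x)))
             (trans (cong₂ _,_ (finish t d i j α β x₁) (finish t d i j α β x₂))
                    (cong₂ _,_ (trans (cong (_* x₁) tk≡1) (ℚ.*-identityˡ x₁)) (trans (cong (_* x₂) tk≡1) (ℚ.*-identityˡ x₂)))))
    where
    d = det u v
    i = det x b
    j = det a x
    α = det x v
    β = det u x
    0<h-1 : 0ℚ < i + j - 1ℚ
    0<h-1 = subst (0ℚ <_) (cong (_- 1ℚ) (ℚ.+-comm j i)) (ℚO.diff< 1<h)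
    k = (i + j) * d - (α + β)
    0<k : 0ℚ < k
    0<k = subst (0ℚ <_) (poly d i j (α + β)) (ℚO.0<+ (ℚO.0<* 0<h-1 0<d) (ℚO.diff α+β≤d))
      where
      poly : ∀ d i j w → (i + j - 1ℚ) * d + (d - w) ≡ (i + j) * d - w
      poly = solve-∀ ℚ-ring
    quotient = divide 1ℚ k 0<1ℚ 0<k
    t = proj₁ quotient
    0≤t = ℚ.<⇒≤ (proj₁ (proj₂ quotient))
    tk≡1 = proj₂ (proj₂ quotient)
    total : ∀ t d i j α β → t * ((d - (α + β)) * i) + (t * ((d - (α + β)) * j) + (t * ((i + j - 1ℚ) * α) + (t * ((i + j - 1ℚ) * β) + 0ℚ)))
            ≡ t * ((i + j) * d - (α + β))
    total = solve-∀ ℚ-ring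
    collect : ∀ t d i j α β a b u v →
      t * ((d - (α + β)) * i) * a + (t * ((d - (α + β)) * j) * b + (t * ((i + j - 1ℚ) * α) * u + (t * ((i + j - 1ℚ) * β) * v + 0ℚ)))
      ≡ t * ((d - (α + β)) * (i * a + j * b) + (i + j - 1ℚ) * (α * u + β * v))
    collect = solve-∀ ℚ-ring
    finish : ∀ t d i j α β x → t * ((d - (α + β)) * (1ℚ * x) + (i + j - 1ℚ) * (d * x)) ≡ t * ((i + j) * d - (α + β)) * x
    finish = solve-∀ ℚ-ring

  -- A chain point has height exactly 1 for one of its segments, while the hull has height at least
  -- 1, so moving slightly towards the origin enters the sail. Any other nonzero lattice point of
  -- the triangle has all heights at least 2. Nearby points of ∇ then have all heights above 1 and
  -- belong to the hull by `above-segment`.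
  sail⇔points : ∀ {v u q} (c : Chain v u q) (∇ : Region) → (∀ x → ∇ x ⇔ InTriangle (ι u) (ι v) x) → ∀ n →
    (Closure (λ x → ∇ x × ¬ Conv (λ y → ∃[ n ] (∇ (ι n) × n ≢ 0ℤ²) × ι n ≡ y) x) (ι n) × n ≢ 0ℤ²) ⇔ n ∈ points c
  sail⇔points {v} {u} c ∇ ∇⇔ n = mk⇔ to from
    where
    0<d : 0ℚ < det (ι u) (ι v)
    0<d = subst (0ℚ <_) (sym (det-ι u v)) (fromℤ-mono-< (det-end>0 c))

    NonzeroPoint Sailʳ : Region
    NonzeroPoint y = ∃[ n ] (∇ (ι n) × n ≢ 0ℤ²) × ι n ≡ y
    Sailʳ x = ∇ x × ¬ Conv NonzeroPoint x

    chain-point : ∀ {x} → x ∈ points c → NonzeroPoint (ι x)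
    chain-point {x} x∈ = x , (Equivalence.from (∇⇔ (ι x)) (Equivalence.from (triangle-ι u v x) (proj₁ lattice)) , proj₂ lattice) , refl
      where lattice = chain-points c x∈

    hull-above : ∀ {s} → s ∈ segments c → ∀ x → Conv NonzeroPoint x → 1ℚ ≤ height s x
    hull-above {s} s∈ x hull = Equivalence.from (⊨-above s 1ℚ x) (conv-⊨ (above s 1ℚ)
      (λ { y (n , (∇n , n≢0) , refl) → Equivalence.to (⊨-above s 1ℚ (ι n)) (subst (1ℚ ≤_) (sym (height-ι s n))
            (fromℤ-mono-≤ (All.lookup (height≥1 c n (Equivalence.to (triangle-ι u v n) (Equivalence.to (∇⇔ (ι n)) ∇n) , n≢0)) s∈))) }) hull)

    above⇒hull : ∀ x → ∇ x → All (λ s → 1ℚ < height s x) (segments c) → Conv NonzeroPoint x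
    above⇒hull x ∇x high =
      let tri@(0≤α , 0≤β , _) = Equivalence.to (∇⇔ x) ∇x
          s@(a , b) , s∈ , left , right , _ = locate c x 0≤β 0≤α
      in above-segment (ι u) (ι v) (ι a) (ι b) x (chain-point (first∈ c)) (chain-point (last∈ c))
           (chain-point (proj₁ (segment-points c s∈))) (chain-point (proj₂ (segment-points c s∈)))
           (trans (det-ι a b) (cong fromℤ (segment-det c s∈))) tri left right 0<d (All.lookup high s∈)

    from : n ∈ points c → Closure Sailʳ (ι n) × n ≢ 0ℤ²
    from n∈ = closure , proj₂ (chain-points c n∈)
      where
      end-height : ∀ {s} → detℤ (proj₁ s) (proj₂ s) ≡ 1ℤ → n ≡ proj₁ s ⊎ n ≡ proj₂ s → height s (ι n) ≡ 1ℚ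
      end-height {s} e (inj₁ refl) = trans (height-ι s n) (cong fromℤ (cong₂ ℤ._+_ (det-self n) e))
      end-height {s} e (inj₂ refl) = trans (height-ι s n) (cong fromℤ (cong₂ ℤ._+_ e (det-self n)))
      closure : Closure Sailʳ (ι n)
      closure ε 0<ε =
        let t , 0<t , t<1 , near = near-scale ε (ι n) 0<ε
            s@(a , b) , s∈ , n-end = predecessor c n∈
            y = (1ℚ - t) • ι n
            eq : height s y ≡ 1ℚ - t
            eq = trans (det+det-• (1ℚ - t) (ι a) (ι b) (ι n))
                   (trans (cong ((1ℚ - t) *_) (end-height {s} (segment-det c s∈) n-end)) (ℚ.*-identityʳ (1ℚ - t)))
            low : height s y < 1ℚ
            low = subst (_< 1ℚ) (sym eq) (ℚO.undiff< (subst (0ℚ <_) (poly t) 0<t))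
        in y , near ,
           Equivalence.from (∇⇔ y) (triangle-• (ι u) (ι v) t (ι n) 0<t t<1
             (Equivalence.from (triangle-ι u v n) (proj₁ (chain-points c n∈)))) ,
           λ hull → ℚ.<-irrefl refl (ℚ.<-≤-trans low (hull-above s∈ y hull))
        where
        poly : ∀ t → t ≡ 1ℚ - (1ℚ - t)
        poly = solve-∀ ℚ-ring

    to : Closure Sailʳ (ι n) × n ≢ 0ℤ² → n ∈ points c
    to (closure , n≢0) =
      let tri = closure⇒triangle (ι u) (ι v) (λ y sy → Equivalence.to (∇⇔ y) (proj₁ sy)) (ι n) closure
          0≤α , 0≤β , _ = Equivalence.to (triangle-ι u v n) tri
          s , s∈ , left , right , minimal = locateℤ c n 0≤β 0≤α
      in decide s s∈ minimal (height-cases (proj₁ s) (proj₂ s) n (segment-det c s∈) n≢0 left right)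
      where
      decide : ∀ s → s ∈ segments c → All (λ s′ → heightℤ s n ℤ.≤ heightℤ s′ n) (segments c) →
               n ≡ proj₁ s ⊎ n ≡ proj₂ s ⊎ + 2 ℤ.≤ heightℤ s n → n ∈ points c
      decide s s∈ _ (inj₁ refl)        = proj₁ (segment-points c s∈)
      decide s s∈ _ (inj₂ (inj₁ refl)) = proj₂ (segment-points c s∈)
      decide s s∈ minimal (inj₂ (inj₂ 2≤)) =
        let ε , 0<ε , near = polyhedron-open (ι n) (map (λ s → above s 1ℚ) (segments c)) (All.map⁺ (All.map
              (λ {s′} le → Equivalence.to (⊨°-above s′ 1ℚ (ι n)) (subst (1ℚ <_) (sym (height-ι s′ n))
                (fromℤ-mono-< {1ℤ} (ℤ.<-≤-trans (ℤ.+<+ (s≤s (s≤s z≤n))) (ℤ.≤-trans 2≤ le))))) minimal))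
            y , ny , ∇y , ¬hull = closure ε 0<ε
        in contradiction (above⇒hull y ∇y (All.map (λ {s′} → Equivalence.from (⊨°-above s′ 1ℚ y)) (All.map⁻ (near y ny)))) ¬hull

open Sails

-- The values of κ on the cone.

module Kappa where
  open import Data.Rational.Base using (_+_; _*_; -_; _-_; _≤_; _<_; nonNegative)

  segment-conv : ∀ {u v L} a b → u ∈ L → v ∈ L → 0ℚ ≤ a → 0ℚ ≤ b → a + b ≡ 1ℚ → conv L (a • u ⊕ b • v)
  segment-conv {u₁ , u₂} {v₁ , v₂} a b u∈ v∈ 0≤a 0≤b a+b≡1 =
    (a , (u₁ , u₂)) ∷ (b , (v₁ , v₂)) ∷ [] , (0≤a , u∈) ∷ (0≤b , v∈) ∷ [] ,
    trans (cong (_+_ a) (ℚ.+-identityʳ b)) a+b≡1 ,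
    cong₂ _,_ (cong (_+_ (a * u₁)) (ℚ.+-identityʳ (b * v₁))) (cong (_+_ (a * u₂)) (ℚ.+-identityʳ (b * v₂)))

  vertex-conv : ∀ {u L} → u ∈ L → conv L u
  vertex-conv {u₁ , u₂} u∈ = (1ℚ , (u₁ , u₂)) ∷ [] , (ℚ.<⇒≤ 0<1ℚ , u∈) ∷ [] , refl , cong₂ _,_ (poly u₁) (poly u₂)
    where
    poly : ∀ a → 1ℚ * a + 0ℚ ≡ a
    poly = solve-∀ ℚ-ring

  ⟨⟩-0 : ∀ m → ⟨ m , 0ℚ² ⟩ ≡ 0ℚ
  ⟨⟩-0 (m₁ , m₂) = poly m₁ m₂
    where
    poly : ∀ a b → a * 0ℚ + b * 0ℚ ≡ 0ℚ
    poly = solve-∀ ℚ-ring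

  ⟨⟩-• : ∀ m t x → ⟨ m , t • x ⟩ ≡ t * ⟨ m , x ⟩
  ⟨⟩-• (m₁ , m₂) t (x₁ , x₂) = poly m₁ m₂ t x₁ x₂
    where
    poly : ∀ m₁ m₂ t x₁ x₂ → m₁ * (t * x₁) + m₂ * (t * x₂) ≡ t * (m₁ * x₁ + m₂ * x₂)
    poly = solve-∀ ℚ-ring

  ⟨⟩-combination : ∀ m a b u v → ⟨ m , a • u ⊕ b • v ⟩ ≡ a * ⟨ m , u ⟩ + b * ⟨ m , v ⟩
  ⟨⟩-combination (m₁ , m₂) a b (u₁ , u₂) (v₁ , v₂) = poly m₁ m₂ a b u₁ u₂ v₁ v₂
    where
    poly : ∀ m₁ m₂ a b u₁ u₂ v₁ v₂ → m₁ * (a * u₁ + b * v₁) + m₂ * (a * u₂ + b * v₂) ≡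
                                     a * (m₁ * u₁ + m₂ * u₂) + b * (m₁ * v₁ + m₂ * v₂)
    poly = solve-∀ ℚ-ring

  -- If m were 0, then Δ would be the segment [u , v], which has no interior.
  support-positive : ∀ (Δ : Region) m c u v → u ≢ v → (∀ x → Δ x → ⟨ m , x ⟩ ≤ c) →
    (∀ x → conv (u ∷ v ∷ []) x ⇔ (Δ x × ⟨ m , x ⟩ ≡ c)) → Interior Δ 0ℚ² → 0ℚ < c
  support-positive Δ m c u@(u₁ , u₂) v@(v₁ , v₂) u≢v bound face origin with m ≟² 0ℚ²
  ... | no m≢0 = subst (_< c) (⟨⟩-0 m) (interior-⊨° m c m≢0 bound origin)
  ... | yes refl = contradiction (ℚ.<-trans 0<k k<0) (ℚ.<-irrefl refl)
    where
    normal opposite : ℚ²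
    normal   = v₂ - u₂ , u₁ - v₁
    opposite = u₂ - v₂ , v₁ - u₁
    0≡c : 0ℚ ≡ c
    0≡c = trans (sym (poly u₁ u₂)) (proj₂ (Equivalence.to (face u) (vertex-conv (here refl))))
      where
      poly : ∀ a b → 0ℚ * a + 0ℚ * b ≡ 0ℚ
      poly = solve-∀ ℚ-ring
    flat : ∀ x → Δ x → conv (u ∷ v ∷ []) x
    flat (x₁ , x₂) Δx = Equivalence.from (face (x₁ , x₂)) (Δx , trans (poly x₁ x₂) 0≡c)
      where
      poly : ∀ a b → 0ℚ * a + 0ℚ * b ≡ 0ℚ
      poly = solve-∀ ℚ-ring
    along : ∀ n k → ⟨ n , u ⟩ ≡ k → ⟨ n , v ⟩ ≡ k → ∀ x → Δ x → ⟨ n , x ⟩ ≤ k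
    along n k nu nv x Δx = conv-⊨ {_∈ (u ∷ v ∷ [])} {x} (n , k)
      (λ { y (here refl) → ℚ.≤-reflexive nu ; y (there (here refl)) → ℚ.≤-reflexive nv }) (flat x Δx)
    normal≢0 : normal ≢ 0ℚ²
    normal≢0 eq = u≢v (cong₂ _,_ (sub≡0 {u₁} {v₁} (cong proj₂ eq)) (sym (sub≡0 {v₂} {u₂} (cong proj₁ eq))))
    opposite≢0 : opposite ≢ 0ℚ²
    opposite≢0 eq = u≢v (cong₂ _,_ (sym (sub≡0 {v₁} {u₁} (cong proj₂ eq))) (sub≡0 {u₂} {v₂} (cong proj₁ eq)))
    k : ℚ
    k = det u v
    poly₁ : ∀ u₁ u₂ v₁ v₂ → (v₂ - u₂) * u₁ + (u₁ - v₁) * u₂ ≡ u₁ * v₂ - u₂ * v₁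
    poly₁ = solve-∀ ℚ-ring
    poly₂ : ∀ u₁ u₂ v₁ v₂ → (v₂ - u₂) * v₁ + (u₁ - v₁) * v₂ ≡ u₁ * v₂ - u₂ * v₁
    poly₂ = solve-∀ ℚ-ring
    poly₃ : ∀ u₁ u₂ v₁ v₂ → (u₂ - v₂) * u₁ + (v₁ - u₁) * u₂ ≡ - (u₁ * v₂ - u₂ * v₁)
    poly₃ = solve-∀ ℚ-ring
    poly₄ : ∀ u₁ u₂ v₁ v₂ → (u₂ - v₂) * v₁ + (v₁ - u₁) * v₂ ≡ - (u₁ * v₂ - u₂ * v₁)
    poly₄ = solve-∀ ℚ-ring
    0<k : 0ℚ < k
    0<k = subst (_< k) (⟨⟩-0 normal) (interior-⊨° normal k normal≢0 (along normal k (poly₁ u₁ u₂ v₁ v₂) (poly₂ u₁ u₂ v₁ v₂)) origin)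
    k<0 : k < 0ℚ
    k<0 = neg-cancel-< (subst (_< - k) (⟨⟩-0 opposite)
      (interior-⊨° opposite (- k) opposite≢0 (along opposite (- k) (poly₃ u₁ u₂ v₁ v₂) (poly₄ u₁ u₂ v₁ v₂)) origin))

  -- If the determinant were 0, v would be an integral multiple t u of the primitive vector u. As m
  -- takes the same nonzero value at both, t = 1 and v = u.
  det≢0 : ∀ u v m c → Primitive u → u ≢ v → 0ℚ < c → ⟨ m , ι u ⟩ ≡ c → ⟨ m , ι v ⟩ ≡ c → detℤ u v ≢ 0ℤ
  det≢0 u@(u₁ , u₂) v@(v₁ , v₂) m@(m₁ , m₂) c prim u≢v 0<c mu mv uv≡0 = u≢v (sym (trans v≡tu (cong₂ _,_ (one u₁) (one u₂))))
    where
    e = proj₁ (primitive⇒basis u prim)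
    t = ℤ.- detℤ e v
    v≡tu : v ≡ (t ℤ.* u₁ , t ℤ.* u₂)
    v≡tu = trans (cramer u e v (proj₂ (primitive⇒basis u prim))) (cong₂ _,_ (drop (proj₁ e) u₁) (drop (proj₂ e) u₂))
      where
      poly : ∀ a b c → 0ℤ ℤ.* a ℤ.- b ℤ.* c ≡ ℤ.- b ℤ.* c
      poly = solve-∀ ℤ-ring
      drop : ∀ a b → detℤ u v ℤ.* a ℤ.- detℤ e v ℤ.* b ≡ t ℤ.* b
      drop a b = trans (cong (λ z → z ℤ.* a ℤ.- detℤ e v ℤ.* b) uv≡0) (poly a (detℤ e v) b)
    t≡1 : t ≡ 1ℤ
    t≡1 = fromℤ-injective (ℚO.*-cancel 0<c (begin
      c * fromℤ t                                   ≡⟨ cong (_* fromℤ t) mu ⟨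
      ⟨ m , ι u ⟩ * fromℤ t                         ≡⟨ poly m₁ m₂ (fromℤ t) (fromℤ u₁) (fromℤ u₂) ⟩
      m₁ * (fromℤ t * fromℤ u₁) + m₂ * (fromℤ t * fromℤ u₂) ≡⟨ cong₂ (λ a b → m₁ * a + m₂ * b) (fromℤ-* t u₁) (fromℤ-* t u₂) ⟨
      ⟨ m , ι (t ℤ.* u₁ , t ℤ.* u₂) ⟩               ≡⟨ cong (λ z → ⟨ m , ι z ⟩) v≡tu ⟨
      ⟨ m , ι v ⟩                                   ≡⟨ mv ⟩
      c                                             ≡⟨ ℚ.*-identityʳ c ⟨
      c * fromℤ 1ℤ                                  ∎))
      where
      open ≡-Reasoning
      poly : ∀ m₁ m₂ t u₁ u₂ → (m₁ * u₁ + m₂ * u₂) * t ≡ m₁ * (t * u₁) + m₂ * (t * u₂)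
      poly = solve-∀ ℚ-ring
    one : ∀ a → t ℤ.* a ≡ a
    one a = trans (cong (ℤ._* a) t≡1) (ℤ.*-identityˡ a)

  -- With w = det x v + det u x, the point x lies on the edge dilated by w / d, so - κ x ≤ w / d by
  -- minimality. Conversely, x = λ y with y in Δ gives ⟨ m , x ⟩ ≤ λ c, while ⟨ m , x ⟩ = (w / d) c
  -- because m has the value c at both u and v.
  kappa-formula : ∀ (P : LDPPolygon) κ → IsKappa P κ → let open LDPPolygon P in
    ∀ m c u v → 0ℚ < c → (∀ x → Δ x → ⟨ m , x ⟩ ≤ c) → ⟨ m , u ⟩ ≡ c → ⟨ m , v ⟩ ≡ c →
    (∀ a b → 0ℚ ≤ a → 0ℚ ≤ b → a + b ≡ 1ℚ → Δ (a • u ⊕ b • v)) → 0ℚ < det u v →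
    ∀ x → InTriangle° u v x → det u v * κ x ≡ - (det x v + det u x)
  kappa-formula P κ isκ m@(m₁ , m₂) c u@(u₁ , u₂) v@(v₁ , v₂) 0<c bound mu mv seg⊆Δ 0<d x@(x₁ , x₂) (0<α , 0<β , _) =
    trans (poly d (κ x)) (cong -_ (ℚ.≤-antisym upper lower))
    where
    open LDPPolygon P
    d = det u v
    α = det x v
    β = det u x
    w = α + β
    poly : ∀ d k → d * k ≡ - (d * - k)
    poly = solve-∀ ℚ-ring
    0<w : 0ℚ < w
    0<w = ℚO.0<+ 0<α (ℚ.<⇒≤ 0<β)
    member = proj₁ (isκ x)
    minimal = proj₂ (isκ x)
    quotient = divide w d 0<w 0<d
    r = proj₁ quotient
    rd≡w = proj₂ (proj₂ quotient)
    inverse = divide 1ℚ w 0<1ℚ 0<w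
    s = proj₁ inverse
    sw≡1 = proj₂ (proj₂ inverse)
    0≤s = ℚ.<⇒≤ (proj₁ (proj₂ inverse))
    scaled : r • ((s * α) • u ⊕ (s * β) • v) ≡ x
    scaled = cong₂ _,_ (coordinate u₁ v₁ x₁ (cong proj₁ (cramerℚ u v x))) (coordinate u₂ v₂ x₂ (cong proj₂ (cramerℚ u v x)))
      where
      poly₁ : ∀ r s a b u v → r * (s * a * u + s * b * v) ≡ r * s * (a * u + b * v)
      poly₁ = solve-∀ ℚ-ring
      poly₂ : ∀ r s d x → r * s * (d * x) ≡ s * (r * d) * x
      poly₂ = solve-∀ ℚ-ring
      coordinate : ∀ u v x → d * x ≡ α * u + β * v → r * (s * α * u + s * β * v) ≡ x
      coordinate u v x eq = trans (poly₁ r s α β u v) (trans (cong (r * s *_) (sym eq)) (trans (poly₂ r s d x)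
        (trans (cong (λ z → s * z * x) rd≡w) (trans (cong (_* x) sw≡1) (ℚ.*-identityˡ x)))))
    upper : d * - κ x ≤ w
    upper = subst (d * - κ x ≤_) (trans (ℚ.*-comm d r) rd≡w)
      (ℚ.*-monoˡ-≤-nonNeg d {{nonNegative (ℚ.<⇒≤ 0<d)}} (minimal r (ℚ.<⇒≤ (proj₁ (proj₂ quotient)) , _ ,
        seg⊆Δ (s * α) (s * β) (ℚO.0≤* 0≤s (ℚ.<⇒≤ 0<α)) (ℚO.0≤* 0≤s (ℚ.<⇒≤ 0<β)) (trans (sym (ℚ.*-distribˡ-+ s α β)) sw≡1) , scaled)))
    dm≡wc : d * ⟨ m , x ⟩ ≡ w * c
    dm≡wc = trans (sym (⟨⟩-• m d x)) (trans (cong ⟨ m ,_⟩ (cramerℚ u v x)) (trans (⟨⟩-combination m α β u v)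
      (trans (cong₂ (λ y z → α * y + β * z) mu mv) (sym (ℚ.*-distribʳ-+ c α β)))))
    lower : w ≤ d * - κ x
    lower = ℚO.undiff (ℚO.0≤-cancel 0<c (subst (0ℚ ≤_) eq
      (ℚO.0≤* (ℚ.<⇒≤ 0<d) (ℚO.0≤* (proj₁ member) (ℚO.diff (bound y Δy))))))
      where
      y = proj₁ (proj₂ member)
      Δy = proj₁ (proj₂ (proj₂ member))
      ky≡x = proj₂ (proj₂ (proj₂ member))
      poly₁ : ∀ d k c my → d * (k * (c - my)) ≡ d * k * c - d * (k * my)
      poly₁ = solve-∀ ℚ-ring
      poly₂ : ∀ d k c w → d * k * c - w * c ≡ c * (d * k - w)
      poly₂ = solve-∀ ℚ-ring
      eq : d * (- κ x * (c - ⟨ m , y ⟩)) ≡ c * (d * - κ x - w)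
      eq = trans (poly₁ d (- κ x) c ⟨ m , y ⟩) (trans (cong (λ z → d * - κ x * c - z)
        (trans (cong (d *_) (trans (sym (⟨⟩-• m (- κ x) y)) (cong ⟨ m ,_⟩ ky≡x))) dm≡wc)) (poly₂ d (- κ x) c w))

open Kappa

-- Normalized volumes of finite point sets and triangles.

module Volume where
  open import Data.Rational.Base using (_+_; _*_; -_; _-_; _≤_; _<_)

  ∈-boundary⁻ : ∀ S {e} → e ∈ boundary S → proj₁ e ∈ S × proj₂ e ∈ S × BoundarySegment S e
  ∈-boundary⁻ S e∈ =
    let e∈² , segment = ∈-filter⁻ (boundarySegment? S) e∈
        a∈ , b∈ = ∈-cartesianProduct⁻ (deduplicate _≟²_ S) (deduplicate _≟²_ S) e∈²
    in ∈-deduplicate⁻ _≟²_ S a∈ , ∈-deduplicate⁻ _≟²_ S b∈ , segment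

  ∈-boundary⁺ : ∀ S {e} → proj₁ e ∈ S → proj₂ e ∈ S → BoundarySegment S e → e ∈ boundary S
  ∈-boundary⁺ S a∈ b∈ segment =
    ∈-filter⁺ (boundarySegment? S) (∈-cartesianProduct⁺ (∈-deduplicate⁺ _≟²_ a∈) (∈-deduplicate⁺ _≟²_ b∈)) segment

  boundary-unique : ∀ S → Unique (boundary S)
  boundary-unique S = filter⁺ (boundarySegment? S) (cartesianProduct⁺ (deduplicate-! S) (deduplicate-! S))

  fan : ℚ² → ℚ² × ℚ² → ℚ
  fan o (a , b) = orient o a b

  -- Reduces a volume to the determination of the set of boundary segments.
  v-conv-enumerated : ∀ o S {E} → Unique E →
    (∀ {e} → e ∈ E ⇔ (proj₁ e ∈ (o ∷ S) × proj₂ e ∈ (o ∷ S) × BoundarySegment (o ∷ S) e)) →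
    v-conv (o ∷ S) ≡ sumℚ (map (fan o) E)
  v-conv-enumerated o S E! E⇔ = sumℚ-↭ (fan o) (unique⇒↭ (boundary-unique (o ∷ S)) E! (mk⇔
    (λ e∈ → Equivalence.from E⇔ (∈-boundary⁻ (o ∷ S) e∈))
    (λ e∈ → let a∈ , b∈ , segment = Equivalence.to E⇔ e∈ in ∈-boundary⁺ (o ∷ S) a∈ b∈ segment)))

  orient-rotate : ∀ a b c → orient b c a ≡ orient a b c
  orient-rotate (a₁ , a₂) (b₁ , b₂) (c₁ , c₂) = poly a₁ a₂ b₁ b₂ c₁ c₂
    where
    poly : ∀ a₁ a₂ b₁ b₂ c₁ c₂ → (c₁ - b₁) * (a₂ - b₂) - (c₂ - b₂) * (a₁ - b₁) ≡ (b₁ - a₁) * (c₂ - a₂) - (b₂ - a₂) * (c₁ - a₁)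
    poly = solve-∀ ℚ-ring

  orient-swap : ∀ a b c → orient b a c ≡ - orient a b c
  orient-swap (a₁ , a₂) (b₁ , b₂) (c₁ , c₂) = poly a₁ a₂ b₁ b₂ c₁ c₂
    where
    poly : ∀ a₁ a₂ b₁ b₂ c₁ c₂ → (a₁ - b₁) * (c₂ - b₂) - (a₂ - b₂) * (c₁ - b₁) ≡ - ((b₁ - a₁) * (c₂ - a₂) - (b₂ - a₂) * (c₁ - a₁))
    poly = solve-∀ ℚ-ring

  orient-aba : ∀ a b → orient a b a ≡ 0ℚ
  orient-aba (a₁ , a₂) (b₁ , b₂) = poly a₁ a₂ b₁ b₂
    where
    poly : ∀ a₁ a₂ b₁ b₂ → (b₁ - a₁) * (a₂ - a₂) - (b₂ - a₂) * (a₁ - a₁) ≡ 0ℚ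
    poly = solve-∀ ℚ-ring

  orient-abb : ∀ a b → orient a b b ≡ 0ℚ
  orient-abb a b = trans (orient-rotate b a b) (orient-aba b a)

  orient-aab : ∀ a b → orient a a b ≡ 0ℚ
  orient-aab a b = trans (sym (orient-rotate a a b)) (orient-aba a b)

  dot-aba : ∀ a b → 0ℚ ≡ ⟨ a ⊖ a , a ⊖ b ⟩
  dot-aba (a₁ , a₂) (b₁ , b₂) = poly a₁ a₂ b₁ b₂
    where
    poly : ∀ a₁ a₂ b₁ b₂ → 0ℚ ≡ (a₁ - a₁) * (a₁ - b₁) + (a₂ - a₂) * (a₂ - b₂)
    poly = solve-∀ ℚ-ring

  dot-abb : ∀ a b → 0ℚ ≡ ⟨ b ⊖ a , b ⊖ b ⟩
  dot-abb (a₁ , a₂) (b₁ , b₂) = poly a₁ a₂ b₁ b₂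
    where
    poly : ∀ a₁ a₂ b₁ b₂ → 0ℚ ≡ (b₁ - a₁) * (b₁ - b₁) + (b₂ - a₂) * (b₂ - b₂)
    poly = solve-∀ ℚ-ring

  triangle-segment : ∀ {a b c S} → 0ℚ < orient a b c → (∀ {z} → z ∈ S → z ∈ (a ∷ b ∷ c ∷ [])) → BoundarySegment S (a , b)
  triangle-segment {a} {b} {c} {S} 0<o S⊆ = a≢b , All.tabulate (λ z∈ → left (S⊆ z∈))
    where
    a≢b : a ≢ b
    a≢b refl = ℚ.<-irrefl (sym (orient-aab a c)) 0<o
    left : ∀ {z} → z ∈ (a ∷ b ∷ c ∷ []) → 0ℚ ≤ orient a b z × (orient a b z ≡ 0ℚ → 0ℚ ≤ ⟨ z ⊖ a , z ⊖ b ⟩)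
    left (here refl)                 = ℚ.≤-reflexive (sym (orient-aba a b)) , λ _ → ℚ.≤-reflexive (dot-aba a b)
    left (there (here refl))         = ℚ.≤-reflexive (sym (orient-abb a b)) , λ _ → ℚ.≤-reflexive (dot-abb a b)
    left (there (there (here refl))) = ℚ.<⇒≤ 0<o , λ o≡0 → contradiction 0<o (ℚ.<-irrefl (sym o≡0))

  no-reverse-segment : ∀ {a b c S} → 0ℚ < orient a b c → c ∈ S → ¬ BoundarySegment S (b , a)
  no-reverse-segment {a} {b} {c} 0<o c∈ (_ , left) = ℚ.<-irrefl refl (ℚ.<-≤-trans 0<o (ℚO.undiff
    (subst (0ℚ ≤_) (trans (orient-swap a b c) (poly (orient a b c))) (proj₁ (All.lookup left c∈)))))
    where
    poly : ∀ a → - a ≡ 0ℚ - a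
    poly = solve-∀ ℚ-ring

  -- The list is fixed only by its elements, because its order and its head o need not follow the
  -- counterclockwise order a, b, c. The signed areas add up to the same value from any apex.
  v-conv-triangle : ∀ {a b c o S} → 0ℚ < orient a b c → (∀ {z} → z ∈ (o ∷ S) ⇔ z ∈ (a ∷ b ∷ c ∷ [])) →
                    v-conv (o ∷ S) ≡ orient a b c
  v-conv-triangle {a} {b} {c} {o} {S} 0<o S⇔ =
    trans (v-conv-enumerated o S E! (mk⇔ to (λ (x∈ , y∈ , segment) → from (Equivalence.to S⇔ x∈) (Equivalence.to S⇔ y∈) segment))) (total o a b c)
    where
    E = (a , b) ∷ (b , c) ∷ (c , a) ∷ []
    0<o′ : 0ℚ < orient b c a
    0<o′ = subst (0ℚ <_) (sym (orient-rotate a b c)) 0<o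
    0<o″ : 0ℚ < orient c a b
    0<o″ = subst (0ℚ <_) (sym (orient-rotate b c a)) 0<o′
    a∈ : a ∈ (o ∷ S)
    a∈ = Equivalence.from S⇔ (here refl)
    b∈ : b ∈ (o ∷ S)
    b∈ = Equivalence.from S⇔ (there (here refl))
    c∈ : c ∈ (o ∷ S)
    c∈ = Equivalence.from S⇔ (there (there (here refl)))
    S⊆ : ∀ {z} → z ∈ (o ∷ S) → z ∈ (a ∷ b ∷ c ∷ [])
    S⊆ = Equivalence.to S⇔
    rotate : ∀ {a b c z : ℚ²} → z ∈ (a ∷ b ∷ c ∷ []) → z ∈ (b ∷ c ∷ a ∷ [])
    rotate (here refl)                 = there (there (here refl))
    rotate (there (here refl))         = here refl
    rotate (there (there (here refl))) = there (here refl)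
    ab = triangle-segment 0<o S⊆
    bc = triangle-segment 0<o′ (rotate ∘ S⊆)
    ca = triangle-segment 0<o″ (rotate ∘ rotate ∘ S⊆)
    a≢b = proj₁ ab
    b≢c = proj₁ bc
    c≢a = proj₁ ca
    E! : Unique E
    E! = ((λ eq → a≢b (cong proj₁ eq)) ∷ (λ eq → c≢a (sym (cong proj₁ eq))) ∷ []) ∷ ((λ eq → b≢c (cong proj₁ eq)) ∷ []) ∷ [] ∷ []
    to : ∀ {e} → e ∈ E → proj₁ e ∈ (o ∷ S) × proj₂ e ∈ (o ∷ S) × BoundarySegment (o ∷ S) e
    to (here refl)                 = a∈ , b∈ , ab
    to (there (here refl))         = b∈ , c∈ , bc
    to (there (there (here refl))) = c∈ , a∈ , ca
    from : ∀ {x y} → x ∈ (a ∷ b ∷ c ∷ []) → y ∈ (a ∷ b ∷ c ∷ []) → BoundarySegment (o ∷ S) (x , y) → (x , y) ∈ E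
    from (here refl) (here refl) (x≢x , _) = contradiction refl x≢x
    from (there (here refl)) (there (here refl)) (x≢x , _) = contradiction refl x≢x
    from (there (there (here refl))) (there (there (here refl))) (x≢x , _) = contradiction refl x≢x
    from (here refl) (there (here refl)) _ = here refl
    from (there (here refl)) (there (there (here refl))) _ = there (here refl)
    from (there (there (here refl))) (here refl) _ = there (there (here refl))
    from (there (here refl)) (here refl) segment = contradiction segment (no-reverse-segment 0<o c∈)
    from (there (there (here refl))) (there (here refl)) segment = contradiction segment (no-reverse-segment 0<o′ a∈)
    from (here refl) (there (there (here refl))) segment = contradiction segment (no-reverse-segment 0<o″ b∈)
    total : ∀ o a b c → orient o a b + (orient o b c + (orient o c a + 0ℚ)) ≡ orient a b c
    total (o₁ , o₂) (a₁ , a₂) (b₁ , b₂) (c₁ , c₂) = poly o₁ o₂ a₁ a₂ b₁ b₂ c₁ c₂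
      where
      poly : ∀ o₁ o₂ a₁ a₂ b₁ b₂ c₁ c₂ →
        ((a₁ - o₁) * (b₂ - o₂) - (a₂ - o₂) * (b₁ - o₁)) +
        (((b₁ - o₁) * (c₂ - o₂) - (b₂ - o₂) * (c₁ - o₁)) +
        (((c₁ - o₁) * (a₂ - o₂) - (c₂ - o₂) * (a₁ - o₁)) + 0ℚ)) ≡
        (b₁ - a₁) * (c₂ - a₂) - (b₂ - a₂) * (c₁ - a₁)
      poly = solve-∀ ℚ-ring

  sumℚ-zero : ∀ {A : Set} (f : A → ℚ) xs → All (λ x → f x ≡ 0ℚ) xs → sumℚ (map f xs) ≡ 0ℚ
  sumℚ-zero f [] [] = refl
  sumℚ-zero f (x ∷ xs) (eq ∷ eqs) = cong₂ _+_ eq (sumℚ-zero f xs eqs)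

  v-conv-collinear : ∀ a b c → orient a b c ≡ 0ℚ → v-conv (a ∷ b ∷ c ∷ []) ≡ 0ℚ
  v-conv-collinear a b c o≡0 = sumℚ-zero (fan a) (boundary S) (All.tabulate λ e∈ →
    let x∈ , y∈ , _ = ∈-boundary⁻ S e∈ in flat x∈ y∈)
    where
    S = a ∷ b ∷ c ∷ []
    flat : ∀ {x y} → x ∈ S → y ∈ S → orient a x y ≡ 0ℚ
    flat {_} {y} (here refl) _ = orient-aab a y
    flat {x} {_} _ (here refl) = orient-aba a x
    flat (there (here refl)) (there (here refl)) = orient-abb a b
    flat (there (here refl)) (there (there (here refl))) = o≡0
    flat (there (there (here refl))) (there (there (here refl))) = orient-abb a c
    flat (there (there (here refl))) (there (here refl)) =
      trans (sym (orient-rotate a c b)) (trans (orient-swap b c a) (cong -_ (trans (orient-rotate a b c) o≡0)))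

  v-conv-positive : ∀ a b c → 0ℚ ≤ orient a b c → v-conv (a ∷ b ∷ c ∷ []) ≡ orient a b c
  v-conv-positive a b c 0≤o = decide (orient a b c ℚ.≟ 0ℚ)
    where
    decide : Dec (orient a b c ≡ 0ℚ) → v-conv (a ∷ b ∷ c ∷ []) ≡ orient a b c
    decide (yes o≡0) = trans (v-conv-collinear a b c o≡0) (sym o≡0)
    decide (no o≢0)  = v-conv-triangle {a} {b} {c} {a} {b ∷ c ∷ []} (ℚO.≤∧≢⇒< 0≤o (λ eq → o≢0 (sym eq))) (mk⇔ (λ z → z) (λ z → z))

  v-conv-negative : ∀ a b c → orient a b c ≤ 0ℚ → v-conv (a ∷ b ∷ c ∷ []) ≡ - orient a b c
  v-conv-negative a b c o≤0 = decide (orient a b c ℚ.≟ 0ℚ)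
    where
    decide : Dec (orient a b c ≡ 0ℚ) → v-conv (a ∷ b ∷ c ∷ []) ≡ - orient a b c
    decide (yes o≡0) = trans (v-conv-collinear a b c o≡0) (cong -_ (sym o≡0))
    decide (no o≢0)  = trans (v-conv-triangle {b} {a} {c} {a} {b ∷ c ∷ []} (subst (0ℚ <_) (sym (orient-swap a b c))
        (subst (0ℚ <_) (ℚ.+-identityˡ _) (ℚO.diff< (ℚO.≤∧≢⇒< o≤0 o≢0)))) (mk⇔ swap swap)) (orient-swap a b c)
      where
      swap : ∀ {x y c z : ℚ²} → z ∈ (x ∷ y ∷ c ∷ []) → z ∈ (y ∷ x ∷ c ∷ [])
      swap (here refl)         = there (here refl)
      swap (there (here refl)) = here refl
      swap (there (there z∈))  = there (there z∈)

open Volume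

-- The convex hull of the nonzero lattice points.

module Polygon where
  open import Data.Integer.Base using (_+_; _*_; -_; _-_; _≤_; _<_; ∣_∣; sign; _◃_)

  infixl 6 _-ᵥ_
  _-ᵥ_ : ℤ² → ℤ² → ℤ²
  (a , b) -ᵥ (c , d) = a - c , b - d

  orientℤ : ℤ² → ℤ² → ℤ² → ℤ
  orientℤ a b c = detℤ (b -ᵥ a) (c -ᵥ a)

  dotℤ : ℤ² → ℤ² → ℤ
  dotℤ (a , b) (c , d) = a * c + b * d

  ι-- : ∀ a b → ι a ⊖ ι b ≡ ι (a -ᵥ b)
  ι-- (a₁ , a₂) (b₁ , b₂) = sym (cong₂ _,_ (fromℤ-- a₁ b₁) (fromℤ-- a₂ b₂))

  orient-ι : ∀ a b c → orient (ι a) (ι b) (ι c) ≡ fromℤ (orientℤ a b c)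
  orient-ι a b c = trans (cong₂ det (ι-- b a) (ι-- c a)) (det-ι (b -ᵥ a) (c -ᵥ a))

  ⟨ι,ι⟩ : ∀ x y → ⟨ ι x , ι y ⟩ ≡ fromℤ (dotℤ x y)
  ⟨ι,ι⟩ (a , b) (c , d) = sym (trans (fromℤ-+ (a * c) (b * d)) (cong₂ ℚ._+_ (fromℤ-* a c) (fromℤ-* b d)))

  dot-ι : ∀ a b c → ⟨ ι c ⊖ ι a , ι c ⊖ ι b ⟩ ≡ fromℤ (dotℤ (c -ᵥ a) (c -ᵥ b))
  dot-ι a b c = trans (cong₂ ⟨_,_⟩ (ι-- c a) (ι-- c b)) (⟨ι,ι⟩ (c -ᵥ a) (c -ᵥ b))

  Boundaryℤ : List ℤ² → ℤ² × ℤ² → Set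
  Boundaryℤ S (a , b) = a ≢ b × All (λ c → 0ℤ ≤ orientℤ a b c × (orientℤ a b c ≡ 0ℤ → 0ℤ ≤ dotℤ (c -ᵥ a) (c -ᵥ b))) S

  boundary-ι : ∀ S a b → BoundarySegment (map ι S) (ι a , ι b) ⇔ Boundaryℤ S (a , b)
  boundary-ι S a b = mk⇔
    (λ (a≢b , left) → (λ eq → a≢b (cong ι eq)) , All.map (λ {c} (0≤o , 0≤d) →
       fromℤ-cancel-≤ (subst (0ℚ ℚ.≤_) (orient-ι a b c) 0≤o) ,
       λ o≡0 → fromℤ-cancel-≤ (subst (0ℚ ℚ.≤_) (dot-ι a b c) (0≤d (trans (orient-ι a b c) (cong fromℤ o≡0))))) (All.map⁻ left))
    (λ (a≢b , left) → (λ eq → a≢b (ι-injective eq)) , All.map⁺ (All.map (λ {c} (0≤o , 0≤d) →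
       subst (0ℚ ℚ.≤_) (sym (orient-ι a b c)) (fromℤ-mono-≤ 0≤o) ,
       λ o≡0 → subst (0ℚ ℚ.≤_) (sym (dot-ι a b c)) (fromℤ-mono-≤ (0≤d (fromℤ-injective (trans (sym (orient-ι a b c)) o≡0))))) left))

  ι² : ℤ² × ℤ² → ℚ² × ℚ²
  ι² (a , b) = ι a , ι b

  ι²-injective : ∀ {x y} → ι² x ≡ ι² y → x ≡ y
  ι²-injective eq = cong₂ _,_ (ι-injective (cong proj₁ eq)) (ι-injective (cong proj₂ eq))

  fanℤ : ℤ² → ℤ² × ℤ² → ℤ
  fanℤ o (a , b) = orientℤ o a b

  sum-fan-ι : ∀ o E → sumℚ (map (fan (ι o)) (map ι² E)) ≡ fromℤ (sumℤ (map (fanℤ o) E))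
  sum-fan-ι o [] = refl
  sum-fan-ι o ((a , b) ∷ E) = trans (cong₂ ℚ._+_ (orient-ι o a b) (sum-fan-ι o E)) (sym (fromℤ-+ (orientℤ o a b) (sumℤ (map (fanℤ o) E))))

  v-conv-ℤ : ∀ o S {E} → Unique E →
    (∀ {e} → e ∈ E ⇔ (proj₁ e ∈ (o ∷ S) × proj₂ e ∈ (o ∷ S) × Boundaryℤ (o ∷ S) e)) →
    v-conv (map ι (o ∷ S)) ≡ fromℤ (sumℤ (map (fanℤ o) E))
  v-conv-ℤ o S {E} E! E⇔ = trans (v-conv-enumerated (ι o) (map ι S) (map⁺ ι²-injective E!) (mk⇔ to from)) (sum-fan-ι o E)
    where
    to : ∀ {e} → e ∈ map ι² E → proj₁ e ∈ map ι (o ∷ S) × proj₂ e ∈ map ι (o ∷ S) × BoundarySegment (map ι (o ∷ S)) e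
    to e∈ =
      let (a , b) , ab∈ , eq = ∈-map⁻ ι² e∈
          a∈ , b∈ , segment = Equivalence.to E⇔ ab∈
      in subst (λ e → proj₁ e ∈ map ι (o ∷ S) × proj₂ e ∈ map ι (o ∷ S) × BoundarySegment (map ι (o ∷ S)) e) (sym eq)
           (∈-map⁺ ι a∈ , ∈-map⁺ ι b∈ , Equivalence.from (boundary-ι (o ∷ S) a b) segment)
    from : ∀ {e} → proj₁ e ∈ map ι (o ∷ S) × proj₂ e ∈ map ι (o ∷ S) × BoundarySegment (map ι (o ∷ S)) e → e ∈ map ι² E
    from {e} (x∈ , y∈ , segment) =
      let a , a∈ , x≡ = ∈-map⁻ ι x∈
          b , b∈ , y≡ = ∈-map⁻ ι y∈
      in subst (_∈ map ι² E) (sym (cong₂ _,_ x≡ y≡)) (∈-map⁺ ι² (Equivalence.from E⇔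
           (a∈ , b∈ , Equivalence.to (boundary-ι (o ∷ S) a b) (subst (BoundarySegment (map ι (o ∷ S))) (cong₂ _,_ x≡ y≡) segment))))

  orientℤ-expand : ∀ a b c → orientℤ a b c ≡ detℤ b c + detℤ a b - detℤ a c
  orientℤ-expand (a₁ , a₂) (b₁ , b₂) (c₁ , c₂) = poly a₁ a₂ b₁ b₂ c₁ c₂
    where
    poly : ∀ a₁ a₂ b₁ b₂ c₁ c₂ → (b₁ - a₁) * (c₂ - a₂) - (b₂ - a₂) * (c₁ - a₁) ≡
           (b₁ * c₂ - b₂ * c₁) + (a₁ * b₂ - a₂ * b₁) - (a₁ * c₂ - a₂ * c₁)
    poly = solve-∀ ℤ-ring

  sumℤ-++ : ∀ {A : Set} (f : A → ℤ) xs ys → sumℤ (map f (xs ++ ys)) ≡ sumℤ (map f xs) + sumℤ (map f ys)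
  sumℤ-++ f [] ys = sym (ℤ.+-identityˡ _)
  sumℤ-++ f (x ∷ xs) ys = trans (cong (_+_ (f x)) (sumℤ-++ f xs ys)) (sym (ℤ.+-assoc (f x) _ _))

  segments-unique : ∀ {v p q} (c : Chain v p q) → Unique (segments c)
  segments-unique (end _) = [] ∷ []
  segments-unique {p = p} (step b e c) = All.tabulate (λ s∈ eq → ℤ.<-irrefl (sym (det-self p))
    (subst (λ x → 0ℤ < detℤ p x) (sym (cong proj₁ eq)) (All.lookup (det-first>0 b e c refl) (proj₁ (segment-points c s∈)))))
    ∷ segments-unique c

  -- Traversed backwards, each segment has determinant -1 and the terms det o _ telescope. This is
  -- how the k unimodular triangles between the chain and the origin get subtracted.
  sum-chain : ∀ o {v p q} (c : Chain v p q) → sumℤ (map (fanℤ o) (map ×-swap (segments c))) ≡ detℤ o v - detℤ o p - size c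
  sum-chain o {v} {p} (end e) = trans (cong (_+ 0ℤ) (orientℤ-expand o v p))
    (trans (cong (λ z → z + detℤ o v - detℤ o p + 0ℤ) (trans (det-anti p v) (cong -_ e))) (poly (detℤ o v) (detℤ o p)))
    where
    poly : ∀ v p → - 1ℤ + v - p + 0ℤ ≡ v - p - 1ℤ
    poly = solve-∀ ℤ-ring
  sum-chain o {v} {p} {q} (step b e c) = trans (cong₂ _+_ (orientℤ-expand o q p) (sum-chain o c))
    (trans (cong (λ z → z + detℤ o q - detℤ o p + (detℤ o v - detℤ o q - size c)) (trans (det-anti p q) (cong -_ e)))
           (poly (detℤ o v) (detℤ o p) (detℤ o q) (size c)))
    where
    poly : ∀ v p q k → - 1ℤ + q - p + (v - q - k) ≡ v - p - (1ℤ + k)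
    poly = solve-∀ ℤ-ring

  along : ℤ² → ℤ² → ℕ → ℤ²
  along (u₁ , u₂) (w₁ , w₂) s = u₁ + + s * w₁ , u₂ + + s * w₂

  coprime-quotients : ∀ m n g → gcd m n ≡ suc g →
                      ∃[ q₁ ] ∃[ q₂ ] m ≡ q₁ ℕ.* suc g × n ≡ q₂ ℕ.* suc g × Coprimeℕ q₁ q₂
  coprime-quotients m n g eq =
    m ℕ./ gcd m n , n ℕ./ gcd m n ,
    trans (sym (m/n*n≡m (gcd[m,n]∣m m n))) (cong (m ℕ./ gcd m n ℕ.*_) eq) ,
    trans (sym (m/n*n≡m (gcd[m,n]∣n m n))) (cong (n ℕ./ gcd m n ℕ.*_) eq) ,
    coprime-/gcd m n
    where instance nonZero = ℕ.≢-nonZero {gcd m n} (λ z → ℕ.1+n≢0 (trans (sym eq) z))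

  -- The factor is the content of d and w its primitive direction. The vector f completes w to a
  -- basis, which is the form in which primitivity is used.
  direction : ∀ d → d ≢ 0ℤ² → ∃[ g ] ∃[ w ] ∃[ f ] d ≡ (+ suc g * proj₁ w , + suc g * proj₂ w) × detℤ w f ≡ 1ℤ
  direction d@(d₁ , d₂) d≢0 = split (gcd ∣ d₁ ∣ ∣ d₂ ∣) refl
    where
    coordinate : ∀ d q g → ∣ d ∣ ≡ q ℕ.* g → d ≡ + g * (sign d ◃ q)
    coordinate d q g eq = trans (sym (ℤ.signᵢ◃∣i∣≡i d)) (trans (cong (sign d ◃_) eq)
      (trans (cong (_◃ (q ℕ.* g)) (sym (Sign.*-identityʳ (sign d)))) (trans (ℤ.◃-distrib-* (sign d) Sign.+ q g)
        (trans (cong ((sign d ◃ q) *_) (ℤ.+◃n≡+n g)) (ℤ.*-comm (sign d ◃ q) (+ g))))))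
    split : ∀ g → gcd ∣ d₁ ∣ ∣ d₂ ∣ ≡ g →
            ∃[ g ] ∃[ w ] ∃[ f ] d ≡ (+ suc g * proj₁ w , + suc g * proj₂ w) × detℤ w f ≡ 1ℤ
    split zero eq = contradiction (cong₂ _,_ (ℤ.∣i∣≡0⇒i≡0 (gcd[m,n]≡0⇒m≡0 eq)) (ℤ.∣i∣≡0⇒i≡0 (gcd[m,n]≡0⇒n≡0 ∣ d₁ ∣ eq))) d≢0
    split (suc g) eq =
      let q₁ , q₂ , eq₁ , eq₂ , coprime = coprime-quotients ∣ d₁ ∣ ∣ d₂ ∣ g eq
          w = sign d₁ ◃ q₁ , sign d₂ ◃ q₂
          f , wf≡1 = primitive⇒basis w (subst₂ Coprimeℕ (sym (ℤ.abs-◃ (sign d₁) q₁)) (sym (ℤ.abs-◃ (sign d₂) q₂)) coprime)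
      in g , w , f , cong₂ _,_ (coordinate d₁ q₁ (suc g) eq₁) (coordinate d₂ q₂ (suc g) eq₂) , wf≡1

  square-positive : ∀ i → i ≢ 0ℤ → 0ℤ < i * i
  square-positive (+ zero)   i≢0 = contradiction refl i≢0
  square-positive (+ suc n)  _   = +<+ (s≤s z≤n)
  square-positive ℤ.-[1+ n ] _   = +<+ (s≤s z≤n)

  square-nonneg : ∀ i → 0ℤ ≤ i * i
  square-nonneg i = decide (i ℤ.≟ 0ℤ)
    where
    decide : Dec (i ≡ 0ℤ) → 0ℤ ≤ i * i
    decide (yes refl) = ℤ.≤-refl
    decide (no i≢0)   = ℤ.<⇒≤ (square-positive i i≢0)

  norm-positive : ∀ z f → detℤ z f ≡ 1ℤ → 0ℤ < dotℤ z z
  norm-positive z@(z₁ , z₂) f@(f₁ , f₂) zf≡1 = decide (z₁ ℤ.≟ 0ℤ) (z₂ ℤ.≟ 0ℤ)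
    where
    decide : Dec (z₁ ≡ 0ℤ) → Dec (z₂ ≡ 0ℤ) → 0ℤ < z₁ * z₁ + z₂ * z₂
    decide (no z₁≢0)  _          = ℤO.0<+ (square-positive z₁ z₁≢0) (square-nonneg z₂)
    decide (yes _)    (no z₂≢0)  = subst (0ℤ <_) (ℤ.+-comm (z₂ * z₂) (z₁ * z₁)) (ℤO.0<+ (square-positive z₂ z₂≢0) (square-nonneg z₁))
    decide (yes z₁≡0) (yes z₂≡0) = contradiction (cong₂ _,_ z₁≡0 z₂≡0) (proj₁ (basis-nonzero {z} {f} zf≡1))

  dot-multiple : ∀ y z t → y ≡ (t * proj₁ z , t * proj₂ z) → dotℤ y (y -ᵥ z) ≡ t * (t - 1ℤ) * dotℤ z z
  dot-multiple _ (z₁ , z₂) t refl = poly z₁ z₂ t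
    where
    poly : ∀ z₁ z₂ t → t * z₁ * (t * z₁ - z₁) + t * z₂ * (t * z₂ - z₂) ≡ t * (t - 1ℤ) * (z₁ * z₁ + z₂ * z₂)
    poly = solve-∀ ℤ-ring

  -ᵥ-shift : ∀ a b c → c -ᵥ b ≡ (c -ᵥ a) -ᵥ (b -ᵥ a)
  -ᵥ-shift (a₁ , a₂) (b₁ , b₂) (c₁ , c₂) = cong₂ _,_ (poly a₁ b₁ c₁) (poly a₂ b₂ c₂)
    where
    poly : ∀ a b c → c - b ≡ (c - a) - (b - a)
    poly = solve-∀ ℤ-ring

  parallel-multiple : ∀ z f x → detℤ z f ≡ 1ℤ → detℤ z x ≡ 0ℤ → x ≡ (detℤ x f * proj₁ z , detℤ x f * proj₂ z)
  parallel-multiple z f x zf≡1 zx≡0 = trans (combination z f x zf≡1 refl zx≡0) (cong₂ _,_ (poly (detℤ x f) (proj₁ z) (proj₁ f)) (poly (detℤ x f) (proj₂ z) (proj₂ f)))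
    where
    poly : ∀ t z f → t * z + 0ℤ * f ≡ t * z
    poly = solve-∀ ℤ-ring

  -- No lattice point lies strictly between a and b when b - a is primitive.
  collinear-dot : ∀ a b c f → detℤ (b -ᵥ a) f ≡ 1ℤ → orientℤ a b c ≡ 0ℤ → 0ℤ ≤ dotℤ (c -ᵥ a) (c -ᵥ b)
  -- c - a = t (b - a) for an integer t, so the dot product is t (t - 1) |b - a|².
  collinear-dot a b c f zf≡1 o≡0 = subst (0ℤ ≤_)
    (sym (trans (cong (dotℤ (c -ᵥ a)) (-ᵥ-shift a b c)) (dot-multiple (c -ᵥ a) (b -ᵥ a) t (parallel-multiple (b -ᵥ a) f (c -ᵥ a) zf≡1 o≡0))))
    (ℤO.0≤* (ℤO.0≤t[t-1] t) (ℤ.<⇒≤ (norm-positive (b -ᵥ a) f zf≡1)))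
    where
    t = detℤ (c -ᵥ a) f

  det-alongʳ : ∀ x u w s → detℤ x (along u w s) ≡ detℤ x u + + s * detℤ x w
  det-alongʳ (x₁ , x₂) (u₁ , u₂) (w₁ , w₂) s = poly x₁ x₂ u₁ u₂ w₁ w₂ (+ s)
    where
    poly : ∀ x₁ x₂ u₁ u₂ w₁ w₂ s → x₁ * (u₂ + s * w₂) - x₂ * (u₁ + s * w₁) ≡ (x₁ * u₂ - x₂ * u₁) + s * (x₁ * w₂ - x₂ * w₁)
    poly = solve-∀ ℤ-ring

  det-alongˡ : ∀ x u w s → detℤ (along u w s) x ≡ detℤ u x + + s * detℤ w x
  det-alongˡ (x₁ , x₂) (u₁ , u₂) (w₁ , w₂) s = poly x₁ x₂ u₁ u₂ w₁ w₂ (+ s)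
    where
    poly : ∀ x₁ x₂ u₁ u₂ w₁ w₂ s → (u₁ + s * w₁) * x₂ - (u₂ + s * w₂) * x₁ ≡ (u₁ * x₂ - u₂ * x₁) + s * (w₁ * x₂ - w₂ * x₁)
    poly = solve-∀ ℤ-ring

  det-zeroˡ : ∀ x → detℤ 0ℤ² x ≡ 0ℤ
  det-zeroˡ (x₁ , x₂) = poly x₁ x₂
    where
    poly : ∀ a b → 0ℤ * b - 0ℤ * a ≡ 0ℤ
    poly = solve-∀ ℤ-ring

  -- With d = det u v, d z is the combination of u, v and 0 with coefficients det z v, det u z and d
  -- - `weight u v z`, whose sum is d. The function `orientℤ a b` is affine, and its value at 0 is -
  -- det b a.
  orient-cramer : ∀ u v a b z → detℤ z v * orientℤ a b u + detℤ u z * orientℤ a b v ≡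
                  detℤ u v * orientℤ a b z + (detℤ u v - weight u v z) * detℤ b a
  orient-cramer (u₁ , u₂) (v₁ , v₂) (a₁ , a₂) (b₁ , b₂) (z₁ , z₂) = solveℤ 10
    (λ u₁ u₂ v₁ v₂ a₁ a₂ b₁ b₂ z₁ z₂ →
      let u = (u₁ , u₂) ; v = (v₁ , v₂) ; a = (a₁ , a₂) ; b = (b₁ , b₂) ; z = (z₁ , z₂)
          o = λ x → :det (b₁ :- a₁ , b₂ :- a₂) (proj₁ x :- a₁ , proj₂ x :- a₂)
      in :det z v :* o u :+ :det u z :* o v := :det u v :* o z :+ (:det u v :- (:det z v :+ :det u z)) :* :det b a)
    refl u₁ u₂ v₁ v₂ a₁ a₂ b₁ b₂ z₁ z₂

  multiple-between : ∀ {d t} → 0ℤ < d → 0ℤ ≤ t * d → t * d ≤ d → t ≢ 0ℤ → t ≡ 1ℤ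
  multiple-between {d} {t} 0<d 0≤td td≤d t≢0 = ℤ.≤-antisym
    (ℤ.*-cancelʳ-≤-pos t 1ℤ d {{ℤ.positive 0<d}} (subst (t * d ≤_) (sym (ℤ.*-identityˡ d)) td≤d))
    (ℤO.0<⇒1≤ (ℤ.≤∧≢⇒< (ℤO.0≤-cancel 0<d (subst (0ℤ ≤_) (ℤ.*-comm t d) 0≤td)) (t≢0 ∘ sym)))

  ray-first : ∀ {v u q} (c : Chain v u q) n → LatticePoint u v n → detℤ u n ≡ 0ℤ → n ≡ u
  ray-first {v} {u} {q} c n ((0≤α , 0≤β , w≤d) , n≢0) β≡0 =
    trans n≡tu (trans (cong (λ t → t * proj₁ u , t * proj₂ u) t≡1) (cong₂ _,_ (ℤ.*-identityˡ _) (ℤ.*-identityˡ _)))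
    where
    t = detℤ n q
    drop : ∀ t a b → t * a + 0ℤ * b ≡ t * a
    drop = solve-∀ ℤ-ring
    n≡tu : n ≡ (t * proj₁ u , t * proj₂ u)
    n≡tu = trans (combination u q n (first-det c) refl β≡0) (cong₂ _,_ (drop t (proj₁ u) (proj₁ q)) (drop t (proj₂ u) (proj₂ q)))
    scale : ∀ t u v → detℤ (t * proj₁ u , t * proj₂ u) v ≡ t * detℤ u v
    scale t (u₁ , u₂) (v₁ , v₂) = poly t u₁ u₂ v₁ v₂
      where
      poly : ∀ t u₁ u₂ v₁ v₂ → t * u₁ * v₂ - t * u₂ * v₁ ≡ t * (u₁ * v₂ - u₂ * v₁)
      poly = solve-∀ ℤ-ring
    α≡td : detℤ n v ≡ t * detℤ u v
    α≡td = trans (cong (λ z → detℤ z v) n≡tu) (scale t u v)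
    t≡1 : t ≡ 1ℤ
    t≡1 = multiple-between (det-end>0 c) (subst (0ℤ ≤_) α≡td 0≤α)
      (subst (_≤ detℤ u v) (trans (cong₂ _+_ α≡td β≡0) (ℤ.+-identityʳ _)) w≤d)
      (λ t≡0 → n≢0 (trans n≡tu (cong (λ t → t * proj₁ u , t * proj₂ u) t≡0)))

  ray-last : ∀ {v u q} (c : Chain v u q) n → LatticePoint u v n → detℤ n v ≡ 0ℤ → n ≡ v
  ray-last {v} {u} c n ((0≤α , 0≤β , w≤d) , n≢0) α≡0 =
    trans n≡tv (trans (cong (λ t → t * proj₁ v , t * proj₂ v) t≡1) (cong₂ _,_ (ℤ.*-identityˡ _) (ℤ.*-identityˡ _)))
    where
    p = penultimate c
    t = detℤ p n
    drop : ∀ t a b → 0ℤ * b + t * a ≡ t * a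
    drop = solve-∀ ℤ-ring
    n≡tv : n ≡ (t * proj₁ v , t * proj₂ v)
    n≡tv = trans (combination p v n (penultimate-det c) α≡0 refl) (cong₂ _,_ (drop t (proj₁ v) (proj₁ p)) (drop t (proj₂ v) (proj₂ p)))
    scale : ∀ t u v → detℤ u (t * proj₁ v , t * proj₂ v) ≡ t * detℤ u v
    scale t (u₁ , u₂) (v₁ , v₂) = poly t u₁ u₂ v₁ v₂
      where
      poly : ∀ t u₁ u₂ v₁ v₂ → u₁ * (t * v₂) - u₂ * (t * v₁) ≡ t * (u₁ * v₂ - u₂ * v₁)
      poly = solve-∀ ℤ-ring
    β≡td : detℤ u n ≡ t * detℤ u v
    β≡td = trans (cong (detℤ u) n≡tv) (scale t u v)
    t≡1 : t ≡ 1ℤ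
    t≡1 = multiple-between (det-end>0 c) (subst (0ℤ ≤_) β≡td 0≤β)
      (subst (_≤ detℤ u v) (trans (cong₂ _+_ α≡0 β≡td) (ℤ.+-identityˡ _)) w≤d)
      (λ t≡0 → n≢0 (trans n≡tv (cong (λ t → t * proj₁ v , t * proj₂ v) t≡0)))

  sum≡0 : ∀ {a b} → 0ℤ ≤ a → 0ℤ ≤ b → a + b ≡ 0ℤ → a ≡ 0ℤ × b ≡ 0ℤ
  sum≡0 {a} {b} 0≤a 0≤b eq =
    ℤ.≤-antisym (subst (a ≤_) eq (subst (_≤ a + b) (ℤ.+-identityʳ a) (ℤ.+-monoʳ-≤ a 0≤b))) 0≤a ,
    ℤ.≤-antisym (subst (b ≤_) eq (subst (_≤ a + b) (ℤ.+-identityˡ b) (ℤ.+-monoˡ-≤ b 0≤a))) 0≤b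

  nonzero-factor : ∀ a {b} → b ≢ 0ℤ → a * b ≡ 0ℤ → a ≡ 0ℤ
  nonzero-factor a b≢0 eq with ℤ.i*j≡0⇒i≡0∨j≡0 a eq
  ... | inj₁ a≡0 = a≡0
  ... | inj₂ b≡0 = contradiction b≡0 b≢0

  orient-aba≡0 : ∀ a b → orientℤ a b a ≡ 0ℤ
  orient-aba≡0 (a₁ , a₂) (b₁ , b₂) = poly a₁ a₂ b₁ b₂
    where
    poly : ∀ a₁ a₂ b₁ b₂ → (b₁ - a₁) * (a₂ - a₂) - (b₂ - a₂) * (a₁ - a₁) ≡ 0ℤ
    poly = solve-∀ ℤ-ring

  orient-abb≡0 : ∀ a b → orientℤ a b b ≡ 0ℤ
  orient-abb≡0 a b = det-self (b -ᵥ a)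

  sum-path : ∀ o k (x : ℕ → ℤ²) → (∀ s → detℤ (x s) (x (suc s)) ≡ k) → ∀ n →
             sumℤ (map (fanℤ o) (applyUpTo (λ s → x s , x (suc s)) n)) ≡ + n * k + detℤ o (x 0) - detℤ o (x n)
  sum-path o k x step≡k zero = poly k (detℤ o (x 0))
    where
    poly : ∀ k a → 0ℤ ≡ 0ℤ * k + a - a
    poly = solve-∀ ℤ-ring
  sum-path o k x step≡k (suc n) = trans (cong₂ _+_
      (trans (orientℤ-expand o (x 0) (x 1)) (cong (λ z → z + detℤ o (x 0) - detℤ o (x 1)) (step≡k 0)))
      (sum-path o k (λ s → x (suc s)) (λ s → step≡k (suc s)) n))
    (poly (+ n) k (detℤ o (x 0)) (detℤ o (x 1)) (detℤ o (x (suc n))))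
    where
    poly : ∀ n k a b c → k + a - b + (n * k + b - c) ≡ (1ℤ + n) * k + a - c
    poly = solve-∀ ℤ-ring

  -- The convex hull of the nonzero lattice points is bounded by the chain,
  -- traversed from v to u, and by the lattice segments of the edge from u to v.
  module Hull {v u q : ℤ²} (c : Chain v u q) (S : List ℤ²) (S⇔ : ∀ n → n ∈ S ⇔ LatticePoint u v n)
              (g : ℕ) (w f : ℤ²) (0<g : 0ℤ < + g) (v≡e : v ≡ along u w g) (wf≡1 : detℤ w f ≡ 1ℤ) where

    lattice : ∀ {n} → n ∈ S → LatticePoint u v n
    lattice {n} = Equivalence.to (S⇔ n)

    chain∈ : ∀ {n} → n ∈ points c → n ∈ S
    chain∈ {n} n∈ = Equivalence.from (S⇔ n) (chain-points c n∈)

    d : ℤ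
    d = detℤ u v

    0<d : 0ℤ < d
    0<d = det-end>0 c

    e : ℕ → ℤ²
    e = along u w

    k : ℤ
    k = detℤ u w

    d≡gk : d ≡ + g * k
    d≡gk = trans (cong (detℤ u) v≡e) (trans (det-alongʳ u u w g) (trans (cong (_+ + g * k) (det-self u)) (ℤ.+-identityˡ _)))

    0<k : 0ℤ < k
    0<k = ℤO.0<-cancel {+ g} (+≤+ z≤n) (subst (0ℤ <_) d≡gk 0<d)

    -- Because v = u + g w, the weight is g times the form det _ w, whose value on the edge is k.
    weight-height : ∀ n → weight u v n ≡ + g * detℤ n w
    weight-height n = trans (cong (_+ detℤ u n) (trans (cong (detℤ n) v≡e) (det-alongʳ n u w g)))
      (trans (cong (λ z → detℤ n u + + g * detℤ n w + z) (det-anti n u)) (poly (detℤ n u) (+ g * detℤ n w)))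
      where
      poly : ∀ a b → a + b + - a ≡ b
      poly = solve-∀ ℤ-ring

    height≤k : ∀ {n} → n ∈ S → detℤ n w ≤ k
    height≤k {n} n∈ = ℤ.*-cancelˡ-≤-pos (detℤ n w) k (+ g) {{ℤ.positive 0<g}}
      (subst₂ _≤_ (weight-height n) d≡gk (proj₂ (proj₂ (proj₁ (lattice n∈)))))

    e-difference : ∀ s → e (suc s) -ᵥ e s ≡ w
    e-difference s = cong₂ _,_ (poly (proj₁ u) (proj₁ w) (+ s)) (poly (proj₂ u) (proj₂ w) (+ s))
      where
      poly : ∀ u w s → (u + (1ℤ + s) * w) - (u + s * w) ≡ w
      poly = solve-∀ ℤ-ring

    orient-e : ∀ s n → orientℤ (e s) (e (suc s)) n ≡ k - detℤ n w
    orient-e s n@(n₁ , n₂) = trans (cong (λ z → detℤ z (n -ᵥ e s)) (e-difference s))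
      (poly (proj₁ w) (proj₂ w) (proj₁ u) (proj₂ u) n₁ n₂ (+ s))
      where
      poly : ∀ w₁ w₂ u₁ u₂ n₁ n₂ s → w₁ * (n₂ - (u₂ + s * w₂)) - w₂ * (n₁ - (u₁ + s * w₁)) ≡
             (u₁ * w₂ - u₂ * w₁) - (n₁ * w₂ - n₂ * w₁)
      poly = solve-∀ ℤ-ring

    det-ew : ∀ s → detℤ (e s) w ≡ k
    det-ew s = trans (det-alongˡ w u w s) (trans (cong (λ z → k + + s * z) (det-self w)) (poly k (+ s)))
      where
      poly : ∀ k s → k + s * 0ℤ ≡ k
      poly = solve-∀ ℤ-ring

    det-ue : ∀ s → detℤ u (e s) ≡ + s * k
    det-ue s = trans (det-alongʳ u u w s) (trans (cong (_+ + s * k) (det-self u)) (ℤ.+-identityˡ _))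

    det-ev : ∀ s → detℤ (e s) v ≡ (+ g - + s) * k
    det-ev s = trans (poly₁ (detℤ (e s) v) (detℤ u (e s))) (trans (cong₂ _-_
      (trans (weight-height (e s)) (cong (+ g *_) (det-ew s))) (det-ue s)) (poly₂ (+ g) (+ s) k))
      where
      poly₁ : ∀ a b → a ≡ (a + b) - b
      poly₁ = solve-∀ ℤ-ring
      poly₂ : ∀ g s k → g * k - s * k ≡ (g - s) * k
      poly₂ = solve-∀ ℤ-ring

    e∈ : ∀ {s} → s ℕ.≤ g → e s ∈ S
    e∈ {s} s≤g = Equivalence.from (S⇔ (e s))
      ((subst (0ℤ ≤_) (sym (det-ev s)) (ℤO.0≤* (ℤO.diff (+≤+ s≤g)) (ℤ.<⇒≤ 0<k)) ,
        subst (0ℤ ≤_) (sym (det-ue s)) (ℤO.0≤* {+ s} (+≤+ z≤n) (ℤ.<⇒≤ 0<k)) ,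
        ℤ.≤-reflexive (trans (weight-height (e s)) (trans (cong (+ g *_) (det-ew s)) (sym d≡gk)))) ,
       λ eq → ℤ.<-irrefl (trans (sym (det-zeroˡ w)) (trans (cong (λ z → detℤ z w) (sym eq)) (det-ew s))) 0<k)

    on-edge : ∀ {n} → n ∈ S → weight u v n ≡ d → ∃[ s ] s ℕ.≤ g × n ≡ e s
    on-edge {n} n∈ w≡d =
      let ((0≤α , 0≤β , _) , _) = lattice n∈
          s , t≡s = nonneg⇒ℕ (ℤO.0≤-cancel 0<k (subst (0ℤ ≤_) (trans β≡tk (ℤ.*-comm t k)) 0≤β))
          n≡es = n≡ s t≡s
          0≤g-s = ℤO.0≤-cancel 0<k (subst (0ℤ ≤_) (trans (trans (cong (λ z → detℤ z v) n≡es) (det-ev s)) (ℤ.*-comm (+ g - + s) k)) 0≤α)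
      in s , ℤ.drop‿+≤+ (ℤO.undiff 0≤g-s) , n≡es
      where
      h≡k : detℤ n w ≡ k
      h≡k = ℤ.*-cancelˡ-≡ (+ g) (detℤ n w) k {{ℤ.≢-nonZero (λ eq → ℤ.<-irrefl (sym eq) 0<g)}} (trans (sym (weight-height n)) (trans w≡d d≡gk))
      parallel : detℤ w (n -ᵥ u) ≡ 0ℤ
      parallel = trans (poly (proj₁ w) (proj₂ w) (proj₁ n) (proj₂ n) (proj₁ u) (proj₂ u)) (ℤ.i≡j⇒i-j≡0 (sym h≡k))
        where
        poly : ∀ w₁ w₂ n₁ n₂ u₁ u₂ → w₁ * (n₂ - u₂) - w₂ * (n₁ - u₁) ≡ (u₁ * w₂ - u₂ * w₁) - (n₁ * w₂ - n₂ * w₁)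
        poly = solve-∀ ℤ-ring
      t : ℤ
      t = detℤ (n -ᵥ u) f
      n-u≡tw : n -ᵥ u ≡ (t * proj₁ w , t * proj₂ w)
      n-u≡tw = parallel-multiple w f (n -ᵥ u) wf≡1 parallel
      n≡ : ∀ s → t ≡ + s → n ≡ e s
      n≡ s t≡s = cong₂ _,_ (coordinate (proj₁ n) (proj₁ u) (proj₁ w) (cong proj₁ n-u≡tw)) (coordinate (proj₂ n) (proj₂ u) (proj₂ w) (cong proj₂ n-u≡tw))
        where
        poly : ∀ a b → a ≡ b + (a - b)
        poly = solve-∀ ℤ-ring
        coordinate : ∀ a b w → a - b ≡ t * w → a ≡ b + + s * w
        coordinate a b w eq = trans (poly a b) (cong (_+_ b) (trans eq (cong (_* w) t≡s)))
      β≡tk : detℤ u n ≡ t * k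
      β≡tk = trans (poly₁ (proj₁ u) (proj₂ u) (proj₁ n) (proj₂ n)) (trans (cong (detℤ u) n-u≡tw) (poly₂ (proj₁ u) (proj₂ u) (proj₁ w) (proj₂ w) t))
        where
        poly₁ : ∀ u₁ u₂ n₁ n₂ → u₁ * n₂ - u₂ * n₁ ≡ u₁ * (n₂ - u₂) - u₂ * (n₁ - u₁)
        poly₁ = solve-∀ ℤ-ring
        poly₂ : ∀ u₁ u₂ w₁ w₂ t → u₁ * (t * w₂) - u₂ * (t * w₁) ≡ t * (u₁ * w₂ - u₂ * w₁)
        poly₂ = solve-∀ ℤ-ring

    edges : List (ℤ² × ℤ²)
    edges = applyUpTo (λ s → e s , e (suc s)) g

    hull : List (ℤ² × ℤ²)
    hull = map ×-swap (segments c) ++ edges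

    edges-unique : Unique edges
    edges-unique = applyUpTo⁺₁ _ g λ {i} {j} i<j _ eq → ℕ.<⇒≢ i<j (ℤ.+-injective (injective (+ i) (+ j)
      (trans (sym (det-f i)) (trans (cong (λ z → detℤ (proj₁ z) f) eq) (det-f j)))))
      where
      det-f : ∀ s → detℤ (e s) f ≡ detℤ u f + + s
      det-f s = trans (det-alongˡ f u w s) (cong (_+_ (detℤ u f)) (trans (cong (+ s *_) wf≡1) (ℤ.*-identityʳ (+ s))))
      poly : ∀ a i → i ≡ a + i - a
      poly = solve-∀ ℤ-ring
      injective : ∀ i j → detℤ u f + i ≡ detℤ u f + j → i ≡ j
      injective i j eq = trans (poly (detℤ u f) i) (trans (cong (_- detℤ u f) eq) (sym (poly (detℤ u f) j)))

    det-step : ∀ s → detℤ (e s) (e (suc s)) ≡ k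
    det-step s = poly (proj₁ u) (proj₂ u) (proj₁ w) (proj₂ w) (+ s)
      where
      poly : ∀ u₁ u₂ w₁ w₂ s → (u₁ + s * w₁) * (u₂ + (1ℤ + s) * w₂) - (u₂ + s * w₂) * (u₁ + (1ℤ + s) * w₁) ≡ u₁ * w₂ - u₂ * w₁
      poly = solve-∀ ℤ-ring

    chain-negative : ∀ {x} → x ∈ map ×-swap (segments c) → detℤ (proj₁ x) (proj₂ x) ≡ - 1ℤ
    chain-negative x∈ =
      let (a , b) , s∈ , eq = ∈-map⁻ ×-swap x∈
      in trans (cong (λ z → detℤ (proj₁ z) (proj₂ z)) eq) (trans (det-anti a b) (cong -_ (segment-det c s∈)))

    hull-unique : Unique hull
    hull-unique = ++⁺ (map⁺ (λ eq → cong ×-swap eq) (segments-unique c)) edges-unique λ { {x} (x∈ , x∈′) →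
      let s , _ , eq = ∈-applyUpTo⁻ _ x∈′
      in negative-k (trans (sym (chain-negative x∈)) (trans (cong (λ z → detℤ (proj₁ z) (proj₂ z)) eq) (det-step s))) }
      where
      negative-k : - 1ℤ ≢ k
      negative-k eq = contradiction (subst (0ℤ <_) (sym eq) 0<k) λ ()

    chain-boundary : ∀ {x y} → (x , y) ∈ segments c → Boundaryℤ S (y , x)
    chain-boundary {x} {y} s∈ = y≢x , All.tabulate λ {n} n∈ →
      subst (0ℤ ≤_) (sym (orient-height n)) (ℤO.diff (All.lookup (height≥1 c n (lattice n∈)) s∈)) ,
      collinear-dot y x n y (trans (poly₁ (proj₁ x) (proj₂ x) (proj₁ y) (proj₂ y)) xy≡1)
      where
      xy≡1 : detℤ x y ≡ 1ℤ
      xy≡1 = segment-det c s∈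
      y≢x : y ≢ x
      y≢x eq = contradiction (trans (sym (det-self x)) (trans (cong (detℤ x) (sym eq)) xy≡1)) λ ()
      poly₁ : ∀ x₁ x₂ y₁ y₂ → (x₁ - y₁) * y₂ - (x₂ - y₂) * y₁ ≡ x₁ * y₂ - x₂ * y₁
      poly₁ = solve-∀ ℤ-ring
      orient-height : ∀ n → orientℤ y x n ≡ heightℤ (x , y) n - 1ℤ
      orient-height n = trans (orientℤ-expand y x n) (trans (cong₂ (λ a b → detℤ x n + a - b)
        (trans (det-anti x y) (cong -_ xy≡1)) (det-anti n y)) (poly₃ (detℤ x n) (detℤ n y)))
        where
        poly₃ : ∀ a b → a + - 1ℤ - - b ≡ a + b - 1ℤ
        poly₃ = solve-∀ ℤ-ring

    edge-boundary : ∀ s → Boundaryℤ S (e s , e (suc s))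
    edge-boundary s = distinct , All.tabulate λ {n} n∈ →
      subst (0ℤ ≤_) (sym (orient-e s n)) (ℤO.diff (height≤k n∈)) ,
      collinear-dot (e s) (e (suc s)) n f (trans (cong (λ z → detℤ z f) (e-difference s)) wf≡1)
      where
      distinct : e s ≢ e (suc s)
      distinct eq = ℤ.<-irrefl (trans (sym (det-self (e s))) (trans (cong (detℤ (e s)) eq) (det-step s))) 0<k

    boundary-left : ∀ {a b} → Boundaryℤ S (a , b) → ∀ {n} → n ∈ S → 0ℤ ≤ orientℤ a b n
    boundary-left (_ , left) n∈ = proj₁ (All.lookup left n∈)

    boundary-dot : ∀ {a b} → Boundaryℤ S (a , b) → ∀ {n} → n ∈ S → orientℤ a b n ≡ 0ℤ → 0ℤ ≤ dotℤ (n -ᵥ a) (n -ᵥ b)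
    boundary-dot (_ , left) n∈ = proj₂ (All.lookup left n∈)

    u∈ : u ∈ S
    u∈ = chain∈ (first∈ c)

    v∈ : v ∈ S
    v∈ = chain∈ (last∈ c)

    -- If the line through a and b contains 0, `orient-cramer` at a and at b is a vanishing sum of
    -- nonnegative terms. If u is off the line, then a and b both equal v. If v is off the line,
    -- both equal u. If neither is, the independent vectors u and v lie on a common line with 0,
    -- which is possible only for a = b.
    not-radial : ∀ {a b} → a ∈ S → b ∈ S → Boundaryℤ S (a , b) → detℤ b a ≢ 0ℤ
    not-radial {a} {b} a∈ b∈ boundary ba≡0 = decide (o u ℤ.≟ 0ℤ) (o v ℤ.≟ 0ℤ)
      where
      o : ℤ² → ℤ
      o = orientℤ a b
      balance : ∀ z → orientℤ a b z ≡ 0ℤ → detℤ z v * o u + detℤ u z * o v ≡ 0ℤ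
      balance z oz≡0 = trans (orient-cramer u v a b z) (trans (cong₂ (λ x y → d * x + (d - weight u v z) * y) oz≡0 ba≡0)
        (poly d (d - weight u v z)))
        where
        poly : ∀ a b → a * 0ℤ + b * 0ℤ ≡ 0ℤ
        poly = solve-∀ ℤ-ring
      vanish-terms : ∀ {z} → z ∈ S → orientℤ a b z ≡ 0ℤ → detℤ z v * o u ≡ 0ℤ × detℤ u z * o v ≡ 0ℤ
      vanish-terms {z} z∈ oz≡0 = sum≡0 (ℤO.0≤* (proj₁ (proj₁ (lattice z∈))) (boundary-left boundary u∈))
        (ℤO.0≤* (proj₁ (proj₂ (proj₁ (lattice z∈)))) (boundary-left boundary v∈)) (balance z oz≡0)
      at-a = vanish-terms a∈ (orient-aba≡0 a b)
      at-b = vanish-terms b∈ (orient-abb≡0 a b)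
      decide : Dec (o u ≡ 0ℤ) → Dec (o v ≡ 0ℤ) → _
      decide (no ou≢0) _ = proj₁ boundary (trans
        (ray-last c a (lattice a∈) (nonzero-factor (detℤ a v) ou≢0 (proj₁ at-a)))
        (sym (ray-last c b (lattice b∈) (nonzero-factor (detℤ b v) ou≢0 (proj₁ at-b)))))
      decide (yes _) (no ov≢0) = proj₁ boundary (trans
        (ray-first c a (lattice a∈) (nonzero-factor (detℤ u a) ov≢0 (proj₂ at-a)))
        (sym (ray-first c b (lattice b∈) (nonzero-factor (detℤ u b) ov≢0 (proj₂ at-b)))))
      decide (yes ou≡0) (yes ov≡0) = proj₁ boundary (sym (cong₂ _,_
        (ℤ.*-cancelˡ-≡ d (proj₁ b) (proj₁ a) {{ℤ.≢-nonZero (λ eq → ℤ.<-irrefl (sym eq) 0<d)}} (ℤ.i-j≡0⇒i≡j _ _ (trans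
          (poly₁ (proj₁ u) (proj₂ u) (proj₁ v) (proj₂ v) (proj₁ a) (proj₂ a) (proj₁ b) (proj₂ b))
          (trans (cong₂ (λ x y → (y - ba) * proj₁ u - (x - ba) * proj₁ v) ou≡0 ov≡0) (cancelled ba≡0 (proj₁ u) (proj₁ v))))))
        (ℤ.*-cancelˡ-≡ d (proj₂ b) (proj₂ a) {{ℤ.≢-nonZero (λ eq → ℤ.<-irrefl (sym eq) 0<d)}} (ℤ.i-j≡0⇒i≡j _ _ (trans
          (poly₂ (proj₁ u) (proj₂ u) (proj₁ v) (proj₂ v) (proj₁ a) (proj₂ a) (proj₁ b) (proj₂ b))
          (trans (cong₂ (λ x y → (y - ba) * proj₂ u - (x - ba) * proj₂ v) ou≡0 ov≡0) (cancelled ba≡0 (proj₂ u) (proj₂ v))))))))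
        where
        ba = - detℤ b a
        cancelled : detℤ b a ≡ 0ℤ → ∀ x y → (0ℤ - - detℤ b a) * x - (0ℤ - - detℤ b a) * y ≡ 0ℤ
        cancelled eq x y = cong (λ z → (0ℤ - - z) * x - (0ℤ - - z) * y) eq
        poly₁ : ∀ u₁ u₂ v₁ v₂ a₁ a₂ b₁ b₂ → (u₁ * v₂ - u₂ * v₁) * b₁ - (u₁ * v₂ - u₂ * v₁) * a₁ ≡
          (((b₁ - a₁) * (v₂ - a₂) - (b₂ - a₂) * (v₁ - a₁)) - - (b₁ * a₂ - b₂ * a₁)) * u₁ -
          (((b₁ - a₁) * (u₂ - a₂) - (b₂ - a₂) * (u₁ - a₁)) - - (b₁ * a₂ - b₂ * a₁)) * v₁
        poly₁ = solve-∀ ℤ-ring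
        poly₂ : ∀ u₁ u₂ v₁ v₂ a₁ a₂ b₁ b₂ → (u₁ * v₂ - u₂ * v₁) * b₂ - (u₁ * v₂ - u₂ * v₁) * a₂ ≡
          (((b₁ - a₁) * (v₂ - a₂) - (b₂ - a₂) * (v₁ - a₁)) - - (b₁ * a₂ - b₂ * a₁)) * u₂ -
          (((b₁ - a₁) * (u₂ - a₂) - (b₂ - a₂) * (u₁ - a₁)) - - (b₁ * a₂ - b₂ * a₁)) * v₂
        poly₂ = solve-∀ ℤ-ring

    -- The origin lies strictly to the left of the line, as S does weakly. For z = a and z = b,
    -- `orient-cramer` makes (d - `weight u v z`) det b a nonnegative, which puts both points on the
    -- edge from u to v.
    upper-segment : ∀ {a b} → a ∈ S → b ∈ S → Boundaryℤ S (a , b) → detℤ b a < 0ℤ → (a , b) ∈ edges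
    upper-segment {a} {b} a∈ b∈ boundary δ<0 =
      let s , s≤g , a≡ = on-edge a∈ (on-top a∈ (orient-aba≡0 a b))
          t , t≤g , b≡ = on-edge b∈ (on-top b∈ (orient-abb≡0 a b))
      in conclude s t t≤g a≡ b≡
      where
      on-top : ∀ {z} → z ∈ S → orientℤ a b z ≡ 0ℤ → weight u v z ≡ d
      on-top {z} z∈ oz≡0 = ℤ.≤-antisym (proj₂ (proj₂ (proj₁ (lattice z∈))))
        (ℤO.undiff (ℤO.0≤-cancel {0ℤ - detℤ b a} (ℤO.diff< δ<0) (subst (0ℤ ≤_)
          (trans (orient-cramer u v a b z) (trans (cong (λ x → d * x + (d - weight u v z) * detℤ b a) oz≡0) (poly d (weight u v z) (detℤ b a))))
          (ℤO.0≤+ (ℤO.0≤* (proj₁ (proj₁ (lattice z∈))) (boundary-left boundary u∈))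
                  (ℤO.0≤* (proj₁ (proj₂ (proj₁ (lattice z∈)))) (boundary-left boundary v∈))))))
        where
        poly : ∀ d w δ → d * 0ℤ + (d - w) * δ ≡ (0ℤ - δ) * (w - d)
        poly = solve-∀ ℤ-ring
      conclude : ∀ s t → t ℕ.≤ g → a ≡ e s → b ≡ e t → (a , b) ∈ edges
      conclude s t t≤g a≡ b≡ = subst (_∈ edges) (sym (cong₂ _,_ a≡ (trans b≡ (cong e t≡1+s))))
          (∈-applyUpTo⁺ (λ s → e s , e (suc s)) s<g)
        where
        δ≡ : detℤ b a ≡ k * (+ s - + t)
        δ≡ = trans (cong₂ detℤ b≡ a≡) (poly (proj₁ u) (proj₂ u) (proj₁ w) (proj₂ w) (+ s) (+ t))
          where
          poly : ∀ u₁ u₂ w₁ w₂ s t → (u₁ + t * w₁) * (u₂ + s * w₂) - (u₂ + t * w₂) * (u₁ + s * w₁) ≡ (u₁ * w₂ - u₂ * w₁) * (s - t)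
          poly = solve-∀ ℤ-ring
        s<t : s ℕ.< t
        s<t = ℤ.drop‿+<+ (ℤO.undiff< (ℤO.0<-cancel (ℤ.<⇒≤ 0<k) (subst (0ℤ <_) (trans (cong (_-_ 0ℤ) δ≡) (poly k (+ s) (+ t))) (ℤO.diff< δ<0))))
          where
          poly : ∀ k s t → 0ℤ - k * (s - t) ≡ k * (t - s)
          poly = solve-∀ ℤ-ring
        s<g : s ℕ.< g
        s<g = ℕ.<-≤-trans s<t t≤g
        -- The lattice point of the edge directly after a. It must not lie strictly between a and b,
        -- so it is b.
        m = e (suc s)
        between : orientℤ a b m ≡ 0ℤ
        between = trans (cong₂ (λ x y → orientℤ x y m) a≡ b≡) (poly (proj₁ u) (proj₂ u) (proj₁ w) (proj₂ w) (+ s) (+ t))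
          where
          poly : ∀ u₁ u₂ w₁ w₂ s t → ((u₁ + t * w₁) - (u₁ + s * w₁)) * ((u₂ + (1ℤ + s) * w₂) - (u₂ + s * w₂)) -
                                     ((u₂ + t * w₂) - (u₂ + s * w₂)) * ((u₁ + (1ℤ + s) * w₁) - (u₁ + s * w₁)) ≡ 0ℤ
          poly = solve-∀ ℤ-ring
        dot≡ : dotℤ (m -ᵥ a) (m -ᵥ b) ≡ dotℤ w w * (1ℤ + + s - + t)
        dot≡ = trans (cong₂ (λ x y → dotℤ (m -ᵥ x) (m -ᵥ y)) a≡ b≡) (poly (proj₁ u) (proj₂ u) (proj₁ w) (proj₂ w) (+ s) (+ t))
          where
          poly : ∀ u₁ u₂ w₁ w₂ s t →
            ((u₁ + (1ℤ + s) * w₁) - (u₁ + s * w₁)) * ((u₁ + (1ℤ + s) * w₁) - (u₁ + t * w₁)) +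
            ((u₂ + (1ℤ + s) * w₂) - (u₂ + s * w₂)) * ((u₂ + (1ℤ + s) * w₂) - (u₂ + t * w₂)) ≡ (w₁ * w₁ + w₂ * w₂) * (1ℤ + s - t)
          poly = solve-∀ ℤ-ring
        t≡1+s : t ≡ suc s
        t≡1+s = ℕ.≤-antisym (ℤ.drop‿+≤+ (ℤO.undiff (ℤO.0≤-cancel (norm-positive w f wf≡1)
          (subst (0ℤ ≤_) dot≡ (boundary-dot boundary (e∈ s<g) between))))) s<t

    -- Here the origin lies strictly to the right of the line. Let b have coordinates i, j in the
    -- basis x, y of its unimodular cone. If i + j ≥ 2, then i `orientℤ a b x` + j `orientℤ a b y` =
    -- (1 - i - j) δ is negative, although x and y belong to S. So b is a chain point, and it is not
    -- v because det v a ≤ 0.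
    lower-segment : ∀ {a b} → a ∈ S → b ∈ S → Boundaryℤ S (a , b) → 0ℤ < detℤ b a → (a , b) ∈ map ×-swap (segments c)
    lower-segment {a} {b} a∈ b∈ boundary 0<δ =
      let s , s∈ , left , right , _ = locateℤ c b (proj₁ (proj₂ (proj₁ (lattice b∈)))) (proj₁ (proj₁ (lattice b∈)))
      in conclude (on-chain s s∈ left right (height-cases (proj₁ s) (proj₂ s) b (segment-det c s∈) (proj₂ (lattice b∈)) left right))
      where
      δ : ℤ
      δ = detℤ b a
      on-chain : ∀ s → s ∈ segments c → 0ℤ ≤ detℤ (proj₁ s) b → 0ℤ ≤ detℤ b (proj₂ s) →
                 b ≡ proj₁ s ⊎ b ≡ proj₂ s ⊎ + 2 ≤ heightℤ s b → b ∈ points c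
      on-chain s s∈ _ _ (inj₁ b≡)        = subst (_∈ points c) (sym b≡) (proj₁ (segment-points c s∈))
      on-chain s s∈ _ _ (inj₂ (inj₁ b≡)) = subst (_∈ points c) (sym b≡) (proj₂ (segment-points c s∈))
      on-chain s@(x , y) s∈ 0≤j 0≤i (inj₂ (inj₂ 2≤h)) = contradiction
        (ℤ.<-≤-trans 0<δ (ℤO.undiff (subst (0ℤ ≤_) eq
          (ℤO.0≤+ (ℤO.0≤+ (ℤO.0≤* 0≤i (boundary-left boundary (chain∈ (proj₁ (segment-points c s∈)))))
                           (ℤO.0≤* 0≤j (boundary-left boundary (chain∈ (proj₂ (segment-points c s∈))))))
                  (ℤO.0≤* (ℤO.diff 2≤h) (ℤ.<⇒≤ 0<δ)))))) (ℤ.<-irrefl refl)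
        where
        i = detℤ b y
        j = detℤ x b
        poly : ∀ i j δ xy → xy * 0ℤ + (xy - (i + j)) * δ + (j + i - + 2) * δ ≡ (xy - 1ℤ) * δ + (0ℤ - δ)
        poly = solve-∀ ℤ-ring
        unit : ∀ δ → (1ℤ - 1ℤ) * δ + (0ℤ - δ) ≡ 0ℤ - δ
        unit = solve-∀ ℤ-ring
        eq : detℤ b y * orientℤ a b x + detℤ x b * orientℤ a b y + (heightℤ s b - + 2) * δ ≡ 0ℤ - δ
        eq = trans (cong (_+ (heightℤ s b - + 2) * δ) (trans (orient-cramer x y a b b)
               (cong (λ z → detℤ x y * z + (detℤ x y - weight x y b) * δ) (orient-abb≡0 a b))))
             (trans (poly i j δ (detℤ x y)) (trans (cong (λ z → (z - 1ℤ) * δ + (0ℤ - δ)) (segment-det c s∈)) (unit δ)))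
      -- As y is not to the right of the line, a has height at most 1 over the segment from b to y,
      -- hence exactly 1. So a = (1 - δ) b + δ y and y is on the line. It is not strictly between a
      -- and b, which leaves δ = 1.
      next-point : ∀ y → (b , y) ∈ segments c → a ≡ y
      next-point y s∈ = trans a≡ (cong₂ _,_ (final (proj₁ b) (proj₁ y)) (final (proj₂ b) (proj₂ y)))
        where
        by≡1 : detℤ b y ≡ 1ℤ
        by≡1 = segment-det c s∈
        y∈ : y ∈ S
        y∈ = chain∈ (proj₂ (segment-points c s∈))
        orient≡ : orientℤ a b y ≡ 1ℤ - heightℤ (b , y) a
        orient≡ = trans (orientℤ-expand a b y) (trans (cong₂ (λ p q → p + q - detℤ a y) by≡1 (det-anti b a)) (poly δ (detℤ a y)))
          where
          poly : ∀ δ y → 1ℤ + - δ - y ≡ 1ℤ - (δ + y)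
          poly = solve-∀ ℤ-ring
        height≡1 : heightℤ (b , y) a ≡ 1ℤ
        height≡1 = ℤ.≤-antisym (ℤO.undiff (subst (0ℤ ≤_) orient≡ (boundary-left boundary y∈)))
                               (All.lookup (height≥1 c a (lattice a∈)) s∈)
        orient≡0 : orientℤ a b y ≡ 0ℤ
        orient≡0 = trans orient≡ (ℤ.i≡j⇒i-j≡0 (sym height≡1))
        ay≡ : detℤ a y ≡ 1ℤ - δ
        ay≡ = trans (poly δ (detℤ a y)) (cong (_- δ) height≡1)
          where
          poly : ∀ δ y → y ≡ δ + y - δ
          poly = solve-∀ ℤ-ring
        expansion : a ≡ ((1ℤ - δ) * proj₁ b + δ * proj₁ y , (1ℤ - δ) * proj₂ b + δ * proj₂ y)
        expansion = combination b y a by≡1 ay≡ refl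
        dot≡ : dotℤ (y -ᵥ a) (y -ᵥ b) ≡ dotℤ (y -ᵥ b) (y -ᵥ b) * (1ℤ - δ)
        dot≡ = trans (cong (λ z → dotℤ (y -ᵥ z) (y -ᵥ b)) expansion) (poly (proj₁ b) (proj₂ b) (proj₁ y) (proj₂ y) δ)
          where
          poly : ∀ b₁ b₂ y₁ y₂ δ → (y₁ - ((1ℤ - δ) * b₁ + δ * y₁)) * (y₁ - b₁) + (y₂ - ((1ℤ - δ) * b₂ + δ * y₂)) * (y₂ - b₂) ≡
                                   ((y₁ - b₁) * (y₁ - b₁) + (y₂ - b₂) * (y₂ - b₂)) * (1ℤ - δ)
          poly = solve-∀ ℤ-ring
        complement : detℤ (y -ᵥ b) (0ℤ - proj₁ y , 0ℤ - proj₂ y) ≡ 1ℤ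
        complement = trans (poly (proj₁ b) (proj₂ b) (proj₁ y) (proj₂ y)) by≡1
          where
          poly : ∀ b₁ b₂ y₁ y₂ → (y₁ - b₁) * (0ℤ - y₂) - (y₂ - b₂) * (0ℤ - y₁) ≡ b₁ * y₂ - b₂ * y₁
          poly = solve-∀ ℤ-ring
        δ≡1 : δ ≡ 1ℤ
        δ≡1 = ℤ.≤-antisym (ℤO.undiff (ℤO.0≤-cancel (norm-positive (y -ᵥ b) (0ℤ - proj₁ y , 0ℤ - proj₂ y) complement)
          (subst (0ℤ ≤_) dot≡ (boundary-dot boundary y∈ orient≡0)))) (ℤO.0<⇒1≤ 0<δ)
        a≡ : a ≡ ((1ℤ - 1ℤ) * proj₁ b + 1ℤ * proj₁ y , (1ℤ - 1ℤ) * proj₂ b + 1ℤ * proj₂ y)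
        a≡ = trans expansion (cong (λ z → (1ℤ - z) * proj₁ b + z * proj₁ y , (1ℤ - z) * proj₂ b + z * proj₂ y) δ≡1)
        final : ∀ b y → (1ℤ - 1ℤ) * b + 1ℤ * y ≡ y
        final = solve-∀ ℤ-ring
      conclude : b ∈ points c → (a , b) ∈ map ×-swap (segments c)
      conclude b∈chain = decide (successor c b∈chain)
        where
        decide : b ≡ v ⊎ ∃[ y ] (b , y) ∈ segments c → (a , b) ∈ map ×-swap (segments c)
        decide (inj₁ b≡v) = contradiction (ℤ.<-≤-trans 0<δ (subst (_≤ 0ℤ) (sym (trans (cong (λ z → detℤ z a) b≡v) (det-anti a v)))
          (ℤ.neg-mono-≤ (proj₁ (proj₁ (lattice a∈)))))) (ℤ.<-irrefl refl)
        decide (inj₂ (y , s∈)) = subst (λ z → (z , b) ∈ map ×-swap (segments c)) (sym (next-point y s∈)) (∈-map⁺ ×-swap s∈)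

    hull⇔ : ∀ {x} → x ∈ hull ⇔ (proj₁ x ∈ S × proj₂ x ∈ S × Boundaryℤ S x)
    hull⇔ {x} = mk⇔ to from
      where
      to : ∀ {x} → x ∈ hull → proj₁ x ∈ S × proj₂ x ∈ S × Boundaryℤ S x
      to {x} x∈ = decide (∈-++⁻ (map ×-swap (segments c)) x∈)
        where
        decide : x ∈ map ×-swap (segments c) ⊎ x ∈ edges → proj₁ x ∈ S × proj₂ x ∈ S × Boundaryℤ S x
        decide (inj₁ x∈) =
          let s , s∈ , eq = ∈-map⁻ ×-swap x∈
          in subst (λ x → proj₁ x ∈ S × proj₂ x ∈ S × Boundaryℤ S x) (sym eq)
               (chain∈ (proj₂ (segment-points c s∈)) , chain∈ (proj₁ (segment-points c s∈)) , chain-boundary s∈)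
        decide (inj₂ x∈) =
          let s , s<g , eq = ∈-applyUpTo⁻ _ x∈
          in subst (λ x → proj₁ x ∈ S × proj₂ x ∈ S × Boundaryℤ S x) (sym eq) (e∈ (ℕ.<⇒≤ s<g) , e∈ s<g , edge-boundary s)
      from : proj₁ x ∈ S × proj₂ x ∈ S × Boundaryℤ S x → x ∈ hull
      from (a∈ , b∈ , boundary) = decide (ℤ.<-cmp 0ℤ (detℤ (proj₂ x) (proj₁ x)))
        where
        decide : _ → x ∈ hull
        decide (tri< 0<δ _ _) = ∈-++⁺ˡ (lower-segment a∈ b∈ boundary 0<δ)
        decide (tri≈ _ 0≡δ _) = contradiction (sym 0≡δ) (not-radial a∈ b∈ boundary)
        decide (tri> _ _ δ<0) = ∈-++⁺ʳ (map ×-swap (segments c)) (upper-segment a∈ b∈ boundary δ<0)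

    -- The edge contributes g k = d and the chain - `size c`. The terms det o _ cancel around the
    -- closed path, so the apex does not matter.
    sum-hull : ∀ o → sumℤ (map (fanℤ o) hull) ≡ d - size c
    sum-hull o = trans (sumℤ-++ (fanℤ o) (map ×-swap (segments c)) edges) (trans (cong₂ _+_ (sum-chain o c) (sum-path o k e det-step g))
      (trans (cong₂ (λ x y → detℤ o v - detℤ o u - size c + (+ g * k + x - y)) (trans (det-alongʳ o u w 0) (ℤ.+-identityʳ _)) (cong (detℤ o) (sym v≡e)))
      (trans (cong (λ z → detℤ o v - detℤ o u - size c + (z + detℤ o u - detℤ o v)) (sym d≡gk)) (poly (detℤ o v) (detℤ o u) (size c) d))))
      where
      poly : ∀ v u s d → v - u - s + (d + u - v) ≡ d - s
      poly = solve-∀ ℤ-ring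

  v-conv-polygon : ∀ {v u q} (c : Chain v u q) S → (∀ n → n ∈ S ⇔ LatticePoint u v n) →
                   v-conv (map ι S) ≡ fromℤ (detℤ u v - size c)
  v-conv-polygon {v} {u} c [] S⇔ = contradiction (Equivalence.from (S⇔ u) (chain-points c (first∈ c))) λ ()
  v-conv-polygon {v} {u} c (o ∷ S) S⇔ =
    let g , w , f , d≡gw , wf≡1 = direction (v -ᵥ u) v-u≢0
        module H = Hull c (o ∷ S) S⇔ (suc g) w f (+<+ (s≤s z≤n)) (v≡along w (suc g) d≡gw) wf≡1
    in trans (v-conv-ℤ o S H.hull-unique H.hull⇔) (cong fromℤ (H.sum-hull o))
    where
    v-u≢0 : v -ᵥ u ≢ 0ℤ²
    v-u≢0 eq = ℤ.<-irrefl (sym (trans (cong (detℤ u) v≡u) (det-self u))) (det-end>0 c)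
      where
      v≡u : v ≡ u
      v≡u = cong₂ _,_ (ℤ.i-j≡0⇒i≡j _ _ (cong proj₁ eq)) (ℤ.i-j≡0⇒i≡j _ _ (cong proj₂ eq))
    v≡along : ∀ w g → v -ᵥ u ≡ (+ g * proj₁ w , + g * proj₂ w) → v ≡ along u w g
    v≡along w g eq = cong₂ _,_ (shift (proj₁ v) (proj₁ u) (cong proj₁ eq)) (shift (proj₂ v) (proj₂ u) (cong proj₂ eq))
      where
      poly : ∀ a b → a ≡ b + (a - b)
      poly = solve-∀ ℤ-ring
      shift : ∀ a b {k} → a - b ≡ k → a ≡ b + k
      shift a b eq = trans (poly a b) (cong (_+_ b) eq)

open Polygon

-- Interior lattice points as residues.

module Slices where
  open import Data.Integer.Base using (_+_; _*_; -_; _-_; _≤_; _<_)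

  residue-positive : ∀ {v u q} (c : Chain v u q) n q′ → detℤ u v ≡ + suc n → detℤ q v ≡ + q′ →
                     ∀ {i} → i ℕ.< n → residue n q′ (suc i) ≢ 0
  residue-positive (end e) n q′ d≡ q≡ i<n = contradiction (subst (_ ℕ.<_) (ℕ.suc-injective (ℤ.+-injective (trans (sym d≡) e))) i<n) λ ()
  residue-positive (step b e c) n q′ d≡ q≡ i<n =
    let m , q≡1+m = pos⇒ℕ (det-end>0 c)
    in subst (λ z → residue n z _ ≢ 0) (ℤ.+-injective (trans (sym q≡1+m) q≡))
         (residue≢0 n (suc m) (inverseˣ b e c d≡ q≡1+m) (inverseʸ b e c d≡ q≡1+m) (inverse-ℕ b e c d≡ q≡1+m) i<n)

  -- The lattice points n with 0 < det u n < d and 0 ≤ det n v < d, one for each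
  -- value of det u n.
  module Slice {v u q : ℤ²} (c : Chain v u q) (n : ℕ) (q′ : ℕ) (d≡ : detℤ u v ≡ + suc n) (q≡ : detℤ q v ≡ + q′) where

    -- For j = `suc i`, the point j q has det u _ = j and det _ v = j q′. Subtracting multiples of u
    -- preserves the former and reduces the latter modulo d to its residue.
    slice : ℕ → ℤ²
    slice i = + suc i * proj₁ q - + floor n q′ (suc i) * proj₁ u , + suc i * proj₂ q - + floor n q′ (suc i) * proj₂ u

    r : ℕ → ℕ
    r i = residue n q′ (suc i)

    uq≡1 : detℤ u q ≡ 1ℤ
    uq≡1 = first-det c

    det-combination : ∀ u q j f → detℤ u (j * proj₁ q - f * proj₁ u , j * proj₂ q - f * proj₂ u) ≡ j * detℤ u q
    det-combination (u₁ , u₂) (q₁ , q₂) j f = poly u₁ u₂ q₁ q₂ j f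
      where
      poly : ∀ u₁ u₂ q₁ q₂ j f → u₁ * (j * q₂ - f * u₂) - u₂ * (j * q₁ - f * u₁) ≡ j * (u₁ * q₂ - u₂ * q₁)
      poly = solve-∀ ℤ-ring

    combination-det : ∀ u q v j f → detℤ (j * proj₁ q - f * proj₁ u , j * proj₂ q - f * proj₂ u) v ≡ j * detℤ q v - f * detℤ u v
    combination-det (u₁ , u₂) (q₁ , q₂) (v₁ , v₂) j f = poly u₁ u₂ q₁ q₂ v₁ v₂ j f
      where
      poly : ∀ u₁ u₂ q₁ q₂ v₁ v₂ j f → (j * q₁ - f * u₁) * v₂ - (j * q₂ - f * u₂) * v₁ ≡
             j * (q₁ * v₂ - q₂ * v₁) - f * (u₁ * v₂ - u₂ * v₁)
      poly = solve-∀ ℤ-ring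

    det-u-slice : ∀ i → detℤ u (slice i) ≡ + suc i
    det-u-slice i = trans (det-combination u q (+ suc i) (+ floor n q′ (suc i)))
      (trans (cong (+ suc i *_) uq≡1) (ℤ.*-identityʳ (+ suc i)))

    det-slice-v : ∀ i → detℤ (slice i) v ≡ + r i
    det-slice-v i = trans (combination-det u q v (+ suc i) (+ floor n q′ (suc i)))
      (trans (cong₂ (λ x y → + suc i * x - + floor n q′ (suc i) * y) q≡ d≡)
      (trans (cong (_- + floor n q′ (suc i) * + suc n) (ℤ.*-comm (+ suc i) (+ q′))) (sym (residue-floor n q′ (suc i)))))

    inside : ℕ → ℕ
    inside i = suc i ℕ.+ r i

    slices : List ℤ²
    slices = map slice (filter (λ i → inside i ℕ.<? suc n) (downFrom n))

    slice-injective : ∀ {i j} → slice i ≡ slice j → i ≡ j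
    slice-injective {i} {j} eq = ℕ.suc-injective (ℤ.+-injective
      (trans (sym (det-u-slice i)) (trans (cong (detℤ u) eq) (det-u-slice j))))

    slices-unique : Unique slices
    slices-unique = map⁺ slice-injective (filter⁺ (λ i → inside i ℕ.<? suc n) (downFrom⁺ n))

    slices⇒triangle° : ∀ {x} → x ∈ slices → Triangle°ℤ u v x
    slices⇒triangle° x∈ =
      let i , i∈ , x≡ = ∈-map⁻ slice x∈
          i<n , in-d  = ∈-filter⁻ (λ i → inside i ℕ.<? suc n) i∈
      in subst (Triangle°ℤ u v) (sym x≡)
           (subst (0ℤ <_) (sym (det-slice-v i)) (ℤ.+<+ (ℕ.n≢0⇒n>0 (residue-positive c n q′ d≡ q≡ (∈-downFrom⁻ i<n)))) ,
            subst (0ℤ <_) (sym (det-u-slice i)) (ℤ.+<+ (s≤s z≤n)) ,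
            subst₂ _<_ (sym (cong₂ _+_ (det-slice-v i) (det-u-slice i))) (sym d≡)
              (ℤ.+<+ (subst (ℕ._< suc n) (ℕ.+-comm (suc i) (r i)) in-d)))

    small-multiple : ∀ {z d a b} → z * d ≡ a - b → 0ℤ ≤ a → a < d → 0ℤ ≤ b → b < d → 0ℤ < d → z ≡ 0ℤ
    small-multiple {z} {d} {a} {b} eq 0≤a a<d 0≤b b<d 0<d = ℤ.≤-antisym
      (ℤ.≮⇒≥ λ 0<z → ℤ.<-irrefl refl (ℤ.<-≤-trans a<d (ℤO.undiff {d} {a} (subst (0ℤ ≤_) (trans (poly₁ z d b) (trans (cong (λ y → y + b - d) eq) (poly₃ a b d)))
        (ℤO.0≤+ (ℤO.0≤* (ℤ.<⇒≤ 0<d) (ℤO.diff (ℤO.0<⇒1≤ 0<z))) 0≤b)))))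
      (ℤ.≮⇒≥ λ z<0 → ℤ.<-irrefl refl (ℤ.<-≤-trans b<d (ℤO.undiff {d} {b} (subst (0ℤ ≤_) (trans (poly₂ z d a) (trans (cong (λ y → a - y - d) eq) (poly₄ a b d)))
        (ℤO.0≤+ (ℤO.0≤* (ℤ.<⇒≤ 0<d) (ℤO.diff (ℤO.0<⇒1≤ (ℤO.diff< z<0)))) 0≤a)))))
      where
      poly₁ : ∀ z d b → d * (z - 1ℤ) + b ≡ z * d + b - d
      poly₁ = solve-∀ ℤ-ring
      poly₂ : ∀ z d a → d * ((0ℤ - z) - 1ℤ) + a ≡ a - z * d - d
      poly₂ = solve-∀ ℤ-ring
      poly₃ : ∀ a b d → a - b + b - d ≡ a - d
      poly₃ = solve-∀ ℤ-ring
      poly₄ : ∀ a b d → a - (a - b) - d ≡ b - d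
      poly₄ = solve-∀ ℤ-ring

    -- x and the slice point with the same det u _ differ by a multiple of u, so their values of det
    -- _ v differ by a multiple of d. Both values lie in the range from 0 to d - 1, hence the points
    -- coincide.
    triangle°⇒slices : ∀ {x} → Triangle°ℤ u v x → x ∈ slices
    triangle°⇒slices {x} (0<α , 0<β , α+β<d) =
      let i , β≡ = pos⇒ℕ 0<β
      in located i β≡
      where
      located : ∀ i → detℤ u x ≡ + suc i → x ∈ slices
      located i β≡ = subst (_∈ slices) (sym x≡slice) (∈-map⁺ slice (∈-filter⁺ (λ i → inside i ℕ.<? suc n) (∈-downFrom⁺ i<n) in-d))
        where
        α<d : detℤ x v < + suc n
        α<d = subst (detℤ x v <_) d≡ (ℤ.≤-<-trans (subst (_≤ detℤ x v + detℤ u x) (ℤ.+-identityʳ (detℤ x v)) (ℤ.+-monoʳ-≤ (detℤ x v) (ℤ.<⇒≤ 0<β))) α+β<d)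
        β<d : + suc i < + suc n
        β<d = subst₂ _<_ β≡ d≡ (ℤ.≤-<-trans (subst (_≤ detℤ x v + detℤ u x) (ℤ.+-identityˡ (detℤ u x)) (ℤ.+-monoˡ-≤ (detℤ u x) (ℤ.<⇒≤ 0<α))) α+β<d)
        i<n : i ℕ.< n
        i<n = ℕ.≤-pred (ℤ.drop‿+<+ β<d)
        y : ℤ²
        y = slice i
        h : ℤ² → ℤ
        h z = detℤ z q
        expand : ∀ z → detℤ u z ≡ + suc i → z ≡ (h z * proj₁ u + + suc i * proj₁ q , h z * proj₂ u + + suc i * proj₂ q)
        expand z = combination u q z uq≡1 refl
        det-expand : ∀ z → detℤ u z ≡ + suc i → detℤ z v ≡ h z * + suc n + + suc i * + q′
        det-expand z eq = trans (cong (λ z → detℤ z v) (expand z eq)) (trans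
          (poly (h z) (+ suc i) (proj₁ u) (proj₂ u) (proj₁ q) (proj₂ q) (proj₁ v) (proj₂ v)) (cong₂ (λ x y → h z * x + + suc i * y) d≡ q≡))
          where
          poly : ∀ h j u₁ u₂ q₁ q₂ v₁ v₂ → (h * u₁ + j * q₁) * v₂ - (h * u₂ + j * q₂) * v₁ ≡
                 h * (u₁ * v₂ - u₂ * v₁) + j * (q₁ * v₂ - q₂ * v₁)
          poly = solve-∀ ℤ-ring
        h≡ : h x ≡ h y
        h≡ = ℤ.i-j≡0⇒i≡j _ _ (small-multiple (trans (poly (h x) (h y) (+ suc n) (+ suc i * + q′))
               (cong₂ _-_ (sym (det-expand x β≡)) (sym (det-expand y (det-u-slice i)))))
               (ℤ.<⇒≤ 0<α) α<d (subst (0ℤ ≤_) (sym (det-slice-v i)) (ℤ.+≤+ z≤n))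
               (subst (_< + suc n) (sym (det-slice-v i)) (ℤ.+<+ (ℕ.m%n<n (q′ ℕ.* suc i) (suc n)))) (ℤ.+<+ (s≤s z≤n)))
          where
          poly : ∀ x y d k → (x - y) * d ≡ (x * d + k) - (y * d + k)
          poly = solve-∀ ℤ-ring
        x≡slice : x ≡ slice i
        x≡slice = trans (expand x β≡) (trans (cong (λ z → z * proj₁ u + + suc i * proj₁ q , z * proj₂ u + + suc i * proj₂ q) h≡)
                    (sym (expand y (det-u-slice i))))
        in-d : inside i ℕ.< suc n
        in-d = ℤ.drop‿+<+ (subst₂ _<_ (trans (cong₂ _+_ (trans (cong (λ z → detℤ z v) x≡slice) (det-slice-v i)) β≡)
                                              (cong +_ (ℕ.+-comm (r i) (suc i)))) d≡ α+β<d)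

    sum-slices : sumℤ (map (λ x → (+ suc n - weight u v x) * (+ suc n - weight u v x)) slices) ≡ defectSum n q′
    sum-slices = trans (cong sumℤ (sym (List.map-∘ (filter (λ i → inside i ℕ.<? suc n) (downFrom n)))))
      (trans (sumℤ-filter inside (suc n) _ (downFrom n))
      (∑-cong n λ {i} _ → cong (λ z → [ inside i < suc n ] * (z * z)) (trans
        (cong (_-_ (+ suc n)) (cong₂ _+_ (det-slice-v i) (det-u-slice i))) (poly (+ suc n) (+ suc i) (+ r i)))))
      where
      poly : ∀ d j r → d - (r + j) ≡ d - j - r
      poly = solve-∀ ℤ-ring

  -- d times either side of the theorem.
  total : ∀ {v u q} → Chain v u q → ℤ
  total {v} {u} {q} c = d * d + + 2 + d * (excess c - size c - + 2) + detℤ q v + detℤ u (penultimate c)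
    where
    d = detℤ u v

  weight-second : ∀ {v u q} (c : Chain v u q) → weight u v q ≡ detℤ q v + 1ℤ
  weight-second {v} {u} {q} c = cong (_+_ (detℤ q v)) (first-det c)

  weight-penultimate : ∀ {v u q} (c : Chain v u q) → weight u v (penultimate c) ≡ 1ℤ + detℤ u (penultimate c)
  weight-penultimate {v} {u} c = cong (_+ detℤ u (penultimate c)) (penultimate-det c)

  -- After telescoping, only four weights remain: d at u and at v, det q v + 1 at the second point
  -- and 1 + det u w at the penultimate point w.
  volume-side : ∀ {v u q} (c : Chain v u q) → let d = detℤ u v in
    d * (d - size c) + weighted (λ x → d - weight u v x) c ≡
    total c
  volume-side {v} {u} {q} c = trans
    (cong (_+_ (d * (d - size c))) (trans (weighted-const d (weight u v) c) (cong (_-_ (d * excess c))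
      (trans (weighted-telescope (weight u v) (weight-linear u v) c)
        (cong₂ _-_ (cong₂ _-_ (cong₂ _+_ (weight-first u v) (weight-last u v)) (weight-second c)) (weight-penultimate c))))))
    (poly d (size c) (excess c) (detℤ q v) (detℤ u (penultimate c)))
    where
    d : ℤ
    d = detℤ u v
    poly : ∀ d k e q x → d * (d - k) + (d * e - (d + d - (q + 1ℤ) - (1ℤ + x))) ≡
                         d * d + + 2 + d * (e - k - + 2) + q + x
    poly = solve-∀ ℤ-ring

open Slices

-- The dual triangles and the formula for one cone.

module ConeFormula where
  open import Data.Rational.Base using (_+_; _*_; -_; _-_; _≤_; _<_)

  -- Identifies the given sail points with the chain, in order. R is assumed asymmetric only, since
  -- the angular relation 0 < det x y is not transitive on the plane.
  sorted-unique : ∀ {A : Set} {R : A → A → Set} → (∀ {x y} → R x y → ¬ R y x) → ∀ {xs ys} →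
                  AllPairs R xs → AllPairs R ys → (∀ {x} → x ∈ xs ⇔ x ∈ ys) → xs ≡ ys
  sorted-unique asym {[]} {[]} _ _ _ = refl
  sorted-unique asym {[]} {y ∷ ys} _ _ eq = contradiction (Equivalence.from eq (here refl)) λ ()
  sorted-unique asym {x ∷ xs} {[]} _ _ eq = contradiction (Equivalence.to eq (here refl)) λ ()
  sorted-unique {R = R} asym {x ∷ xs} {y ∷ ys} (x< ∷ xs<) (y< ∷ ys<) eq = cong₂ _∷_ x≡y
    (sorted-unique asym xs< ys< (mk⇔
      (λ z∈ → tail x< (sym x≡y) z∈ (Equivalence.to eq (there z∈)))
      (λ z∈ → tail y< x≡y z∈ (Equivalence.from eq (there z∈)))))
    where
    x≡y : x ≡ y
    x≡y with Equivalence.to eq (here refl) | Equivalence.from eq (here refl)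
    ... | here x≡y   | _          = x≡y
    ... | there _    | here y≡x   = sym y≡x
    ... | there x∈ys | there y∈xs = contradiction (All.lookup x< y∈xs) (asym (All.lookup y< x∈ys))
    tail : ∀ {a b as bs} → All (R a) as → b ≡ a → ∀ {z} → z ∈ as → z ∈ (b ∷ bs) → z ∈ bs
    tail a< refl z∈as (here refl) = contradiction (All.lookup a< z∈as) (asym (All.lookup a< z∈as))
    tail a< refl z∈as (there z∈bs) = z∈bs

  det-asym : ∀ {x y} → 0ℤ ℤ.< detℤ x y → ¬ 0ℤ ℤ.< detℤ y x
  det-asym {x} {y} 0<xy 0<yx = ℤ.<-asym 0<xy (subst (ℤ._< 0ℤ) (sym (det-anti y x)) (ℤ.neg-mono-< 0<yx))

  -- The Binet-Cauchy identity. With a unimodular pair p, q it computes determinants in M from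
  -- pairings with N.
  lagrange : ∀ x y p q → det x y * det p q ≡ ⟨ x , p ⟩ * ⟨ y , q ⟩ - ⟨ x , q ⟩ * ⟨ y , p ⟩
  lagrange (x₁ , x₂) (y₁ , y₂) (p₁ , p₂) (q₁ , q₂) = poly x₁ x₂ y₁ y₂ p₁ p₂ q₁ q₂
    where
    poly : ∀ x₁ x₂ y₁ y₂ p₁ p₂ q₁ q₂ → (x₁ * y₂ - x₂ * y₁) * (p₁ * q₂ - p₂ * q₁) ≡
           (x₁ * p₁ + x₂ * p₂) * (y₁ * q₁ + y₂ * q₂) - (x₁ * q₁ + x₂ * q₂) * (y₁ * p₁ + y₂ * p₂)
    poly = solve-∀ ℚ-ring

  ⟨⟩-⊖ : ∀ x y p → ⟨ x ⊖ y , p ⟩ ≡ ⟨ x , p ⟩ - ⟨ y , p ⟩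
  ⟨⟩-⊖ (x₁ , x₂) (y₁ , y₂) (p₁ , p₂) = poly x₁ x₂ y₁ y₂ p₁ p₂
    where
    poly : ∀ x₁ x₂ y₁ y₂ p₁ p₂ → (x₁ - y₁) * p₁ + (x₂ - y₂) * p₂ ≡ (x₁ * p₁ + x₂ * p₂) - (y₁ * p₁ + y₂ * p₂)
    poly = solve-∀ ℚ-ring

  ⟨⟩-next : ∀ m b p q → ⟨ m , ι (next b p q) ⟩ ≡ (1ℚ + 1ℚ + fromℤ (+ b)) * ⟨ m , ι q ⟩ - ⟨ m , ι p ⟩
  ⟨⟩-next (m₁ , m₂) b (p₁ , p₂) (q₁ , q₂) =
    trans (cong₂ (λ y z → m₁ * y + m₂ * z) (next-coordinate b p₁ q₁) (next-coordinate b p₂ q₂))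
          (poly (fromℤ (+ b)) m₁ m₂ (fromℤ p₁) (fromℤ p₂) (fromℤ q₁) (fromℤ q₂))
    where
    poly : ∀ b m₁ m₂ p₁ p₂ q₁ q₂ →
      m₁ * ((1ℚ + 1ℚ + b) * q₁ - p₁) + m₂ * ((1ℚ + 1ℚ + b) * q₂ - p₂) ≡
      (1ℚ + 1ℚ + b) * (m₁ * q₁ + m₂ * q₂) - (m₁ * p₁ + m₂ * p₂)
    poly = solve-∀ ℚ-ring

  -- The recurrence gives ⟨ y , p ⟩ = -1 - b, so x and y agree at q and differ by b at p. The dual
  -- triangle has a base of lattice length b and lattice height 1 + ⟨ M , q ⟩. The sign arises
  -- because the dual vectors turn clockwise as seen from M.
  orient-dual : ∀ M x y b p q → detℤ p q ≡ 1ℤ → ⟨ x , ι p ⟩ ≡ - 1ℚ → ⟨ x , ι q ⟩ ≡ - 1ℚ → ⟨ y , ι q ⟩ ≡ - 1ℚ →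
                ⟨ y , ι (next b p q) ⟩ ≡ - 1ℚ → orient M x y ≡ - (fromℤ (+ b) * (1ℚ + ⟨ M , ι q ⟩))
  orient-dual M x y b p q pq≡1 xp xq yq ys =
    trans (sym (ℚ.*-identityʳ (orient M x y)))
    (trans (cong (orient M x y *_) (sym (trans (det-ι p q) (cong fromℤ pq≡1))))
    (trans (lagrange (x ⊖ M) (y ⊖ M) (ι p) (ι q))
    (trans (cong₂ _-_ (cong₂ _*_ (pairing x p xp) (pairing y q yq)) (cong₂ _*_ (pairing x q xq) (pairing y p yp)))
    (poly B ⟨ M , ι p ⟩ ⟨ M , ι q ⟩))))
    where
    B : ℚ
    B = fromℤ (+ b)
    pairing : ∀ x p {k} → ⟨ x , ι p ⟩ ≡ k → ⟨ x ⊖ M , ι p ⟩ ≡ k - ⟨ M , ι p ⟩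
    pairing x p eq = trans (⟨⟩-⊖ x M (ι p)) (cong (_- ⟨ M , ι p ⟩) eq)
    yp : ⟨ y , ι p ⟩ ≡ - 1ℚ - B
    yp = trans (poly′ ((1ℚ + 1ℚ + B) * ⟨ y , ι q ⟩) ⟨ y , ι p ⟩)
      (trans (cong₂ (λ a c → (1ℚ + 1ℚ + B) * a - c) yq (trans (sym (⟨⟩-next y b p q)) ys)) (poly″ B))
      where
      poly′ : ∀ a c → c ≡ a - (a - c)
      poly′ = solve-∀ ℚ-ring
      poly″ : ∀ b → (1ℚ + 1ℚ + b) * - 1ℚ - - 1ℚ ≡ - 1ℚ - b
      poly″ = solve-∀ ℚ-ring
    poly : ∀ b p q → (- 1ℚ - p) * (- 1ℚ - q) - (- 1ℚ - q) * (- 1ℚ - b - p) ≡ - (b * (1ℚ + q))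
    poly = solve-∀ ℚ-ring

  weightedℚ : ∀ {v p q} → (ℤ² → ℚ) → Chain v p q → ℚ
  weightedℚ F (end _) = 0ℚ
  weightedℚ F (step {q = q} b _ c) = fromℤ (+ b) * F q + weightedℚ F c

  scale-weighted : ∀ {v p q} k F f (c : Chain v p q) → (∀ x → fromℤ k * F x ≡ fromℤ (f x)) → fromℤ k * weightedℚ F c ≡ fromℤ (weighted f c)
  scale-weighted k F f (end _) eq = ℚ.*-zeroʳ (fromℤ k)
  scale-weighted k F f (step {q = q} b _ c) eq = trans (poly (fromℤ k) (fromℤ (+ b)) (F q) (weightedℚ F c))
    (trans (cong₂ (λ x y → fromℤ (+ b) * x + y) (eq q) (scale-weighted k F f c eq))
    (sym (trans (fromℤ-+ (+ b ℤ.* f q) (weighted f c)) (cong (_+ fromℤ (weighted f c)) (fromℤ-* (+ b) (f q))))))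
    where
    poly : ∀ k b x w → k * (b * x + w) ≡ b * (k * x) + k * w
    poly = solve-∀ ℚ-ring

  points-front : ∀ {v p q} (c : Chain v p q) → ∃[ xs ] points c ≡ p ∷ q ∷ xs
  points-front (end _) = [] , refl
  points-front (step {p} b e c) = let xs , eq = points-front c in _ , cong (p ∷_) eq

  -- `vol` is abstract because a cone given in the opposite orientation lists the last two vertices
  -- of each dual triangle in the opposite order. Nonnegativity of 1 + ⟨ M , x ⟩ on the chain fixes
  -- the sign of every triangle.
  dual-sum : ∀ {v a q} (c : Chain v a q) M (vol : ℚ² → ℚ² → ℚ) →
    (∀ x y → orient M x y ≤ 0ℚ → vol x y ≡ - orient M x y) →
    All (λ x → 0ℚ ≤ 1ℚ + ⟨ M , ι x ⟩) (points c) →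
    ∀ r (p : Fin (suc (suc r)) → ℤ²) (m : Fin (suc r) → ℤ²) → tabulate p ≡ points c →
    (∀ i → ⟨ ι (m i) , ι (p (inject₁ i)) ⟩ ≡ - 1ℚ) →
    (∀ i → ⟨ ι (m i) , ι (p (Fin.suc i)) ⟩ ≡ - 1ℚ) →
    sumℚ (tabulate (λ (i : Fin r) → vol (ι (m (inject₁ i))) (ι (m (Fin.suc i))))) ≡ weightedℚ (λ x → 1ℚ + ⟨ M , ι x ⟩) c
  dual-sum (end _) M vol vol≡ pos zero p m p≡ left right = refl
  dual-sum (end _) M vol vol≡ pos (suc r) p m p≡ left right =
    contradiction (List.∷-injectiveʳ (List.∷-injectiveʳ p≡)) λ ()
  dual-sum (step b e c) M vol vol≡ pos zero p m p≡ left right =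
    contradiction (trans (List.∷-injectiveʳ p≡) (proj₂ (points-front c))) λ ()
  dual-sum (step {a} {q} b e c) M vol vol≡ (_ ∷ pos) (suc r) p m p≡ left right = cong₂ _+_
    (trans (vol≡ (ι (m Fin.zero)) (ι (m (Fin.suc Fin.zero))) nonpositive) (trans (cong -_ dual) (double (fromℤ (+ b) * (1ℚ + ⟨ M , ι q ⟩)))))
    (dual-sum c M vol vol≡ pos r (p ∘ Fin.suc) (m ∘ Fin.suc) tail≡ (left ∘ Fin.suc) (right ∘ Fin.suc))
    where
    tail≡ : tabulate (p ∘ Fin.suc) ≡ points c
    tail≡ = List.∷-injectiveʳ p≡
    front : tabulate (p ∘ Fin.suc) ≡ q ∷ next b a q ∷ proj₁ (points-front c)
    front = trans tail≡ (proj₂ (points-front c))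
    p₀ : p Fin.zero ≡ a
    p₀ = List.∷-injectiveˡ p≡
    p₁ : p (Fin.suc Fin.zero) ≡ q
    p₁ = List.∷-injectiveˡ front
    p₂ : p (Fin.suc (Fin.suc Fin.zero)) ≡ next b a q
    p₂ = List.∷-injectiveˡ (List.∷-injectiveʳ front)
    m₀ = ι (m Fin.zero)
    m₁ = ι (m (Fin.suc Fin.zero))
    at : ∀ {x y k} (n : ℚ²) → x ≡ y → ⟨ n , ι x ⟩ ≡ k → ⟨ n , ι y ⟩ ≡ k
    at n refl eq = eq
    dual : orient M (ι (m Fin.zero)) (ι (m (Fin.suc Fin.zero))) ≡ - (fromℤ (+ b) * (1ℚ + ⟨ M , ι q ⟩))
    dual = orient-dual M m₀ m₁ b a q e (at m₀ p₀ (left Fin.zero)) (at m₀ p₁ (right Fin.zero))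
             (at m₁ p₁ (left (Fin.suc Fin.zero))) (at m₁ p₂ (right (Fin.suc Fin.zero)))
    double : ∀ x → - - x ≡ x
    double = solve-∀ ℚ-ring
    nonpositive : orient M (ι (m Fin.zero)) (ι (m (Fin.suc Fin.zero))) ≤ 0ℚ
    nonpositive = subst (_≤ 0ℚ) (sym dual) (ℚ.neg-antimono-≤ (ℚO.0≤* (0≤fromℕ b) (All.lookup pos (first∈ c))))

  scale-sum : ∀ k (F : ℤ² → ℚ) (f : ℤ² → ℤ) L → All (λ n → k * F n ≡ fromℤ (f n)) L → k * sumℚ (map F L) ≡ fromℤ (sumℤ (map f L))
  scale-sum k F f [] [] = ℚ.*-zeroʳ k
  scale-sum k F f (n ∷ L) (eq ∷ eqs) = trans (ℚ.*-distribˡ-+ k (F n) (sumℚ (map F L)))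
    (trans (cong₂ _+_ eq (scale-sum k F f L eqs)) (sym (fromℤ-+ (f n) (sumℤ (map f L)))))

  interior-sum : ∀ {v u q} (c : Chain v u q) L → Unique L → (∀ n → n ∈ L ⇔ Triangle°ℤ u v n) →
    (F : ℤ² → ℚ) → (∀ n → Triangle°ℤ u v n → fromℤ (detℤ u v) * F n ≡ fromℤ (detℤ u v ℤ.- weight u v n)) →
    fromℤ (+ 12) * (fromℤ (detℤ u v) * (fromℤ (detℤ u v) * sumℚ (map (λ n → F n * F n) L))) ≡
    fromℤ (detℤ u v ℤ.* total c)
  interior-sum {v} {u} {q} c L L! L⇔ F F≡ = formula (pos⇒ℕ (det-end>0 c)) (nonneg⇒ℕ (proj₁ (det-end-range c)))
    where
    d : ℤ
    d = detℤ u v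
    square : ℤ² → ℤ
    square n = (d ℤ.- weight u v n) ℤ.* (d ℤ.- weight u v n)
    scaled : fromℤ d * (fromℤ d * sumℚ (map (λ n → F n * F n) L)) ≡ fromℤ (sumℤ (map square L))
    scaled = trans (sym (ℚ.*-assoc (fromℤ d) (fromℤ d) _)) (scale-sum (fromℤ d * fromℤ d) (λ n → F n * F n) square L
      (All.tabulate λ {n} n∈ → trans (poly (fromℤ d) (F n)) (trans (cong (λ z → z * z) (F≡ n (Equivalence.to (L⇔ n) n∈)))
        (sym (fromℤ-* (d ℤ.- weight u v n) (d ℤ.- weight u v n))))))
      where
      poly : ∀ d f → d * d * (f * f) ≡ (d * f) * (d * f)
      poly = solve-∀ ℚ-ring
    formula : ∃[ n ] d ≡ + suc n → ∃[ q′ ] detℤ q v ≡ + q′ →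
      fromℤ (+ 12) * (fromℤ d * (fromℤ d * sumℚ (map (λ n → F n * F n) L))) ≡
      fromℤ (d ℤ.* total c)
    formula (n , d≡) (q′ , q≡) = trans (cong (fromℤ (+ 12) *_) scaled) (trans (sym (fromℤ-* (+ 12) (sumℤ (map square L)))) (cong fromℤ
      (trans (cong (+ 12 ℤ.*_) (trans (sumℤ-↭ square (unique⇒↭ L! slices-unique (λ {x} → mk⇔
          (λ x∈ → triangle°⇒slices (Equivalence.to (L⇔ x) x∈)) (λ x∈ → Equivalence.from (L⇔ x) (slices⇒triangle° x∈)))))
        (trans (cong (λ z → sumℤ (map (λ x → (z ℤ.- weight u v x) ℤ.* (z ℤ.- weight u v x)) slices)) d≡) sum-slices)))
      (trans (defect-sum c n q′ d≡ q≡) (cong₂ (λ z y → z ℤ.* (z ℤ.* z ℤ.+ + 2 ℤ.+ z ℤ.* (excess c ℤ.- size c ℤ.- + 2) ℤ.+ y ℤ.+ detℤ u (penultimate c)))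
        (sym d≡) (sym q≡))))))
      where open Slice c n q′ d≡ q≡

  dual-scaled : ∀ u v M → ⟨ M , ι u ⟩ ≡ - 1ℚ → ⟨ M , ι v ⟩ ≡ - 1ℚ → ∀ x →
                fromℤ (detℤ u v) * (1ℚ + ⟨ M , ι x ⟩) ≡ fromℤ (detℤ u v ℤ.- weight u v x)
  dual-scaled u v M Mu Mv x = trans (ℚ.*-distribˡ-+ d 1ℚ ⟨ M , ι x ⟩) (trans (cong₂ _+_ (ℚ.*-identityʳ d)
    (trans (cong (_* ⟨ M , ι x ⟩) (sym (det-ι u v))) (trans (sym (⟨⟩-• M (det (ι u) (ι v)) (ι x)))
      (trans (cong ⟨ M ,_⟩ (cramerℚ (ι u) (ι v) (ι x))) (trans (⟨⟩-combination M (det (ι x) (ι v)) (det (ι u) (ι x)) (ι u) (ι v))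
      (trans (cong₂ (λ y z → det (ι x) (ι v) * y + det (ι u) (ι x) * z) Mu Mv)
      (trans (poly (det (ι x) (ι v)) (det (ι u) (ι x))) (cong -_ (det+det-ι x v u x)))))))))
    (sym (fromℤ-- (detℤ u v) (weight u v x))))
    where
    d = fromℤ (detℤ u v)
    poly : ∀ a b → a * - 1ℚ + b * - 1ℚ ≡ - (a + b)
    poly = solve-∀ ℚ-ring

  cone-formula : ∀ {v u q} (c : Chain v u q) L → Unique L → (∀ n → n ∈ L ⇔ Triangle°ℤ u v n) →
    (F : ℤ² → ℚ) → (∀ n → Triangle°ℤ u v n → fromℤ (detℤ u v) * F n ≡ fromℤ (detℤ u v ℤ.- weight u v n)) →
    ∀ S → (∀ n → n ∈ S ⇔ LatticePoint u v n) →
    ∀ M → ⟨ M , ι u ⟩ ≡ - 1ℚ → ⟨ M , ι v ⟩ ≡ - 1ℚ →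
    (vol : ℚ² → ℚ² → ℚ) → (∀ x y → orient M x y ≤ 0ℚ → vol x y ≡ - orient M x y) →
    ∀ r (p : Fin (suc (suc r)) → ℤ²) (m : Fin (suc r) → ℤ²) → tabulate p ≡ points c →
    (∀ i → ⟨ ι (m i) , ι (p (inject₁ i)) ⟩ ≡ - 1ℚ) →
    (∀ i → ⟨ ι (m i) , ι (p (Fin.suc i)) ⟩ ≡ - 1ℚ) →
    fromℤ (+ 12) * sumℚ (map (λ n → F n * F n) L) ≡
    v-conv (map ι S) + sumℚ (tabulate (λ (i : Fin r) → vol (ι (m (inject₁ i))) (ι (m (Fin.suc i)))))
  cone-formula {v} {u} {q} c L L! L⇔ F F≡ S S⇔ M Mu Mv vol vol≡ r p m p≡ left right =
    -- The factor d² makes the squared summands integral, and `total c` already contains one of the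
    -- two factors d.
    ℚO.*-cancel 0<d (ℚO.*-cancel 0<d (begin
      d * (d * (fromℤ (+ 12) * T))
        ≡⟨ poly d (fromℤ (+ 12)) T ⟩
      fromℤ (+ 12) * (d * (d * T))
        ≡⟨ interior-sum c L L! L⇔ F F≡ ⟩
      fromℤ (dℤ ℤ.* R)
        ≡⟨ fromℤ-* dℤ R ⟩
      d * fromℤ R
        ≡⟨ cong (λ z → d * fromℤ z) (volume-side c) ⟨
      d * fromℤ (dℤ ℤ.* (dℤ ℤ.- size c) ℤ.+ weighted (λ x → dℤ ℤ.- weight u v x) c)
        ≡⟨ cong (d *_) (trans (fromℤ-+ (dℤ ℤ.* (dℤ ℤ.- size c)) (weighted (λ x → dℤ ℤ.- weight u v x) c))
             (cong₂ _+_ (fromℤ-* dℤ (dℤ ℤ.- size c)) (sym scaled-dual))) ⟩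
      d * (d * fromℤ (dℤ ℤ.- size c) + d * W)
        ≡⟨ cong (d *_) (sym (ℚ.*-distribˡ-+ d (fromℤ (dℤ ℤ.- size c)) W)) ⟩
      d * (d * (fromℤ (dℤ ℤ.- size c) + W))
        ≡⟨ cong (λ z → d * (d * z)) (cong₂ _+_ (sym (v-conv-polygon c S S⇔)) (sym duals)) ⟩
      d * (d * (v-conv (map ι S) + D)) ∎))
    where
    open ≡-Reasoning
    dℤ R : ℤ
    dℤ = detℤ u v
    R = total c
    d T W D : ℚ
    d = fromℤ dℤ
    T = sumℚ (map (λ n → F n * F n) L)
    W = weightedℚ (λ x → 1ℚ + ⟨ M , ι x ⟩) c
    D = sumℚ (tabulate (λ (i : Fin r) → vol (ι (m (inject₁ i))) (ι (m (Fin.suc i)))))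
    0<d : 0ℚ < d
    0<d = fromℤ-mono-< (det-end>0 c)
    poly : ∀ d k t → d * (d * (k * t)) ≡ k * (d * (d * t))
    poly = solve-∀ ℚ-ring
    scaled-dual : d * W ≡ fromℤ (weighted (λ x → dℤ ℤ.- weight u v x) c)
    scaled-dual = scale-weighted dℤ (λ x → 1ℚ + ⟨ M , ι x ⟩) (λ x → dℤ ℤ.- weight u v x) c (dual-scaled u v M Mu Mv)
    duals : D ≡ W
    duals = dual-sum c M vol vol≡ (All.tabulate λ {x} x∈ → ℚO.0≤-cancel 0<d (subst (0ℚ ≤_) (sym (dual-scaled u v M Mu Mv x))
      (fromℤ-mono-≤ (ℤO.diff (proj₂ (proj₂ (proj₁ (chain-points c x∈)))))))) r p m p≡ left right

  opposite-inject₁ : ∀ {n} (i : Fin n) → Fin.opposite (inject₁ i) ≡ Fin.suc (Fin.opposite i)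
  opposite-inject₁ {suc n} Fin.zero    = refl
  opposite-inject₁ {suc n} (Fin.suc i) = cong inject₁ (opposite-inject₁ i)

  sum-opposite : ∀ {n} (f : Fin n → ℚ) → sumℚ (tabulate f) ≡ sumℚ (tabulate (f ∘ Fin.opposite))
  sum-opposite {n} f = trans (cong sumℚ (sym (List.map-tabulate id f)))
    (trans (sumℚ-↭ f (unique⇒↭ (allFin⁺ n) (map⁺ injective (allFin⁺ n)) (λ {i} → mk⇔
       (λ _ → subst (_∈ map Fin.opposite (allFin n)) (Fin.opposite-involutive i) (∈-map⁺ Fin.opposite (∈-allFin (Fin.opposite i))))
       (λ _ → ∈-allFin i))))
    (cong sumℚ (trans (sym (List.map-∘ (allFin n))) (List.map-tabulate id (f ∘ Fin.opposite)))))
    where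
    injective : ∀ {i j : Fin n} → Fin.opposite i ≡ Fin.opposite j → i ≡ j
    injective {i} {j} eq = trans (sym (Fin.opposite-involutive i)) (trans (cong Fin.opposite eq) (Fin.opposite-involutive j))

  opposite-< : ∀ {n} {i j : Fin n} → i Fin.< j → Fin.opposite j Fin.< Fin.opposite i
  opposite-< {n} {i} {j} i<j = subst₂ ℕ._<_ (sym (Fin.opposite-prop j)) (sym (Fin.opposite-prop i))
    (ℕ.∸-monoʳ-< (s≤s i<j) (Fin.toℕ<n j))

  module Edge (P : LDPPolygon) (σ : Cone₂ P) where
    open LDPPolygon P
    open Cone₂ σ

    support : ℚ²
    support = proj₁ edge

    level : ℚ
    level = proj₁ (proj₂ edge)

    support-bound : ∀ x → Δ x → ⟨ support , x ⟩ ≤ level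
    support-bound = proj₁ (proj₂ (proj₂ edge))

    edge⇔ : ∀ x → conv (ι u₁ ∷ ι u₂ ∷ []) x ⇔ (Δ x × ⟨ support , x ⟩ ≡ level)
    edge⇔ = proj₂ (proj₂ (proj₂ edge))

    support-u₁ : ⟨ support , ι u₁ ⟩ ≡ level
    support-u₁ = proj₂ (Equivalence.to (edge⇔ (ι u₁)) (vertex-conv (here refl)))

    support-u₂ : ⟨ support , ι u₂ ⟩ ≡ level
    support-u₂ = proj₂ (Equivalence.to (edge⇔ (ι u₂)) (vertex-conv (there (here refl))))

    level>0 : 0ℚ < level
    level>0 = support-positive Δ support level (ι u₁) (ι u₂) (λ eq → u₁≢u₂ (ι-injective eq)) support-bound edge⇔ origin-interior

    cone-det≢0 : detℤ u₂ u₁ ≢ 0ℤ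
    cone-det≢0 = det≢0 u₂ u₁ support level u₂-primitive (λ eq → u₁≢u₂ (sym eq)) level>0 support-u₂ support-u₁

    -- (u , v) is (u₂ , u₁) or (u₁ , u₂), whichever is positively oriented.
    module Oriented (u v : ℤ²) (u-primitive : Primitive u) (v-primitive : Primitive v) (0<d : 0ℤ ℤ.< detℤ u v)
      (u∈ : ι u ∈ (ι u₁ ∷ ι u₂ ∷ [])) (v∈ : ι v ∈ (ι u₁ ∷ ι u₂ ∷ []))
      (only : ∀ {x} → x ∈ (ι u₁ ∷ ι u₂ ∷ []) → x ≡ ι u ⊎ x ≡ ι v)
      (κ : ℚ² → ℚ) (isκ : IsKappa P κ)
      (L : List ℤ²) (L⇔ : Enumerates L (λ n → ∇° (ι n))) (S : List ℤ²) (S⇔ : Enumerates S NonzeroLatticePoint)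
      (r : ℕ) (p : Fin (suc (suc r)) → ℤ²) (p-complete : ∀ n → SailPoint n ⇔ (∃[ i ] p i ≡ n))
      (p-ordered : ∀ {i j} → i Fin.< j → 0ℤ ℤ.< detℤ (p i) (p j))
      (M : ℚ²) (Mu : ⟨ M , ι u ⟩ ≡ - 1ℚ) (Mv : ⟨ M , ι v ⟩ ≡ - 1ℚ)
      (vol : ℚ² → ℚ² → ℚ) (vol≡ : ∀ x y → orient M x y ≤ 0ℚ → vol x y ≡ - orient M x y)
      (m : Fin (suc r) → ℤ²)
      (left : ∀ i → ⟨ ι (m i) , ι (p (inject₁ i)) ⟩ ≡ - 1ℚ)
      (right : ∀ i → ⟨ ι (m i) , ι (p (Fin.suc i)) ⟩ ≡ - 1ℚ) where

      0<det : 0ℚ < det (ι u) (ι v)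
      0<det = subst (0ℚ <_) (sym (det-ι u v)) (fromℤ-mono-< 0<d)

      vertices⊆ : ∀ y → y ∈ (0ℚ² ∷ ι u₁ ∷ ι u₂ ∷ []) → InTriangle (ι u) (ι v) y
      vertices⊆ y (here refl) = triangle-0 (ι u) (ι v) 0<det
      vertices⊆ y (there y∈)  = vertex (only y∈)
        where
        vertex : ∀ {y} → y ≡ ι u ⊎ y ≡ ι v → InTriangle (ι u) (ι v) y
        vertex (inj₁ refl) = triangle-u (ι u) (ι v) 0<det
        vertex (inj₂ refl) = triangle-v (ι u) (ι v) 0<det

      ∇⇔ : ∀ x → ∇ x ⇔ InTriangle (ι u) (ι v) x
      ∇⇔ x = mk⇔ (conv⇒triangle (ι u) (ι v) vertices⊆ x) (triangle⇒conv (ι u) (ι v) 0<det (here refl) (there u∈) (there v∈) x)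

      ∇°⇔ : ∀ n → ∇° (ι n) ⇔ Triangle°ℤ u v n
      ∇°⇔ n = mk⇔
        (λ n∈ → Equivalence.to (triangle°-ι u v n) (Equivalence.to (interior⇔triangle° (ι u) (ι v) 0<det ∇⇔ (ι n)) n∈))
        (λ n∈ → Equivalence.from (interior⇔triangle° (ι u) (ι v) 0<det ∇⇔ (ι n)) (Equivalence.from (triangle°-ι u v n) n∈))

      q : ℤ²
      q = proj₁ (chain-exists u v u-primitive v-primitive 0<d)

      chain : Chain v u q
      chain = proj₂ (chain-exists u v u-primitive v-primitive 0<d)

      p≡chain : tabulate p ≡ points chain
      p≡chain = sorted-unique (λ {x} {y} → det-asym {x} {y}) (AllPairs.tabulate⁺-< {f = p} p-ordered) (ordered chain) (λ {n} → mk⇔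
        (λ n∈ → let i , n≡ = ∈-tabulate⁻ {f = p} n∈ in Equivalence.to (sail⇔points chain ∇ ∇⇔ n) (Equivalence.from (p-complete n) (i , sym n≡)))
        (λ n∈ → let i , p≡ = Equivalence.to (p-complete n) (Equivalence.from (sail⇔points chain ∇ ∇⇔ n) n∈)
                in subst (_∈ tabulate p) p≡ (∈-tabulate⁺ {f = p} i)))

      segment⊆Δ : ∀ a b → 0ℚ ≤ a → 0ℚ ≤ b → a + b ≡ 1ℚ → Δ (a • ι u ⊕ b • ι v)
      segment⊆Δ a b 0≤a 0≤b a+b≡1 = proj₁ (Equivalence.to (edge⇔ (a • ι u ⊕ b • ι v)) (segment-conv a b u∈ v∈ 0≤a 0≤b a+b≡1))

      support-end : ∀ {x} → x ∈ (ι u₁ ∷ ι u₂ ∷ []) → ⟨ support , x ⟩ ≡ level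
      support-end (here refl)         = support-u₁
      support-end (there (here refl)) = support-u₂

      kappa+1 : ∀ n → Triangle°ℤ u v n → fromℤ (detℤ u v) * (κ (ι n) + 1ℚ) ≡ fromℤ (detℤ u v ℤ.- weight u v n)
      kappa+1 n n∈ = trans (ℚ.*-distribˡ-+ d (κ (ι n)) 1ℚ) (trans (cong₂ _+_
        (trans (cong (_* κ (ι n)) (sym (det-ι u v)))
          (trans (kappa-formula P κ isκ support level (ι u) (ι v) level>0 support-bound (support-end u∈) (support-end v∈)
                   segment⊆Δ 0<det (ι n) (Equivalence.from (triangle°-ι u v n) n∈))
                 (cong -_ (det+det-ι n v u n))))
        (ℚ.*-identityʳ d)) (trans (ℚ.+-comm (- fromℤ (weight u v n)) d) (sym (fromℤ-- (detℤ u v) (weight u v n)))))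
        where
        d = fromℤ (detℤ u v)

      formula : fromℤ (+ 12) * sumℚ (map (λ n → (κ (ι n) + 1ℚ) * (κ (ι n) + 1ℚ)) L) ≡
                v-conv (map ι S) + sumℚ (tabulate (λ (i : Fin r) → vol (ι (m (inject₁ i))) (ι (m (Fin.suc i)))))
      formula = cone-formula chain L (proj₁ L⇔)
        (λ n → mk⇔ (λ n∈ → Equivalence.to (∇°⇔ n) (Equivalence.to (proj₂ L⇔ n) n∈))
                   (λ n∈ → Equivalence.from (proj₂ L⇔ n) (Equivalence.from (∇°⇔ n) n∈)))
        (λ n → κ (ι n) + 1ℚ) kappa+1 S
        (λ n → mk⇔ (λ n∈ → let ∇n , n≢0 = Equivalence.to (proj₂ S⇔ n) n∈
                            in Equivalence.to (triangle-ι u v n) (Equivalence.to (∇⇔ (ι n)) ∇n) , n≢0)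
                   (λ (n∈ , n≢0) → Equivalence.from (proj₂ S⇔ n)
                     (Equivalence.from (∇⇔ (ι n)) (Equivalence.from (triangle-ι u v n) n∈) , n≢0)))
        M Mu Mv vol vol≡ r p m p≡chain left right

open ConeFormula

open import Data.Rational.Base using (1ℚ; _+_; _*_; -_; _/_; _≤_)

theorem3p4 : (P : LDPPolygon) (σ : Cone₂ P) →
    let open Cone₂ σ in
    (κ : ℚ² → ℚ) → IsKappa P κ →
    (interiorPoints : List ℤ²) → Enumerates interiorPoints (λ n → ∇° (ι n)) →
    (nonzeroPoints : List ℤ²) → Enumerates nonzeroPoints NonzeroLatticePoint →
    (r : ℕ) (sail : SailPoints σ r) →
    let open SailPoints sail in
    (mσ : ℚ²) → ⟨ mσ , ι u₁ ⟩ ≡ - 1ℚ → ⟨ mσ , ι u₂ ⟩ ≡ - 1ℚ →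
    (m : Fin (suc r) → ℤ²) →
    (∀ i → ⟨ ι (m i) , ι (p (inject₁ i)) ⟩ ≡ - 1ℚ) →
    (∀ i → ⟨ ι (m i) , ι (p (Fin.suc i)) ⟩ ≡ - 1ℚ) →
    (+ 12 / 1) * sumℚ (map (λ n → (κ (ι n) + 1ℚ) * (κ (ι n) + 1ℚ)) interiorPoints)
    ≡ v-conv (map ι nonzeroPoints)
    + sumℚ (tabulate (λ (i : Fin r) →
    v-conv (mσ ∷ ι (m (inject₁ i)) ∷ ι (m (Fin.suc i)) ∷ [])))
theorem3p4 P σ κ isκ L L⇔ S S⇔ r sail M M₁ M₂ m left right = decide (ℤ.<-cmp 0ℤ (detℤ u₂ u₁))
  where
  open Cone₂ σ
  open SailPoints sail
  open Edge P σ
  decide : _ → _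
  decide (tri< 0<d _ _) = Oriented.formula u₂ u₁ u₂-primitive u₁-primitive 0<d (there (here refl)) (here refl)
    (λ { (here eq) → inj₂ eq ; (there (here eq)) → inj₁ eq }) κ isκ L L⇔ S S⇔ r p p-complete
    (λ {i} {j} i<j → ℤO.0<-cancel (ℤ.<⇒≤ 0<d) (p-ordered i j i<j)) M M₂ M₁
    (λ x y → v-conv (M ∷ x ∷ y ∷ [])) (λ x y → v-conv-negative M x y) m left right
  decide (tri≈ _ 0≡d _) = contradiction (sym 0≡d) cone-det≢0
  -- For the other orientation u₁ and u₂ exchange roles, and the sail points and dual vectors are
  -- reversed by `Fin.opposite`. This exchanges `left` with `right` and swaps the last two vertices
  -- of each dual triangle.
  decide (tri> _ _ d<0) = trans
    (Oriented.formula u₁ u₂ u₁-primitive u₂-primitive 0<d′ (here refl) (there (here refl))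
      (λ { (here eq) → inj₁ eq ; (there (here eq)) → inj₂ eq }) κ isκ L L⇔ S S⇔ r (p ∘ Fin.opposite)
      (λ n → mk⇔ (λ n∈ → let i , eq = Equivalence.to (p-complete n) n∈ in Fin.opposite i , trans (cong p (Fin.opposite-involutive i)) eq)
                 (λ (i , eq) → Equivalence.from (p-complete n) (Fin.opposite i , eq)))
      (λ {i} {j} i<j → ℤO.0<-cancel (ℤ.<⇒≤ 0<d′) (subst (0ℤ ℤ.<_) (flip (p (Fin.opposite i)) (p (Fin.opposite j)))
        (p-ordered (Fin.opposite j) (Fin.opposite i) (opposite-< i<j)))) M M₁ M₂
      (λ x y → v-conv (M ∷ y ∷ x ∷ [])) swapped (m ∘ Fin.opposite)
      (λ i → subst (λ k → ⟨ ι (m (Fin.opposite i)) , ι (p k) ⟩ ≡ - 1ℚ) (sym (opposite-inject₁ i)) (right (Fin.opposite i)))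
      (λ i → left (Fin.opposite i)))
    (cong (_+_ (v-conv (map ι S))) (sym (trans (sum-opposite (λ i → v-conv (M ∷ ι (m (inject₁ i)) ∷ ι (m (Fin.suc i)) ∷ [])))
      (cong sumℚ (List.tabulate-cong (λ i → cong (λ k → v-conv (M ∷ ι (m (inject₁ (Fin.opposite i))) ∷ ι (m k) ∷ [])) (sym (opposite-inject₁ i))))))))
    where
    0<d′ : 0ℤ ℤ.< detℤ u₁ u₂
    0<d′ = subst (0ℤ ℤ.<_) (sym (det-anti u₂ u₁)) (ℤ.neg-mono-< d<0)
    flip : ∀ x y → detℤ u₂ u₁ ℤ.* detℤ y x ≡ detℤ u₁ u₂ ℤ.* detℤ x y
    flip x y = trans (cong₂ ℤ._*_ (det-anti u₁ u₂) (det-anti x y)) (poly (detℤ u₁ u₂) (detℤ x y))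
      where
      poly : ∀ a b → ℤ.- a ℤ.* ℤ.- b ≡ a ℤ.* b
      poly = solve-∀ ℤ-ring
    orient-swap′ : ∀ x y → orient M y x ≡ - orient M x y
    orient-swap′ x y = trans (orient-rotate x M y) (orient-swap M x y)
    swapped : ∀ x y → orient M x y ≤ 0ℚ → v-conv (M ∷ y ∷ x ∷ []) ≡ - orient M x y
    swapped x y o≤0 = trans (v-conv-positive M y x (subst (0ℚ ≤_) (sym (orient-swap′ x y)) (ℚ.neg-antimono-≤ o≤0))) (orient-swap′ x y)
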